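{- Let $\mu$ be a diagram with $d$ boxes on the main diagonal. The Schur function $s_\mu(x)$ has the expansion $$s_\mu(x)=\sum_\lambda(-1)^{m(\lambda/\mu)}\,\psi_{\lambda/\mu}(a)\,\widehat s_\lambda(x\|a),$$ summed over diagrams $\lambda$ which contain $\mu$ and such that $\lambda$ has $d$ boxes on the main diagonal, where $m(\lambda/\mu)$ denotes the total number of boxes of $\lambda/\mu$ in rows $1,\dots,d$, and $\widehat s_\lambda(x\|a)$ are the dual Schur functions.
   Context: Let $a=(a_i)_{i\in\mathbb Z}$ be a sequence of commuting indeterminates and $\mathbb Q[a]$ the polynomial ring in the $a_i$; $x=(x_1,x_2,\dots)$. Dual Schur functions: let $\widehat\Lambda(x\|a)$ be the ring of formal (possibly infinite) sums $\sum_{\lambda}c_\lambda(a)s_\lambda(x)$, $c_\lambda(a)\in\mathbb Q[a]$, with $s_\lambda(x)$ the ordinary Schur functions. For a partition $\lambda$ with $d$ boxes on the main diagonal and $n\geqslant\ell(\lambda)$, $$\widehat s_\lambda(x_1,\dots,x_n\|a)=\frac{\det[A_{ij}]_{i,j=1}^n}{\prod_{1\leqslant i<j\leqslant n}(x_i-x_j)},$$ where $A_{ij}=\dfrac{x_i^{\lambda_j+n-j}}{(1-a_0x_i)(1-a_{ -1}x_i)\cdots(1-a_{j-\lambda_j}x_i)}$ for $1\leqslant j\leqslant d$ and $A_{ij}=x_i^{\lambda_j+n-j}(1-a_1x_i)\cdots(1-a_{j-\lambda_j-1}x_i)$ for $d<j\leqslant n$; it is $0$ if $\ell(\lambda)>n$.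 These are compatible with setting $x_n=0$ and define $\widehat s_\lambda(x\|a)\in\widehat\Lambda(x\|a)$. Suppose $\mu\subseteq\lambda$ both have $d$ boxes on the main diagonal. A dual hook $\lambda/\mu$-tableau is a filling $T$ of the boxes of $\lambda/\mu$ with integers such that: the entries in the first $d$ rows strictly decrease along the rows and weakly decrease down the columns, and all entries in row $i$ belong to $\{0,-1,\dots,i-\lambda_i+1\}$ for $i=1,\dots,d$; the entries in the first $d$ columns strictly increase down the columns and weakly increase along the rows, and all entries in column $j$ belong to $\{1,2,\dots,\lambda'_j-j\}$ for $j=1,\dots,d$ ($\lambda'$ is the conjugate of $\lambda$). Then $\psi_{\lambda/\mu}(a)=\sum_T\prod_{\alpha\in\lambda/\mu}a_{T(\alpha)}$, summed over the dual hook $\lambda/\mu$-tableaux $T$. -}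

module Defs where

open import Algebra.Bundles using (RawRing; CommutativeRing)
open import Data.Bool.Base using (if_then_else_)
open import Data.Fin.Base using (Fin; zero; suc; toℕ; punchIn)
open import Data.Fin.Properties using () renaming (_<?_ to _<ᶠ?_)
open import Data.Integer.Base as ℤ using (ℤ; +_)
open import Data.Integer.Properties using () renaming (_<?_ to _<ᶻ?_; _≤?_ to _≤ᶻ?_)
open import Data.List.Base using (List; []; _∷_; length; filter; map; foldr; upTo; concatMap; allFin; cartesianProduct)
open import Data.List.Membership.Propositional using (_∈_; _∉_)
open import Data.List.Relation.Unary.All using (All; all?)
open import Data.List.Relation.Unary.Linked using (Linked)
open import Data.List.Relation.Unary.Unique.Propositional using (Unique)
open import Data.Nat.Base as ℕ using (ℕ; zero; suc; _∸_; _≤_; _<_; _≥_)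
open import Data.Nat.Properties using (_≟_; _≤?_; _<?_)
open import Data.Product using (∃-syntax; _×_; _,_)
open import Data.Product.Properties using (≡-dec)
open import Data.Rational.Base as ℚ using (ℚ; 0ℚ; 1ℚ)
open import Data.Vec.Base using (Vec; []; _∷_; lookup; _[_]%=_)
open import Level using (0ℓ)
open import Relation.Binary.PropositionalEquality using (_≡_)
open import Relation.Nullary.Decidable using (Dec; does; _×-dec_; _→-dec_)

-- ℚ[a] is the free commutative ℚ-algebra on the set {aₖ ∣ k ∈ ℤ}: ring
-- expressions modulo the least congruence containing the axioms of
-- commutative rings and making con : ℚ → ℚ[a] a ring homomorphism.

infixl 6 _⊕_
infixl 7 _⊗_
infix  8 ⊝_
infix  4 _≋_

data Poly : Set where
  con : ℚ → Poly
  var : ℤ → Poly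
  _⊕_ _⊗_ : Poly → Poly → Poly
  ⊝_ : Poly → Poly

data _≋_ : Poly → Poly → Set where
  ≋-refl  : ∀ {p} → p ≋ p
  ≋-sym   : ∀ {p q} → p ≋ q → q ≋ p
  ≋-trans : ∀ {p q r} → p ≋ q → q ≋ r → p ≋ r
  ⊕-cong  : ∀ {p p′ q q′} → p ≋ p′ → q ≋ q′ → p ⊕ q ≋ p′ ⊕ q′
  ⊗-cong  : ∀ {p p′ q q′} → p ≋ p′ → q ≋ q′ → p ⊗ q ≋ p′ ⊗ q′
  ⊝-cong  : ∀ {p p′} → p ≋ p′ → ⊝ p ≋ ⊝ p′
  ⊕-assoc : ∀ p q r → (p ⊕ q) ⊕ r ≋ p ⊕ (q ⊕ r)
  ⊕-comm  : ∀ p q → p ⊕ q ≋ q ⊕ p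
  ⊕-identityˡ : ∀ p → con 0ℚ ⊕ p ≋ p
  ⊝-inverseˡ  : ∀ p → ⊝ p ⊕ p ≋ con 0ℚ
  ⊗-assoc : ∀ p q r → (p ⊗ q) ⊗ r ≋ p ⊗ (q ⊗ r)
  ⊗-comm  : ∀ p q → p ⊗ q ≋ q ⊗ p
  ⊗-identityˡ : ∀ p → con 1ℚ ⊗ p ≋ p
  ⊗-distribˡ-⊕ : ∀ p q r → p ⊗ (q ⊕ r) ≋ (p ⊗ q) ⊕ (p ⊗ r)
  con-+ : ∀ x y → con (x ℚ.+ y) ≋ con x ⊕ con y
  con-* : ∀ x y → con (x ℚ.* y) ≋ con x ⊗ con y

ℚ[a] : CommutativeRing 0ℓ 0ℓ
ℚ[a] = record
  { Carrier = Poly ; _≈_ = _≋_ ; _+_ = _⊕_ ; _*_ = _⊗_ ; -_ = ⊝_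
  ; 0# = con 0ℚ ; 1# = con 1ℚ
  ; isCommutativeRing = record
    { isRing = record
      { +-isAbelianGroup = record
        { isGroup = record
          { isMonoid = record
            { isSemigroup = record
              { isMagma = record
                { isEquivalence = record
                  { refl = ≋-refl ; sym = ≋-sym ; trans = ≋-trans }
                ; ∙-cong = ⊕-cong }
              ; assoc = ⊕-assoc }
            ; identity = ⊕-identityˡ ,
                λ p → ≋-trans (⊕-comm p _) (⊕-identityˡ p) }
          ; inverse = ⊝-inverseˡ ,
              λ p → ≋-trans (⊕-comm p _) (⊝-inverseˡ p)
          ; ⁻¹-cong = ⊝-cong }
        ; comm = ⊕-comm }
      ; *-cong = ⊗-cong
      ; *-assoc = ⊗-assoc
      ; *-identity = ⊗-identityˡ ,
          λ p → ≋-trans (⊗-comm p _) (⊗-identityˡ p)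
      ; distrib = ⊗-distribˡ-⊕ ,
          λ p q r → ≋-trans (⊗-comm _ p) (≋-trans (⊗-distribˡ-⊕ p q r)
                      (⊕-cong (⊗-comm p q) (⊗-comm p r))) }
    ; *-comm = ⊗-comm } }

record Partition : Set where
  constructor partition
  field
    parts       : List ℕ
    .decreasing : Linked _≥_ parts
    .positive   : All (0 <_) parts

open Partition public

ℓ : Partition → ℕ
ℓ lam = length (parts lam)

nth : List ℕ → ℕ → ℕ
nth []       _       = 0
nth (p ∷ ps) zero    = p
nth (p ∷ ps) (suc i) = nth ps i

-- Rows and columns are numbered from 1: part lam i is λᵢ for i ≥ 1, which is 0
-- for i > ℓ(λ).  (part lam 0 = λ₁ is a harmless junk value.)
part : Partition → ℕ → ℕ
part lam i = nth (parts lam) (i ∸ 1)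

-- λ′ⱼ for j ≥ 1
conj : Partition → ℕ → ℕ
conj lam j = length (filter (j ≤?_) (parts lam))

1…_ : ℕ → List ℕ
1… n = map suc (upTo n)

infix 4 _⊆_
_⊆_ : Partition → Partition → Set
μ ⊆ lam = ∀ i → part μ i ≤ part lam i

diag : Partition → ℕ
diag lam = length (filter (λ i → i ≤? part lam i) (1… ℓ lam))

Box : Set
Box = ℕ × ℕ

boxes : Partition → List Box
boxes lam = concatMap (λ i → map (i ,_) (1… part lam i)) (1… ℓ lam)

skew : Partition → Partition → List Box
skew lam μ = filter (λ { (i , j) → part μ i <? j }) (boxes lam)

m : ℕ → Partition → Partition → ℕ
m d lam μ = length (filter (λ { (i , j) → i ≤? d }) (skew lam μ))

-- From here to dualHookTableaux, λ and μ are meant to have d diagonal boxes; a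
-- box (i , j) of λ/μ then satisfies either i ≤ d < j or j ≤ d < i.

-- The set {0, -1, …, i - λᵢ + 1} if i ≤ d, and {1, 2, …, λ′ⱼ - j} if j ≤ d.
entries : ℕ → Partition → Box → List ℤ
entries d lam (i , j) =
  if does (i ≤? d)
  then map (λ k → ℤ.- (+ k)) (upTo (part lam i ∸ i))
  else map +_ (1… (conj lam j ∸ j))

_≟ᴮ_ : (b c : Box) → Dec (b ≡ c)
_≟ᴮ_ = ≡-dec _≟_ _≟_

-- A filling is a function on all of ℕ × ℕ whose values off the shape are 0;
-- for a duplicate-free list bs, fillings E bs lists exactly once each filling
-- T of the boxes bs with T b in the list E b.
fillings : (Box → List ℤ) → List Box → List (Box → ℤ)
fillings E []       = (λ _ → + 0) ∷ []
fillings E (b ∷ bs) = concatMap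
  (λ v → map (λ T c → if does (c ≟ᴮ b) then v else T c) (fillings E bs)) (E b)

Compatible : ℕ → (Box → ℤ) → Box → Box → Set
Compatible d T b@(i , j) c@(i′ , j′) =
    (i ≡ i′ → j < j′ → i ≤ d → T c ℤ.< T b)
  × (j ≡ j′ → i < i′ → i′ ≤ d → T c ℤ.≤ T b)
  × (j ≡ j′ → i < i′ → j ≤ d → T b ℤ.< T c)
  × (i ≡ i′ → j < j′ → j′ ≤ d → T b ℤ.≤ T c)

compatible? : ∀ d T b c → Dec (Compatible d T b c)
compatible? d T b@(i , j) c@(i′ , j′) =
    ((i ≟ i′) →-dec ((j <? j′) →-dec ((i ≤? d) →-dec (T c <ᶻ? T b))))
  ×-dec ((j ≟ j′) →-dec ((i <? i′) →-dec ((i′ ≤? d) →-dec (T c ≤ᶻ? T b))))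
  ×-dec ((j ≟ j′) →-dec ((i <? i′) →-dec ((j ≤? d) →-dec (T b <ᶻ? T c))))
  ×-dec ((i ≟ i′) →-dec ((j <? j′) →-dec ((j′ ≤? d) →-dec (T b ≤ᶻ? T c))))

IsTableau : ℕ → List Box → (Box → ℤ) → Set
IsTableau d bs T = All (λ b → All (Compatible d T b) bs) bs

isTableau? : ∀ d bs T → Dec (IsTableau d bs T)
isTableau? d bs T = all? (λ b → all? (compatible? d T b) bs) bs

dualHookTableaux : ℕ → Partition → Partition → List (Box → ℤ)
dualHookTableaux d lam μ =
  filter (isTableau? d (skew lam μ)) (fillings (entries d lam) (skew lam μ))

-- Instantiated at the end with R = ℚ[a] and the indeterminates aₖ.
module DualSchur {c r} (R : CommutativeRing c r)
                 (a : ℤ → CommutativeRing.Carrier R) where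

  open CommutativeRing R using (_≈_; rawRing) renaming (Carrier to C)

  module Ops {c r} (S : RawRing c r) where
    open RawRing S public
    open import Algebra.Definitions.RawSemiring rawSemiring public
      using (_^_; sum)

    sumᴸ prodᴸ : ∀ {t} {X : Set t} → (X → Carrier) → List X → Carrier
    sumᴸ  f = foldr (λ x y → f x + y) 0#
    prodᴸ f = foldr (λ x y → f x * y) 1#

    det : ∀ {n} → (Fin n → Fin n → Carrier) → Carrier
    det {zero}  M = 1#
    det {suc n} M = sum λ j → ((- 1#) ^ toℕ j) *
      (M zero j * det (λ i k → M (suc i) (punchIn j k)))

  private module R = Ops rawRing

  ψ : ℕ → Partition → Partition → C
  ψ d lam μ =
    R.sumᴸ (λ T → R.prodᴸ (λ b → a (T b)) (skew lam μ)) (dualHookTableaux d lam μ)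

  -- Formal power series in x₁, …, xₙ: α ↦ coefficient of x^α
  Series : ℕ → Set c
  Series n = Vec ℕ n → C

  one : ∀ {n} → Series n
  one []          = R.1#
  one (zero ∷ α)  = one α
  one (suc _ ∷ α) = R.0#

  -- The series f(xᵢ), for f(t) = Σₖ f k · tᵏ
  at : ∀ {n} → Fin n → (ℕ → C) → Series n
  at zero    f (k     ∷ α) = f k R.* one α
  at (suc i) f (zero  ∷ α) = at i f α
  at (suc i) f (suc _ ∷ α) = R.0#

  conv : ∀ {n} → Series n → Series n → Series n
  conv f g []      = f [] R.* g []
  conv f g (k ∷ α) = R.sum {suc k} λ l →
    conv (λ β → f (toℕ l ∷ β)) (λ β → g (k ∸ toℕ l ∷ β)) α

  seriesRing : ℕ → RawRing c r
  seriesRing n = record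
    { Carrier = Series n
    ; _≈_ = λ f g → ∀ α → f α ≈ g α
    ; _+_ = λ f g α → f α R.+ g α
    ; _*_ = conv
    ; -_  = λ f α → R.- f α
    ; 0#  = λ _ → R.0#
    ; 1#  = one
    }

  module S {n} = Ops (seriesRing n)

  infixr 7 _•_
  _•_ : ∀ {n} → C → Series n → Series n
  (u • f) α = u R.* f α

  X : ∀ {n} → Fin n → Series n
  X i = at i λ { 1 → R.1# ; _ → R.0# }

  -- 1 - u xᵢ and its inverse
  linear geometric : ∀ {n} → C → Fin n → Series n
  linear    u i = S.1# S.+ S.- (u • X i)
  geometric u i = at i (u R.^_)

  -- Division by xᵢ - xⱼ.  If f = (xᵢ - xⱼ) g, then comparing coefficients of
  -- x^(α + eᵢ) gives g(α) = f(α + eᵢ) + g(α + eᵢ - eⱼ), where the last term is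
  -- absent if αⱼ = 0; unwinding this recursion,
  --   g(α) = Σ_{0 ≤ k ≤ αⱼ} f(α + (k + 1) eᵢ - k eⱼ).
  infixl 7 _÷_
  _÷_ : ∀ {n} → Series n → Fin n × Fin n → Series n
  (f ÷ (i , j)) α = R.sum {suc (lookup α j)} λ k →
    f ((α [ i ]%= (suc (toℕ k) ℕ.+_)) [ j ]%= (_∸ toℕ k))

  -- Division by ∏_{i<j} (xᵢ - xⱼ), one factor at a time.  It is applied to
  -- determinants [Bⱼ(xᵢ)] only, which are alternating in x₁, …, xₙ and so are
  -- divisible by this product.
  _÷Δ : ∀ {n} → Series n → Series n
  _÷Δ {n} f = foldr (λ p g → g ÷ p) f
    (filter (λ { (i , j) → i <ᶠ? j }) (cartesianProduct (allFin n) (allFin n)))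

  -- A function of x = (x₁, x₂, …), given by its values at
  -- (x₁, …, xₙ, 0, 0, …) for all n: the coefficient of x₁^α₁ ⋯ xₙ^αₙ is that of
  -- the series in x₁, …, xₙ.
  Function∞ : Set c
  Function∞ = ∀ n → Series n

  -- det [ Mᵢⱼ ] / ∏_{i<j} (xᵢ - xⱼ) for n ≥ ℓ(λ), and 0 otherwise, with columns
  -- j numbered from 1
  ratio : Partition → (∀ n → Fin n → ℕ → Series n) → Function∞
  ratio lam M n =
    if does (ℓ lam ≤? n)
    then S.det (λ i j → M n i (suc (toℕ j))) ÷Δ
    else S.0#

  s : Partition → Function∞
  s lam = ratio lam λ n i j → X i S.^ (part lam j ℕ.+ n ∸ j)

  A : Partition → ∀ n → Fin n → ℕ → Series n
  A lam n i j =
    if does (j ≤? diag lam)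
    then X i S.^ (part lam j ℕ.+ n ∸ j) S.*
         S.prodᴸ (λ k → geometric (a (ℤ.- (+ k))) i) (upTo (suc (part lam j ∸ j)))
    else X i S.^ (part lam j ℕ.+ n ∸ j) S.*
         S.prodᴸ (λ k → linear (a (+ k)) i) (1… (j ∸ part lam j ∸ 1))

  ŝ : Partition → Function∞
  ŝ lam = ratio lam (A lam)

  -- The formal infinite sum of f lam over all lam satisfying P equals g: for
  -- each monomial, all but finitely many terms have coefficient 0, and the
  -- coefficients of the remaining ones add up to that of g.
  SumsTo : (Partition → Set) → (Partition → Function∞) → Function∞ → Set r
  SumsTo P f g = ∀ n (α : Vec ℕ n) → ∃[ F ]
      Unique F × All P F
    × (∀ lam → P lam → lam ∉ F → f lam n α ≈ R.0#)
    × R.sumᴸ (λ lam → f lam n α) F ≈ g n α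

  scale : C → Function∞ → Function∞
  scale u f n = u • f n

  sign : ℕ → C
  sign k = (R.- R.1#) R.^ k

open DualSchur ℚ[a] var public

{-# OPTIONS --safe #-}

-- Number the rows of λ from 0.  In the determinant of s_λ a row of length s with
-- index r gives the column x^(s+n-r-1); in that of ŝ_λ this column is divided by
-- factors 1 - a_{-k} x for the first d rows and multiplied by factors 1 - a_k x
-- for the others.  Introducing these factors one value of k and one row at a
-- time turns the determinant of s_μ into those of the ŝ_λ: a single step
-- replaces a column by a linear combination of columns with more boxes in that
-- row, and the terms whose shape is not a partition cancel because they have two
-- equal adjacent columns.  Recording which entry is added in which row, the
-- surviving sequences of steps are exactly the dual hook tableaux.

module Submission where

-- The two kinds of factor behave differently. Let F_K be the product of 1 / (1 - a(-k) t) over 0 ≤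
-- k < K. Then F_K = F_{K+1} - a(-K) t F_{K+1}: the term with an added box is already at the next
-- level, so a step adds at most one box. Let G_K be the product of 1 - a(k) t over 1 ≤ k ≤ K. Then
-- G_K = G_{K+1} + a(K+1) t G_K: the last term can be split again, so a step may add several boxes.
-- This is why rows are strict in one half of a tableau and weak in the other. A cancellation needs
-- equally many factors in the new column and in the column of the row above; this forces upper rows
-- to be treated from the top down and lower rows from the bottom up. The sum over λ is infinite,
-- but a coefficient of a ratio depends on finitely many coefficients of its determinant, the same
-- ones for all λ. If `N` bounds their exponents, shapes with first row longer than `N` contribute
-- nothing, and everything reduces to finite sums of determinants of scalars.

module Tableaux where

  open import Data.Bool.Base using (if_then_else_)
  open import Data.Empty using (⊥; ⊥-elim)
  open import Data.Integer.Base as ℤ using (ℤ; -[1+_])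
  import Data.Integer.Properties as ℤ
  open import Data.List.Base using (List; []; _∷_; _++_; map; length; filter; concatMap; upTo; applyUpTo; applyDownFrom)
  open import Data.List.Membership.Propositional using (_∈_; _∉_; find; lose)
  open import Data.List.Membership.Propositional.Properties
  open import Data.List.Membership.Propositional.Properties.WithK using (unique∧set⇒bag)
  open import Data.List.Properties using (length-map; length-upTo; length-filter; map-upTo; ∷-injectiveˡ; ∷-injectiveʳ; map-cong-local; ≡-dec)
  open import Data.List.Relation.Binary.BagAndSetEquality using (∼bag⇒↭)
  open import Data.List.Relation.Binary.Permutation.Propositional using (_↭_)
  open import Data.List.Relation.Unary.All as All using (All; []; _∷_; all?)
  import Data.List.Relation.Unary.All.Properties as All
  open import Data.List.Relation.Unary.AllPairs as AllPairs using (AllPairs; []; _∷_)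
  import Data.List.Relation.Unary.AllPairs.Properties as AllPairs
  open import Data.List.Relation.Unary.Any using (here; there)
  open import Data.List.Relation.Unary.Linked using (Linked; []; [-]; _∷_; linked?)
  open import Data.List.Relation.Unary.Linked.Properties using (Linked⇒AllPairs)
  open import Data.List.Relation.Unary.Unique.Propositional using (Unique)
  open import Data.List.Relation.Unary.Unique.Propositional.Properties using (upTo⁺; map⁺; concat⁺; filter⁺; ++⁺)
  open import Data.Nat.Base using (ℕ; zero; suc; _+_; _∸_; _⊓_; _≤_; _<_; _≥_; z≤n; s≤s)
  open import Data.Nat.Properties
  open import Data.Product using (∃-syntax; _×_; _,_; proj₁; proj₂)
  open import Data.Sum using (_⊎_; inj₁; inj₂)
  open import Data.Unit using (⊤; tt)
  open import Function using (_∘_; id; mk⇔)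
  open import Relation.Binary.Definitions using (tri<; tri≈; tri>)
  open import Relation.Binary.PropositionalEquality using (_≡_; _≢_; ≢-sym; refl; cong; cong₂; sym; trans; subst; subst₂)
  open import Relation.Nullary using (¬_; Dec; yes; no; does; contradiction)
  open import Relation.Nullary.Decidable using (recompute; dec-true; dec-false; _×-dec_; map′)
  open import Relation.Unary using (Decidable)
  open import Defs using (Partition; partition; parts; ℓ; nth; part; conj; 1…_; _⊆_; diag; Box; boxes; skew; entries; _≟ᴮ_; fillings; Compatible; IsTableau; isTableau?; dualHookTableaux)

  -- A partition of varying shape is a state s, with s r the length of row r
  -- (rows numbered from 0, columns from 1).  The step upper k r adds at most one
  -- box with entry -k to row r, and lower k r a number of boxes with entry k + 1.
  data Step : Set where
    upper lower : (k r : ℕ) → Step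

  row : Step → ℕ
  row (upper k r) = r
  row (lower k r) = r

  -- Changing the length of one row

  bump : (ℕ → ℕ) → ℕ → ℕ → ℕ → ℕ
  bump s r t r′ with r′ ≟ r
  ... | yes _ = s r′ + t
  ... | no  _ = s r′

  bump-≡ : ∀ s r t → bump s r t r ≡ s r + t
  bump-≡ s r t with r ≟ r
  ... | yes _   = refl
  ... | no  r≢r = contradiction refl r≢r

  bump-≢ : ∀ s {r} t {r′} → r′ ≢ r → bump s r t r′ ≡ s r′
  bump-≢ s {r} t {r′} r′≢r with r′ ≟ r
  ... | yes r′≡r = contradiction r′≡r r′≢r
  ... | no  _    = refl

  ≤-bump : ∀ s r t r′ → s r′ ≤ bump s r t r′
  ≤-bump s r t r′ with r′ ≟ r
  ... | yes refl = m≤m+n (s r) t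
  ... | no  _    = ≤-refl

  bump-row : ∀ s r t {r′ c} → s r′ < c → c ≤ bump s r t r′ → r′ ≡ r
  bump-row s r t {r′} s<c c≤ with r′ ≟ r
  ... | yes r′≡r = r′≡r
  ... | no  _    = contradiction c≤ (<⇒≱ s<c)

  -- Admissible numbers of boxes in a single step

  Room : (ℕ → ℕ) → ℕ → ℕ → Set
  Room s zero    t = ⊤
  Room s (suc r) t = s (suc r) + t ≤ s r

  room? : ∀ s r t → Dec (Room s r t)
  room? s zero    t = yes tt
  room? s (suc r) t = s (suc r) + t ≤? s r

  Addable : (ℕ → ℕ) → ℕ → ℕ → Set
  Addable s k r = k + r < s r × Room s r 1

  addable? : ∀ s k r → Dec (Addable s k r)
  addable? s k r = (k + r <? s r) ×-dec room? s r 1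

  choices : Step → (ℕ → ℕ) → List ℕ
  choices (upper k r)       s with addable? s k r
  ... | yes _ = 0 ∷ 1 ∷ []
  ... | no  _ = 0 ∷ []
  -- In row 0 the bound `k + s 0 + t ≤ 0` of `Ok` leaves only `t = 0`.
  choices (lower k zero)    s = 0 ∷ []
  choices (lower k (suc r)) s = upTo (suc ((suc r ∸ k ∸ s (suc r)) ⊓ (s r ∸ s (suc r))))

  -- Adding nothing is always allowed, even where `k + s r + t ≤ r` fails for `t = 0`; this is why
  -- the case `t ≡ 0` stands apart.
  Ok : Step → (ℕ → ℕ) → ℕ → Set
  Ok (upper k r) s t = t ≡ 0 ⊎ (t ≡ 1 × Addable s k r)
  Ok (lower k r) s t = t ≡ 0 ⊎ (k + s r + t ≤ r × Room s r t)

  ≤∸⇒+≤ : ∀ {m n t} → suc t ≤ n ∸ m → m + suc t ≤ n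
  ≤∸⇒+≤ {m} {n} {t} p = subst (_≤ n) (+-comm (suc t) m) (m≤n∸o⇒m+o≤n′ p)
    where
    m≤n∸o⇒m+o≤n′ : ∀ {m n t} → suc t ≤ n ∸ m → suc t + m ≤ n
    m≤n∸o⇒m+o≤n′ {zero}  {n} {t} p = subst (_≤ n) (sym (+-identityʳ (suc t))) p
    m≤n∸o⇒m+o≤n′ {suc m} {suc n} {t} p = subst (_≤ suc n) (sym (+-suc (suc t) m)) (s≤s (m≤n∸o⇒m+o≤n′ {m} {n} p))

  ∈-choices⁻ : ∀ σ {s t} → t ∈ choices σ s → Ok σ s t
  ∈-choices⁻ (upper k r) {s} t∈ with addable? s k r | t∈
  ... | yes p | here eq         = inj₁ eq
  ... | yes p | there (here eq) = inj₂ (eq , p)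
  ... | no  _ | here eq         = inj₁ eq
  ∈-choices⁻ (lower k zero) (here eq) = inj₁ eq
  ∈-choices⁻ (lower k (suc r)) {s} {zero}  t∈ = inj₁ refl
  ∈-choices⁻ (lower k (suc r)) {s} {suc t} t∈ with s≤s t≤ ← ∈-upTo⁻ t∈ = inj₂
    ( ≤∸⇒+≤ (subst (suc t ≤_) (∸-+-assoc (suc r) k (s (suc r))) (≤-trans t≤ (m⊓n≤m _ _)))
    , ≤∸⇒+≤ (≤-trans t≤ (m⊓n≤n (suc r ∸ k ∸ s (suc r)) _)))

  ∈-choices⁺ : ∀ σ {s t} → Ok σ s t → t ∈ choices σ s
  ∈-choices⁺ (upper k r) {s} (inj₁ refl) with addable? s k r
  ... | yes _ = here refl
  ... | no  _ = here refl
  ∈-choices⁺ (upper k r) {s} (inj₂ (refl , p)) with addable? s k r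
  ... | yes _  = there (here refl)
  ... | no  ¬p = contradiction p ¬p
  ∈-choices⁺ (lower k zero) (inj₁ refl) = here refl
  ∈-choices⁺ (lower k zero) {s} {t} (inj₂ (p , _)) = here (m+n≡0⇒n≡0 (k + s 0) (n≤0⇒n≡0 p))
  ∈-choices⁺ (lower k (suc r)) (inj₁ refl) = ∈-upTo⁺ (s≤s z≤n)
  ∈-choices⁺ (lower k (suc r)) {s} {t} (inj₂ (p , q)) = ∈-upTo⁺ (s≤s (⊓-glb
    (subst (t ≤_) (sym (∸-+-assoc (suc r) k (s (suc r)))) (m+n≤o⇒n≤o∸m (k + s (suc r)) p))
    (m+n≤o⇒n≤o∸m (s (suc r)) q)))
    where
    m+n≤o⇒n≤o∸m : ∀ m {n o} → m + n ≤ o → n ≤ o ∸ m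
    m+n≤o⇒n≤o∸m m {n} {o} p = m+n≤o⇒m≤o∸n n (subst (_≤ o) (+-comm m n) p)

  choices-unique : ∀ σ s → Unique (choices σ s)
  choices-unique (upper k r) s with addable? s k r
  ... | yes _ = ((λ ()) ∷ []) ∷ [] ∷ []
  ... | no  _ = [] ∷ []
  choices-unique (lower k zero)    s = [] ∷ []
  choices-unique (lower k (suc r)) s = upTo⁺ _

  -- Runs, the sequences of admissible choices

  data Run : List Step → (ℕ → ℕ) → List ℕ → Set where
    []  : ∀ {s} → Run [] s []
    _∷_ : ∀ {σ σs s t ts} → Ok σ s t → Run σs (bump s (row σ) t) ts → Run (σ ∷ σs) s (t ∷ ts)

  runs : List Step → (ℕ → ℕ) → List (List ℕ)
  runs []       s = [] ∷ []
  runs (σ ∷ σs) s = concatMap (λ t → map (t ∷_) (runs σs (bump s (row σ) t))) (choices σ s)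

  ∈-runs⁻ : ∀ σs {s ts} → ts ∈ runs σs s → Run σs s ts
  ∈-runs⁻ []       (here refl) = []
  ∈-runs⁻ (σ ∷ σs) {s} ts∈ with find (∈-concatMap⁻ (λ t → map (t ∷_) (runs σs (bump s (row σ) t))) {xs = choices σ s} ts∈)
  ... | t , t∈ , ts∈′ with ∈-map⁻ (t ∷_) ts∈′
  ... | ts , ts∈″ , refl = ∈-choices⁻ σ t∈ ∷ ∈-runs⁻ σs ts∈″

  ∈-runs⁺ : ∀ {σs s ts} → Run σs s ts → ts ∈ runs σs s
  ∈-runs⁺ []       = here refl
  ∈-runs⁺ {σ ∷ σs} {s} (_∷_ {t = t} ok run) = ∈-concatMap⁺ (λ t → map (t ∷_) (runs σs (bump s (row σ) t)))
    (lose (∈-choices⁺ σ ok) (∈-map⁺ (t ∷_) (∈-runs⁺ run)))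

  Unique-concatMap : ∀ {a b} {A : Set a} {B : Set b} (f : A → List B) {xs} → Unique xs →
    (∀ {x} → x ∈ xs → Unique (f x)) → (∀ {x y v} → v ∈ f x → v ∈ f y → x ≡ y) →
    Unique (concatMap f xs)
  Unique-concatMap f {xs} u uf inj = concat⁺
    (All.map⁺ (All.tabulate uf))
    (AllPairs.map⁺ (AllPairs.map (λ x≢y {_} (p , q) → x≢y (inj p q)) u))

  runs-unique : ∀ σs s → Unique (runs σs s)
  runs-unique []       s = [] ∷ []
  runs-unique (σ ∷ σs) s = Unique-concatMap _ (choices-unique σ s)
    (λ {t} _ → map⁺ (λ { refl → refl }) (runs-unique σs (bump s (row σ) t)))
    (λ {t} {u} p q → head-≡ (∈-map⁻ (t ∷_) p) (∈-map⁻ (u ∷_) q))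
    where
    head-≡ : ∀ {t u v} {xs ys : List (List ℕ)} →
      (∃[ ts ] ts ∈ xs × v ≡ t ∷ ts) → (∃[ us ] us ∈ ys × v ≡ u ∷ us) → t ≡ u
    head-≡ (_ , _ , refl) (_ , _ , refl) = refl

  -- The step that adds a given box, and the order of the steps

  final : List Step → (ℕ → ℕ) → List ℕ → ℕ → ℕ
  final (σ ∷ σs) s (t ∷ ts) = final σs (bump s (row σ) t) ts
  final _        s _        = s

  -- The step that adds the box (r , c); a junk value unless s r < c ≤ final σs s ts r.
  adder : List Step → (ℕ → ℕ) → List ℕ → ℕ → ℕ → Step
  adder (σ ∷ σs) s (t ∷ ts) r c with c ≤? bump s (row σ) t r
  ... | yes _ = σ
  ... | no  _ = adder σs (bump s (row σ) t) ts r c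
  adder _ _ _ _ _ = upper 0 0

  infix 4 _≺_
  -- The order in which the steps are carried out. It already contains the column conditions of a
  -- tableau: a box is added after the one above it, so equal entries in a column are possible for
  -- `upper`, where rows are treated downwards, and impossible for `lower`, where they are treated
  -- upwards.
  _≺_ : Step → Step → Set
  upper k r ≺ upper k′ r′ = k < k′ ⊎ (k ≡ k′ × r < r′)
  upper k r ≺ lower k′ r′ = ⊤
  lower k r ≺ upper k′ r′ = ⊥
  lower k r ≺ lower k′ r′ = k < k′ ⊎ (k ≡ k′ × r′ < r)

  ≺-asym : ∀ σ τ → σ ≺ τ → ¬ τ ≺ σ
  ≺-asym (upper k r) (upper k′ r′) (inj₁ p)          (inj₁ q)          = <-asym p q
  ≺-asym (upper k r) (upper k′ r′) (inj₁ p)          (inj₂ (refl , _)) = <-irrefl refl p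
  ≺-asym (upper k r) (upper k′ r′) (inj₂ (refl , _)) (inj₁ q)          = <-irrefl refl q
  ≺-asym (upper k r) (upper k′ r′) (inj₂ (_ , p))    (inj₂ (_ , q))    = <-asym p q
  ≺-asym (lower k r) (lower k′ r′) (inj₁ p)          (inj₁ q)          = <-asym p q
  ≺-asym (lower k r) (lower k′ r′) (inj₁ p)          (inj₂ (refl , _)) = <-irrefl refl p
  ≺-asym (lower k r) (lower k′ r′) (inj₂ (refl , _)) (inj₁ q)          = <-irrefl refl q
  ≺-asym (lower k r) (lower k′ r′) (inj₂ (_ , p))    (inj₂ (_ , q))    = <-asym p q

  Sorted : List Step → Set
  Sorted = AllPairs _≺_

  head-∉ : ∀ {σ σs} → Sorted (σ ∷ σs) → σ ∉ σs
  head-∉ {σ} (σ≺ ∷ _) σ∈ = ≺-asym σ σ (All.lookup σ≺ σ∈) (All.lookup σ≺ σ∈)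

  Decreasing : (ℕ → ℕ) → Set
  Decreasing s = ∀ r → s (suc r) ≤ s r

  decreasing-≤ : ∀ {s} → Decreasing s → ∀ {r r′} → r ≤ r′ → s r′ ≤ s r
  decreasing-≤ dec {r} {r′} r≤r′ with m≤n⇒m<n∨m≡n r≤r′
  ... | inj₂ refl = ≤-refl
  ... | inj₁ (s≤s r≤) = ≤-trans (dec _) (decreasing-≤ dec r≤)

  Ok⇒Room : ∀ σ {s t} → Decreasing s → Ok σ s t → Room s (row σ) t
  Ok⇒Room (upper k r)       dec (inj₂ (refl , _ , room)) = room
  Ok⇒Room (lower k r)       dec (inj₂ (_ , room)) = room
  Ok⇒Room (upper k zero)    dec (inj₁ refl) = tt
  Ok⇒Room (lower k zero)    dec (inj₁ refl) = tt
  Ok⇒Room (upper k (suc r)) {s} dec (inj₁ refl) = ≤-trans (≤-reflexive (+-identityʳ _)) (dec r)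
  Ok⇒Room (lower k (suc r)) {s} dec (inj₁ refl) = ≤-trans (≤-reflexive (+-identityʳ _)) (dec r)

  bump-decreasing : ∀ {s} r t → Decreasing s → Room s r t → Decreasing (bump s r t)
  bump-decreasing {s} r t dec room r′ with suc r′ ≟ r
  ... | yes refl = ≤-trans room (≤-bump s (suc r′) t r′)
  ... | no ¬p = ≤-trans (dec r′) (≤-bump s r t r′)

  -- The bounds on the entries, which in a tableau involve the full length of a row or column of λ,
  -- restated for a single box in column `c`. Both versions agree because entries are strictly
  -- monotone along the row or column whose length gives the bound. Only the local version makes
  -- sense while the final shape is unknown.
  Flag : Step → ℕ → Set
  Flag (upper k r) c = suc (k + r) < c
  Flag (lower k r) c = k + c ≤ r

  IsLower : Step → Set
  IsLower (upper _ _) = ⊥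
  IsLower (lower _ _) = ⊤

  ≤-final : ∀ {σs s ts} → Run σs s ts → ∀ r → s r ≤ final σs s ts r
  ≤-final []            r = ≤-refl
  ≤-final {σ ∷ _} {s} (_∷_ {t = t} _ run) r = ≤-trans (≤-bump s (row σ) t r) (≤-final run r)

  Ok⇒Flag : ∀ σ {s t c} → Ok σ s t → s (row σ) < c → c ≤ s (row σ) + t → Flag σ c
  Ok⇒Flag (upper k r) {s} (inj₁ refl) s<c c≤ = contradiction (subst (_ ≤_) (+-identityʳ (s r)) c≤) (<⇒≱ s<c)
  Ok⇒Flag (lower k r) {s} (inj₁ refl) s<c c≤ = contradiction (subst (_ ≤_) (+-identityʳ (s r)) c≤) (<⇒≱ s<c)
  Ok⇒Flag (upper k r) (inj₂ (refl , k+r<s , _)) s<c c≤ = ≤-<-trans k+r<s s<c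
  Ok⇒Flag (lower k r) {s} (inj₂ (p , _)) s<c c≤ =
    ≤-trans (+-monoʳ-≤ k c≤) (subst (_≤ r) (+-assoc k (s r) _) p)

  adder-∈ : ∀ {σs s ts} → Run σs s ts → ∀ {r c} → s r < c → c ≤ final σs s ts r →
    adder σs s ts r c ∈ σs × row (adder σs s ts r c) ≡ r × Flag (adder σs s ts r c) c
  adder-∈ [] s<c c≤ = contradiction c≤ (<⇒≱ s<c)
  adder-∈ {σ ∷ σs} {s} (_∷_ {t = t} ok run) {r} {c} s<c c≤ with c ≤? bump s (row σ) t r
  ... | no c≰ = let (p , q) = adder-∈ run (≰⇒> c≰) c≤ in there p , q
  ... | yes c≤s′ with bump-row s (row σ) t s<c c≤s′
  ...   | refl = here refl , refl , Ok⇒Flag σ ok s<c (subst (c ≤_) (bump-≡ s r t) c≤s′)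

  Ok-upper-≤1 : ∀ σ {s t} → Ok σ s t → ¬ IsLower σ → t ≤ 1
  Ok-upper-≤1 (upper k r) (inj₁ refl)       _ = z≤n
  Ok-upper-≤1 (upper k r) (inj₂ (refl , _)) _ = ≤-refl
  Ok-upper-≤1 (lower k r) _                 ¬l = contradiction tt ¬l

  isLower? : ∀ σ → Dec (IsLower σ)
  isLower? (upper _ _) = no id
  isLower? (lower _ _) = yes tt

  -- Boxes of one row are added from left to right. A label repeats only if one step adds several
  -- boxes, which no `upper` step does.
  adder-row : ∀ {σs s ts} → Sorted σs → Run σs s ts → ∀ {r c c′} →
    s r < c → c < c′ → c′ ≤ final σs s ts r →
    adder σs s ts r c ≺ adder σs s ts r c′ ⊎
    (adder σs s ts r c ≡ adder σs s ts r c′ × IsLower (adder σs s ts r c))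
  adder-row _ [] s<c c<c′ c′≤ = contradiction c′≤ (<⇒≱ (<-trans s<c c<c′))
  adder-row {σ ∷ σs} {s} (σ≺ ∷ sorted) (_∷_ {t = t} ok run) {r} {c} {c′} s<c c<c′ c′≤
    with c ≤? bump s (row σ) t r | c′ ≤? bump s (row σ) t r
  ... | no c≰  | yes c′≤s′ = contradiction (≤-trans (<⇒≤ c<c′) c′≤s′) c≰
  ... | no c≰  | no c′≰    = adder-row sorted run (≰⇒> c≰) c<c′ c′≤
  ... | yes _  | no c′≰    = inj₁ (All.lookup σ≺ (proj₁ (adder-∈ run (≰⇒> c′≰) c′≤)))
  ... | yes c≤s′ | yes c′≤s′ with bump-row s (row σ) t s<c c≤s′ | isLower? σ
  ...   | refl | yes l = inj₂ (refl , l)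
  ...   | refl | no ¬l = contradiction (≤-trans c′≤s′ (≤-trans (≤-reflexive (bump-≡ s r t))
            (≤-trans (+-monoʳ-≤ (s r) (Ok-upper-≤1 σ ok ¬l)) (≤-trans (≤-reflexive (+-comm (s r) 1)) s<c)))) (<⇒≱ c<c′)

  -- `Room` keeps the state decreasing, so a box can be added only after the box above it.
  adder-column : ∀ {σs s ts} → Sorted σs → Decreasing s → Run σs s ts → ∀ {r r′ c} → r < r′ →
    s r < c → c ≤ final σs s ts r′ → adder σs s ts r c ≺ adder σs s ts r′ c
  adder-column _ dec [] r<r′ s<c c≤ = contradiction (≤-trans c≤ (decreasing-≤ dec (<⇒≤ r<r′))) (<⇒≱ s<c)
  adder-column {σ ∷ σs} {s} (σ≺ ∷ sorted) dec (_∷_ {t = t} ok run) {r} {suc r′} {c} (s≤s r≤r′) s<c c≤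
    with c ≤? bump s (row σ) t r | c ≤? bump s (row σ) t (suc r′)
  ... | no c≰ | no c≰′ = adder-column sorted (bump-decreasing _ t dec (Ok⇒Room σ dec ok)) run (s≤s r≤r′) (≰⇒> c≰) c≤
  ... | yes _ | no c≰′ = All.lookup σ≺ (proj₁ (adder-∈ run (≰⇒> c≰′) c≤))
  -- Here `σ` would bring row `suc r′` up to column `c` while row `r` still ends before `c`; but
  -- `Room` gives `c ≤ s r′ ≤ s r`.
  ... | _     | yes c≤s′ = contradiction (≤-trans c≤″ (decreasing-≤ dec r≤r′)) (<⇒≱ s<c)
    where
    s<c′ : s (suc r′) < c
    s<c′ = ≤-<-trans (decreasing-≤ dec (≤-trans r≤r′ (n≤1+n _))) s<c
    c≤″ : c ≤ s r′
    c≤″ with bump-row s (row σ) t s<c′ c≤s′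
    ... | r≡ with Ok⇒Room σ dec ok
    ...   | room rewrite sym r≡ = ≤-trans c≤s′ (≤-trans (≤-reflexive (bump-≡ s (suc r′) t)) room)

  -- At the first step where two runs add different numbers of boxes, a box in the difference is
  -- labelled by this step in one run and by a later step in the other; but no step recurs in a
  -- sorted list.
  runs-injective : ∀ {σs s ts us} → Sorted σs → Run σs s ts → Run σs s us →
    (∀ r → final σs s ts r ≡ final σs s us r) →
    (∀ r c → s r < c → c ≤ final σs s ts r → adder σs s ts r c ≡ adder σs s us r c) →
    ts ≡ us
  runs-injective _ [] [] _ _ = refl
  runs-injective {σ ∷ σs} {s} sorted@(_ ∷ sorted′) (_∷_ {t = t} {ts} ok run) (_∷_ {t = u} {us} ok′ run′) fin add with <-cmp t u
  ... | tri< t<u _ _ = contradiction (subst (_∈ σs) eq (proj₁ (adder-∈ run s′<c c≤))) (head-∉ sorted)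
    where
    c = s (row σ) + u
    s′<c : bump s (row σ) t (row σ) < c
    s′<c = ≤-<-trans (≤-reflexive (bump-≡ s (row σ) t)) (+-monoʳ-< (s (row σ)) t<u)
    c≤s″ : c ≤ bump s (row σ) u (row σ)
    c≤s″ = ≤-reflexive (sym (bump-≡ s (row σ) u))
    c≤ : c ≤ final σs (bump s (row σ) t) ts (row σ)
    c≤ = ≤-trans (≤-trans c≤s″ (≤-final run′ (row σ))) (≤-reflexive (sym (fin (row σ))))
    eq : adder σs (bump s (row σ) t) ts (row σ) c ≡ σ
    eq with add (row σ) c (≤-<-trans (≤-bump s (row σ) t (row σ)) s′<c) c≤
    ... | e with c ≤? bump s (row σ) t (row σ) | c ≤? bump s (row σ) u (row σ)
    ...   | yes p | _     = contradiction p (<⇒≱ s′<c)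
    ...   | no _  | no ¬p = contradiction c≤s″ ¬p
    ...   | no _  | yes _ = e
  ... | tri> _ _ u<t = contradiction (subst (_∈ σs) eq (proj₁ (adder-∈ run′ s″<c c≤))) (head-∉ sorted)
    where
    c = s (row σ) + t
    s″<c : bump s (row σ) u (row σ) < c
    s″<c = ≤-<-trans (≤-reflexive (bump-≡ s (row σ) u)) (+-monoʳ-< (s (row σ)) u<t)
    c≤s′ : c ≤ bump s (row σ) t (row σ)
    c≤s′ = ≤-reflexive (sym (bump-≡ s (row σ) t))
    c≤ : c ≤ final σs (bump s (row σ) u) us (row σ)
    c≤ = ≤-trans (≤-trans c≤s′ (≤-final run (row σ))) (≤-reflexive (fin (row σ)))
    eq : adder σs (bump s (row σ) u) us (row σ) c ≡ σ
    eq with add (row σ) c (≤-<-trans (≤-bump s (row σ) u (row σ)) s″<c) (≤-trans c≤s′ (≤-final run (row σ)))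
    ... | e with c ≤? bump s (row σ) t (row σ) | c ≤? bump s (row σ) u (row σ)
    ...   | no ¬p | _     = contradiction c≤s′ ¬p
    ...   | yes _ | yes p = contradiction p (<⇒≱ s″<c)
    ...   | yes _ | no _  = sym e
  ... | tri≈ _ refl _ = cong (t ∷_) (runs-injective sorted′ run run′ fin add′)
    where
    add′ : ∀ r c → bump s (row σ) t r < c → c ≤ final σs (bump s (row σ) t) ts r →
      adder σs (bump s (row σ) t) ts r c ≡ adder σs (bump s (row σ) t) us r c
    add′ r c s′<c c≤ with add r c (≤-<-trans (≤-bump s (row σ) t r) s′<c) c≤
    ... | e with c ≤? bump s (row σ) t r
    ...   | yes p = contradiction p (<⇒≱ s′<c)
    ...   | no _  = e

  -- Recovering a run from the labels of its boxes

  initial-segment : ∀ {p} {P : ℕ → Set p} (P? : ∀ c → Dec (P c)) s l → s ≤ l →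
    ∃[ t ] s + t ≤ l × (∀ {c} → s < c → c ≤ s + t → P c) × (s + t < l → ¬ P (suc (s + t)))
  initial-segment P? s l s≤l with m≤n⇒m<n∨m≡n s≤l
  ... | inj₂ refl = 0 , ≤-reflexive (+-identityʳ s)
                  , (λ s<c c≤ → contradiction (≤-trans c≤ (≤-reflexive (+-identityʳ s))) (<⇒≱ s<c))
                  , λ p → contradiction p (≤⇒≯ (≤-reflexive (sym (+-identityʳ s))))
  initial-segment {P = P} P? s (suc l) s≤l | inj₁ (s≤s s≤l′) with initial-segment P? s l s≤l′
  ... | t , p , q , r with m≤n⇒m<n∨m≡n p
  ...   | inj₁ s+t<l = t , m≤n⇒m≤1+n p , q , λ _ → r s+t<l
  ...   | inj₂ s+t≡l with P? (suc l)
  ...     | no ¬P = t , m≤n⇒m≤1+n p , q , λ _ → subst (λ x → ¬ P (suc x)) (sym s+t≡l) ¬P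
  ...     | yes Pl = suc t , ≤-reflexive s+1+t≡ , q′ , λ p′ → contradiction p′ (≤⇒≯ (≤-reflexive (sym s+1+t≡)))
    where
    s+1+t≡ : s + suc t ≡ suc l
    s+1+t≡ = trans (+-suc s t) (cong suc s+t≡l)
    q′ : ∀ {c} → s < c → c ≤ s + suc t → P c
    q′ {c} s<c c≤ with m≤n⇒m<n∨m≡n (subst (c ≤_) s+1+t≡ c≤)
    ... | inj₂ refl = Pl
    ... | inj₁ (s≤s c≤l) = q s<c (subst (c ≤_) (sym s+t≡l) c≤l)

  Ok⁺ : ∀ σ {s t} → (0 < t → Room s (row σ) t) → (0 < t → Flag σ (s (row σ) + t)) →
    (¬ IsLower σ → t ≤ 1) → Ok σ s t
  Ok⁺ (upper k r) {s} {zero}        _ _ _ = inj₁ refl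
  Ok⁺ (lower k r) {s} {zero}        _ _ _ = inj₁ refl
  Ok⁺ (upper k r) {s} {suc zero}    room flag _ = inj₂ (refl
    , ≤-pred (≤-trans (flag (s≤s z≤n)) (≤-reflexive (+-comm (s r) 1))) , room (s≤s z≤n))
  Ok⁺ (upper k r) {s} {suc (suc t)} _ _ single = contradiction (single id) λ { (s≤s ()) }
  Ok⁺ (lower k r) {s} {suc t}       room flag _ = inj₂
    (subst (_≤ r) (sym (+-assoc k (s r) (suc t))) (flag (s≤s z≤n)) , room (s≤s z≤n))

  _≟ˢ_ : (σ τ : Step) → Dec (σ ≡ τ)
  upper k r ≟ˢ upper k′ r′ with k ≟ k′ | r ≟ r′
  ... | yes refl | yes refl = yes refl
  ... | no ¬p    | _        = no λ { refl → ¬p refl }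
  ... | _        | no ¬p    = no λ { refl → ¬p refl }
  upper k r ≟ˢ lower k′ r′ = no λ ()
  lower k r ≟ˢ upper k′ r′ = no λ ()
  lower k r ≟ˢ lower k′ r′ with k ≟ k′ | r ≟ r′
  ... | yes refl | yes refl = yes refl
  ... | no ¬p    | _        = no λ { refl → ¬p refl }
  ... | _        | no ¬p    = no λ { refl → ¬p refl }

  -- T names, for every box of l/s, the step that adds it.
  record Filling (σs : List Step) (s l : ℕ → ℕ) (T : ℕ → ℕ → Step) : Set where
    field
      s≤l    : ∀ r → s r ≤ l r
      isStep : ∀ {r c} → s r < c → c ≤ l r → T r c ∈ σs
      isRow  : ∀ {r c} → s r < c → c ≤ l r → row (T r c) ≡ r
      flag   : ∀ {r c} → s r < c → c ≤ l r → Flag (T r c) c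
      along  : ∀ {r c c′} → s r < c → c < c′ → c′ ≤ l r → T r c ≺ T r c′ ⊎ (T r c ≡ T r c′ × IsLower (T r c))
      down   : ∀ {r c} → s r < c → c ≤ l (suc r) → T r c ≺ T (suc r) c

  -- Inverse to reading off `adder`. The first step takes the longest block of missing boxes at the
  -- start of its row that carry its label. Since it precedes all other steps, the order conditions
  -- make this choice admissible and leave no further box with that label.
  filling⇒run : ∀ {σs s l T} → Sorted σs → Decreasing s → Decreasing l → Filling σs s l T →
    ∃[ ts ] Run σs s ts × (∀ r → final σs s ts r ≡ l r) ×
      (∀ {r c} → s r < c → c ≤ l r → adder σs s ts r c ≡ T r c)
  filling⇒run {[]} {s} {l} _ _ _ F = [] , [] , (λ r → ≤-antisym (s≤l r) (l≤s r))
    , λ {r} s<c c≤ → contradiction (≤-trans c≤ (l≤s r)) (<⇒≱ s<c)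
    where
    open Filling F
    l≤s : ∀ r → l r ≤ s r
    l≤s r with l r ≤? s r
    ... | yes p = p
    ... | no ¬p with () ← isStep (≰⇒> ¬p) ≤-refl
  filling⇒run {σ ∷ σs} {s} {l} {T} sorted@(σ≺ ∷ sorted′) sdec ldec F
    = t ∷ proj₁ rec , ok ∷ run , fin , add
    where
    segment = initial-segment (λ c → T (row σ) c ≟ˢ σ) (s (row σ)) (l (row σ)) (Filling.s≤l F (row σ))
    t = proj₁ segment
    s+t≤l = proj₁ (proj₂ segment)
    isσ : ∀ {c} → s (row σ) < c → c ≤ s (row σ) + t → T (row σ) c ≡ σ
    isσ = proj₁ (proj₂ (proj₂ segment))
    maximal = proj₂ (proj₂ (proj₂ segment))
    open Filling F

    -- The box just past the block does not carry `σ`, so it carries a later step, and by `along` no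
    -- box to its right can carry `σ`.
    later : ∀ {r c} → bump s (row σ) t r < c → c ≤ l r → T r c ≢ σ
    later {r} {c} s′<c c≤ eq with trans (sym (isRow (≤-<-trans (≤-bump s (row σ) t r) s′<c) c≤)) (cong row eq)
    ... | refl with m≤n⇒m<n∨m≡n (subst (_< c) (bump-≡ s (row σ) t) s′<c)
    ...   | inj₂ refl = maximal c≤ eq
    ...   | inj₁ 1+s+t<c with along (s≤s (m≤m+n (s (row σ)) t)) 1+s+t<c c≤
    ...     | inj₂ (eq′ , _) = maximal (≤-trans (<⇒≤ 1+s+t<c) c≤) (trans eq′ eq)
    ...     | inj₁ p with isStep (s≤s (m≤m+n (s (row σ)) t)) (≤-trans (<⇒≤ 1+s+t<c) c≤)
    ...       | here eq′ = maximal (≤-trans (<⇒≤ 1+s+t<c) c≤) eq′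
    ...       | there ∈σs = ≺-asym σ _ (All.lookup σ≺ ∈σs) (subst (T (row σ) (suc (s (row σ) + t)) ≺_) eq p)

    -- Were the row above too short, its box in the last new column would be missing, and by `down`
    -- the label of that box would precede `σ`, the first of all steps.
    above : 0 < t → Room s (row σ) t
    -- `Room` computes by the row index, so `row σ` has to be replaced by a variable.
    above 0<t = go (row σ) refl
      where
      go : ∀ r → r ≡ row σ → Room s r t
      go zero    _ = tt
      go (suc r) r≡ with s (suc r) + t ≤? s r
      ... | yes p = p
      ... | no ¬p = contradiction (isStep (≰⇒> ¬p) (≤-trans c≤l (ldec r))) λ
          { (here eq)   → ≺-asym σ σ (subst (_≺ σ) eq ≺σ) (subst (_≺ σ) eq ≺σ)
          ; (there ∈σs) → ≺-asym σ _ (All.lookup σ≺ ∈σs) ≺σ }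
        where
        c≤l : s (suc r) + t ≤ l (suc r)
        c≤l = subst (λ r → s r + t ≤ l r) (sym r≡) s+t≤l
        ≺σ : T r (s (suc r) + t) ≺ σ
        ≺σ = subst (T r (s (suc r) + t) ≺_)
          (trans (cong (λ r′ → T r′ (s (suc r) + t)) r≡)
                 (isσ (subst (λ r′ → s r′ < s (suc r) + t) r≡ (m<m+n _ 0<t)) (≤-reflexive (cong (λ r → s r + t) r≡))))
          (down (≰⇒> ¬p) c≤l)

    -- `along` lets two boxes of a row share a label only if it is a `lower` step.
    single : ¬ IsLower σ → t ≤ 1
    single ¬l with t ≤? 1
    ... | yes p = p
    ... | no ¬p with along (≤-refl {suc (s (row σ))}) (≤-refl {suc (suc (s (row σ)))}) (≤-trans c′≤ s+t≤l)
      where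
      c′≤ : suc (suc (s (row σ))) ≤ s (row σ) + t
      c′≤ = ≤-trans (≤-reflexive (+-comm 2 (s (row σ)))) (+-monoʳ-≤ (s (row σ)) (≰⇒> ¬p))
    ...   | q = contradiction (subst₂ (λ τ τ′ → τ ≺ τ′ ⊎ (τ ≡ τ′ × IsLower τ)) T≡σ T≡σ′ q)
                  λ { (inj₁ p) → ≺-asym σ σ p p ; (inj₂ (_ , l)) → ¬l l }
      where
      c′≤ : suc (suc (s (row σ))) ≤ s (row σ) + t
      c′≤ = ≤-trans (≤-reflexive (+-comm 2 (s (row σ)))) (+-monoʳ-≤ (s (row σ)) (≰⇒> ¬p))
      T≡σ : T (row σ) (suc (s (row σ))) ≡ σ
      T≡σ = isσ ≤-refl (≤-trans (n≤1+n _) c′≤)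
      T≡σ′ : T (row σ) (suc (suc (s (row σ)))) ≡ σ
      T≡σ′ = isσ (n≤1+n _) c′≤

    ok : Ok σ s t
    ok = Ok⁺ σ above
      (λ 0<t → subst (λ τ → Flag τ (s (row σ) + t)) (isσ (m<m+n _ 0<t) ≤-refl) (flag (m<m+n _ 0<t) s+t≤l))
      single

    s′dec : Decreasing (bump s (row σ) t)
    s′dec = bump-decreasing (row σ) t sdec (Ok⇒Room σ sdec ok)

    <′ : ∀ {r c} → bump s (row σ) t r < c → s r < c
    <′ {r} = ≤-<-trans (≤-bump s (row σ) t r)

    F′ : Filling σs (bump s (row σ) t) l T
    F′ = record
      { s≤l    = s′≤l
      ; isStep = λ s′<c c≤ → case-∈ (later s′<c c≤) (isStep (<′ s′<c) c≤)
      ; isRow  = isRow ∘ <′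
      ; flag   = flag ∘ <′
      ; along  = along ∘ <′
      ; down   = down ∘ <′
      }
      where
      case-∈ : ∀ {τ} → τ ≢ σ → τ ∈ σ ∷ σs → τ ∈ σs
      case-∈ ne (here eq) = contradiction eq ne
      case-∈ ne (there p) = p
      s′≤l : ∀ r → bump s (row σ) t r ≤ l r
      s′≤l r with r ≟ row σ
      ... | yes refl = s+t≤l
      ... | no _     = s≤l r

    rec = filling⇒run {σs} {bump s (row σ) t} {l} {T} sorted′ s′dec ldec F′
    run = proj₁ (proj₂ rec)
    fin = proj₁ (proj₂ (proj₂ rec))

    add : ∀ {r c} → s r < c → c ≤ l r → adder (σ ∷ σs) s (t ∷ proj₁ rec) r c ≡ T r c
    add {r} {c} s<c c≤ with c ≤? bump s (row σ) t r
    ... | no c≰ = proj₂ (proj₂ (proj₂ rec)) (≰⇒> c≰) c≤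
    ... | yes c≤s′ with bump-row s (row σ) t s<c c≤s′
    ...   | refl = sym (isσ s<c (subst (c ≤_) (bump-≡ s (row σ) t) c≤s′))

  -- Schedules and hook shapes

  value : Step → ℤ
  value (upper k r) = ℤ.- (ℤ.+ k)
  value (lower k r) = ℤ.+ suc k

  -- κ and κ′ record how many values have been processed in each row before and
  -- after the steps.
  data Schedule (d n : ℕ) : List Step → (κ κ′ : ℕ → ℕ) → Set where
    done  : ∀ {κ} → Schedule d n [] κ κ
    upper : ∀ {k r σs κ κ′} → r < d → r < n → κ r ≡ k → (∀ r′ → r ≡ suc r′ → κ r′ ≡ suc k) →
      Schedule d n σs (bump κ r 1) κ′ → Schedule d n (upper k r ∷ σs) κ κ′
    lower : ∀ {k r σs κ κ′} → d ≤ r → r < n → κ r ≡ k → (∀ r′ → r ≡ suc r′ → d ≤ r′ → κ r′ ≡ k) →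
      Schedule d n σs (bump κ r 1) κ′ → Schedule d n (lower k r ∷ σs) κ κ′

  -- The Durfee square has side `d`. In this form the condition can be checked row by row and
  -- carried through the steps, where the shape is only a function of the row index.
  record Hook (d : ℕ) (s : ℕ → ℕ) : Set where
    field
      decreasing : Decreasing s
      d≤s        : ∀ {r} → r < d → d ≤ s r
      s≤d        : ∀ {r} → d ≤ r → s r ≤ d

  Hook-bump-upper : ∀ {d s r t} → r < d → Room s r t → Hook d s → Hook d (bump s r t)
  Hook-bump-upper {d} {s} {r} {t} r<d room h = record
    { decreasing = bump-decreasing r t decreasing room
    ; d≤s        = λ {r′} r′<d → ≤-trans (d≤s r′<d) (≤-bump s r t r′)
    ; s≤d        = λ {r′} d≤r′ → ≤-trans (≤-reflexive (bump-≢ s t (λ { refl → <⇒≱ r<d d≤r′ }))) (s≤d d≤r′)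
    } where open Hook h

  Hook-bump-lower : ∀ {d s k r t} → d ≤ r → Ok (lower k r) s t → Hook d s → Hook d (bump s r t)
  Hook-bump-lower {d} {s} {k} {r} {t} d≤r ok h = record
    { decreasing = bump-decreasing r t decreasing (Ok⇒Room (lower k r) decreasing ok)
    ; d≤s        = λ {r′} r′<d → ≤-trans (d≤s r′<d) (≤-bump s r t r′)
    ; s≤d        = s′≤d
    }
    where
    open Hook h
    -- In row `d` itself the bound `k + s r + t ≤ r` keeps the row within `d` columns; further down
    -- the row above does.
    new≤d : ∀ r → d ≤ r → Ok (lower k r) s t → s r + t ≤ d
    new≤d r d≤r (inj₁ refl) = ≤-trans (≤-reflexive (+-identityʳ _)) (s≤d d≤r)
    new≤d r d≤r (inj₂ (p , room)) with m≤n⇒m<n∨m≡n d≤r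
    ... | inj₂ refl = ≤-trans (m≤n+m _ k) (≤-trans (≤-reflexive (sym (+-assoc k _ t))) p)
    new≤d (suc r) d≤r (inj₂ (p , room)) | inj₁ (s≤s d≤r′) = ≤-trans room (s≤d d≤r′)
    s′≤d : ∀ {r′} → d ≤ r′ → bump s r t r′ ≤ d
    s′≤d {r′} d≤r′ with r′ ≟ r
    ... | yes refl = new≤d r d≤r ok
    ... | no _       = s≤d d≤r′

  -- The list of all steps, its order and its schedule

  upperBlock : ℕ → ℕ → List Step
  upperBlock d k = map (upper k) (upTo d)

  lowerBlock : ℕ → ℕ → ℕ → List Step
  lowerBlock d n k = map (lower k) (applyDownFrom (d +_) (n ∸ d))

  -- The ranges suffice for shapes with at most `n` rows and first row at most `N`: an entry `-k` in
  -- the first `d` rows has `k < λ₁ ≤ N`, and an entry `k + 1` in column `j` below them has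
  -- `k < λ′ⱼ ≤ n`.
  steps : (d n N : ℕ) → List Step
  steps d n N = concatMap (upperBlock d) (upTo N) ++ concatMap (lowerBlock d n) (upTo n)

  InRange : (d n N : ℕ) → Step → Set
  InRange d n N (upper k r) = k < N × r < d
  InRange d n N (lower k r) = k < n × d ≤ r × r < n

  module _ {d n N : ℕ} (d≤n : d ≤ n) where

    ∈-steps⁺ : ∀ σ → InRange d n N σ → σ ∈ steps d n N
    ∈-steps⁺ (upper k r) (k<N , r<d) = ∈-++⁺ˡ (∈-concatMap⁺ (upperBlock d)
      (lose (∈-upTo⁺ k<N) (∈-map⁺ (upper k) (∈-upTo⁺ r<d))))
    ∈-steps⁺ (lower k r) (k<n , d≤r , r<n) = ∈-++⁺ʳ (concatMap (upperBlock d) (upTo N)) (∈-concatMap⁺ (lowerBlock d n)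
      (lose (∈-upTo⁺ k<n) (∈-map⁺ (lower k)
        (subst (_∈ applyDownFrom (d +_) (n ∸ d)) (m+[n∸m]≡n d≤r) (∈-applyDownFrom⁺ (d +_) (∸-monoˡ-< r<n d≤r))))))

    ∈-steps⁻ : ∀ {σ} → σ ∈ steps d n N → InRange d n N σ
    ∈-steps⁻ σ∈ with ∈-++⁻ (concatMap (upperBlock d) (upTo N)) σ∈
    ... | inj₁ p with find (∈-concatMap⁻ (upperBlock d) {xs = upTo N} p)
    ...   | k , k∈ , q with ∈-map⁻ (upper k) q
    ...     | r , r∈ , refl = ∈-upTo⁻ k∈ , ∈-upTo⁻ r∈
    ∈-steps⁻ σ∈ | inj₂ p with find (∈-concatMap⁻ (lowerBlock d n) {xs = upTo n} p)
    ...   | k , k∈ , q with ∈-map⁻ (lower k) q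
    ...     | r , r∈ , refl with ∈-applyDownFrom⁻ (d +_) r∈
    ...       | i , i< , refl = ∈-upTo⁻ k∈ , m≤m+n d i
              , subst (d + i <_) (m+[n∸m]≡n d≤n) (+-monoʳ-< d i<)

  blocks-sorted : (f : ℕ → List Step) → (∀ k → Sorted (f k)) →
    (∀ {k k′ σ τ} → k < k′ → σ ∈ f k → τ ∈ f k′ → σ ≺ τ) → ∀ m → Sorted (concatMap f (upTo m))
  blocks-sorted f sorted ≺ m = AllPairs.concat⁺
    (All.map⁺ (All.tabulate λ {k} _ → sorted k))
    (AllPairs.map⁺ (AllPairs.applyUpTo⁺₁ id m λ k<k′ _ →
      All.tabulate λ σ∈ → All.tabulate λ τ∈ → ≺ k<k′ σ∈ τ∈))

  steps-sorted : ∀ d n N → Sorted (steps d n N)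
  steps-sorted d n N = AllPairs.++⁺
    (blocks-sorted (upperBlock d)
      (λ k → AllPairs.map⁺ (AllPairs.applyUpTo⁺₁ id d λ r<r′ _ → inj₂ (refl , r<r′)))
      upper≺upper N)
    (blocks-sorted (lowerBlock d n)
      (λ k → AllPairs.map⁺ (AllPairs.applyDownFrom⁺₁ (d +_) (n ∸ d) λ i<j _ → inj₂ (refl , +-monoʳ-< d i<j)))
      lower≺lower n)
    (All.tabulate λ σ∈ → All.tabulate λ τ∈ → upper≺lower
      (find (∈-concatMap⁻ (upperBlock d) {xs = upTo N} σ∈)) (find (∈-concatMap⁻ (lowerBlock d n) {xs = upTo n} τ∈)))
    where
    upper≺upper : ∀ {k k′ σ τ} → k < k′ → σ ∈ upperBlock d k → τ ∈ upperBlock d k′ → σ ≺ τ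
    upper≺upper {k} {k′} k<k′ σ∈ τ∈ with ∈-map⁻ (upper k) σ∈ | ∈-map⁻ (upper k′) τ∈
    ... | _ , _ , refl | _ , _ , refl = inj₁ k<k′
    lower≺lower : ∀ {k k′ σ τ} → k < k′ → σ ∈ lowerBlock d n k → τ ∈ lowerBlock d n k′ → σ ≺ τ
    lower≺lower {k} {k′} k<k′ σ∈ τ∈ with ∈-map⁻ (lower k) σ∈ | ∈-map⁻ (lower k′) τ∈
    ... | _ , _ , refl | _ , _ , refl = inj₁ k<k′
    upper≺lower : ∀ {σ τ} → ∃[ k ] k ∈ upTo N × σ ∈ upperBlock d k → ∃[ k ] k ∈ upTo n × τ ∈ lowerBlock d n k → σ ≺ τ
    upper≺lower (k , _ , σ∈) (k′ , _ , τ∈) with ∈-map⁻ (upper k) σ∈ | ∈-map⁻ (lower k′) τ∈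
    ... | _ , _ , refl | _ , _ , refl = tt

  Schedule-++ : ∀ {d n σs τs κ κ′ κ″} → Schedule d n σs κ κ′ → Schedule d n τs κ′ κ″ → Schedule d n (σs ++ τs) κ κ″
  Schedule-++ done t = t
  Schedule-++ (upper a b c e s) t = upper a b c e (Schedule-++ s t)
  Schedule-++ (lower a b c e s) t = lower a b c e (Schedule-++ s t)

  module _ {d n : ℕ} (d≤n : d ≤ n) where

    -- Stated for the moment when the rows of index less than `f` have been raised to level `k + 1`.
    -- The tail of `applyUpTo g` is `applyUpTo (g ∘ suc)`, so the induction carries a `g` with
    -- `g i ≡ f + i`.
    upperBlock-schedule : ∀ {k} m f (g : ℕ → ℕ) {κ} → (∀ i → g i ≡ f + i) → f + m ≡ d →
      (∀ {r} → r < f → κ r ≡ suc k) → (∀ {r} → f ≤ r → r < d → κ r ≡ k) →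
      ∃[ κ′ ] Schedule d n (map (upper k) (applyUpTo g m)) κ κ′ ×
        (∀ {r} → r < d → κ′ r ≡ suc k) × (∀ {r} → d ≤ r → κ′ r ≡ κ r)
    upperBlock-schedule zero    f g {κ} g≡ f+m≡d before after = κ , done
      , (λ r<d → before (subst (_ <_) (trans (sym f+m≡d) (+-identityʳ f)) r<d)) , λ _ → refl
    upperBlock-schedule {k} (suc m) f g {κ} g≡ f+m≡d before after
      with g 0 | trans (g≡ 0) (+-identityʳ f)
    ... | .f | refl = κ′ , upper f<d (<-≤-trans f<d d≤n) (after ≤-refl f<d) (λ { r′ refl → before ≤-refl }) sch , up , lo′
      where
      f<d : f < d
      f<d = ≤-trans (m<m+n f (s≤s z≤n)) (≤-reflexive f+m≡d)
      before′ : ∀ {r} → r < suc f → bump κ f 1 r ≡ suc k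
      before′ {r} (s≤s r≤f) with m≤n⇒m<n∨m≡n r≤f
      ... | inj₁ r<f  = trans (bump-≢ κ 1 (<⇒≢ r<f)) (before r<f)
      ... | inj₂ refl = trans (bump-≡ κ f 1) (trans (+-comm _ 1) (cong suc (after ≤-refl f<d)))
      after′ : ∀ {r} → suc f ≤ r → r < d → bump κ f 1 r ≡ k
      after′ f<r r<d = trans (bump-≢ κ 1 (≢-sym (<⇒≢ f<r))) (after (<⇒≤ f<r) r<d)
      rec = upperBlock-schedule {k} m (suc f) (g ∘ suc) {bump κ f 1} (λ i → trans (g≡ (suc i)) (+-suc f i))
        (trans (sym (+-suc f m)) f+m≡d) before′ after′
      κ′ = proj₁ rec
      sch = proj₁ (proj₂ rec)
      up : ∀ {r} → r < d → κ′ r ≡ suc k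
      up = proj₁ (proj₂ (proj₂ rec))
      lo′ : ∀ {r} → d ≤ r → κ′ r ≡ κ r
      lo′ d≤r = trans (proj₂ (proj₂ (proj₂ rec)) d≤r) (bump-≢ κ 1 (≢-sym (<⇒≢ (<-≤-trans f<d d≤r))))

    -- Here `m` counts the rows still to be raised, those of index `d` to `d + m - 1`. The last of
    -- them is treated next, when the row above it is still at level `k`.
    lowerBlock-schedule : ∀ {k} m {κ} → d + m ≤ n →
      (∀ {r} → d ≤ r → r < d + m → κ r ≡ k) → (∀ {r} → d + m ≤ r → r < n → κ r ≡ suc k) →
      ∃[ κ′ ] Schedule d n (map (lower k) (applyDownFrom (d +_) m)) κ κ′ ×
        (∀ {r} → d ≤ r → r < n → κ′ r ≡ suc k) × (∀ {r} → r < d → κ′ r ≡ κ r)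
    lowerBlock-schedule zero    {κ} _ before after = κ , done
      , (λ d≤r → after (subst (_≤ _) (sym (+-identityʳ d)) d≤r)) , λ _ → refl
    lowerBlock-schedule {k} (suc m) {κ} d+m≤n before after =
      κ′ , lower (m≤m+n d m) f<n (before (m≤m+n d m) f<) (λ r′ eq d≤r′ → before d≤r′ (<-trans (≤-reflexive (sym eq)) f<)) sch , lo , up
      where
      f = d + m
      f< : f < d + suc m
      f< = ≤-reflexive (sym (+-suc d m))
      f<n : f < n
      f<n = <-≤-trans f< d+m≤n
      before′ : ∀ {r} → d ≤ r → r < f → bump κ f 1 r ≡ k
      before′ d≤r r<f = trans (bump-≢ κ 1 (<⇒≢ r<f)) (before d≤r (<-trans r<f f<))
      after′ : ∀ {r} → f ≤ r → r < n → bump κ f 1 r ≡ suc k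
      after′ {r} f≤r r<n with m≤n⇒m<n∨m≡n f≤r
      ... | inj₁ f<r  = trans (bump-≢ κ 1 (≢-sym (<⇒≢ f<r))) (after (subst (_≤ r) (sym (+-suc d m)) f<r) r<n)
      ... | inj₂ refl = trans (bump-≡ κ f 1) (trans (+-comm _ 1) (cong suc (before (m≤m+n d m) f<)))
      rec = lowerBlock-schedule {k} m {bump κ f 1} (<⇒≤ f<n) before′ after′
      κ′ = proj₁ rec
      sch = proj₁ (proj₂ rec)
      lo : ∀ {r} → d ≤ r → r < n → κ′ r ≡ suc k
      lo = proj₁ (proj₂ (proj₂ rec))
      up : ∀ {r} → r < d → κ′ r ≡ κ r
      up r<d = trans (proj₂ (proj₂ (proj₂ rec)) r<d) (bump-≢ κ 1 (<⇒≢ (<-≤-trans r<d (m≤m+n d m))))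

    uppers-schedule : ∀ m f (g : ℕ → ℕ) {κ} → (∀ i → g i ≡ f + i) → (∀ {r} → r < d → κ r ≡ f) →
      ∃[ κ′ ] Schedule d n (concatMap (upperBlock d) (applyUpTo g m)) κ κ′ ×
        (∀ {r} → r < d → κ′ r ≡ f + m) × (∀ {r} → d ≤ r → κ′ r ≡ κ r)
    uppers-schedule zero    f g {κ} g≡ κ≡ = κ , done , (λ r<d → trans (κ≡ r<d) (sym (+-identityʳ f))) , λ _ → refl
    uppers-schedule (suc m) f g {κ} g≡ κ≡ with g 0 | trans (g≡ 0) (+-identityʳ f)
    ... | .f | refl with upperBlock-schedule {f} d 0 id {κ} (λ _ → refl) refl (λ ()) (λ _ → κ≡)
    ...   | κ₁ , sch₁ , up₁ , lo₁ with uppers-schedule m (suc f) (g ∘ suc) {κ₁} (λ i → trans (g≡ (suc i)) (+-suc f i)) up₁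
    ...     | κ₂ , sch₂ , up₂ , lo₂ = κ₂ , Schedule-++ sch₁ sch₂
              , (λ r<d → trans (up₂ r<d) (sym (+-suc f m))) , λ d≤r → trans (lo₂ d≤r) (lo₁ d≤r)

    lowers-schedule : ∀ m f (g : ℕ → ℕ) {κ} → (∀ i → g i ≡ f + i) → (∀ {r} → d ≤ r → r < n → κ r ≡ f) →
      ∃[ κ′ ] Schedule d n (concatMap (lowerBlock d n) (applyUpTo g m)) κ κ′ ×
        (∀ {r} → d ≤ r → r < n → κ′ r ≡ f + m) × (∀ {r} → r < d → κ′ r ≡ κ r)
    lowers-schedule zero    f g {κ} g≡ κ≡ = κ , done , (λ d≤r r<n → trans (κ≡ d≤r r<n) (sym (+-identityʳ f))) , λ _ → refl
    lowers-schedule (suc m) f g {κ} g≡ κ≡ with g 0 | trans (g≡ 0) (+-identityʳ f)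
    ... | .f | refl with lowerBlock-schedule {f} (n ∸ d) {κ} (≤-reflexive d+[n∸d]≡n)
        (λ d≤r r< → κ≡ d≤r (subst (_ <_) d+[n∸d]≡n r<)) (λ n≤r r<n → contradiction r<n (≤⇒≯ (subst (_≤ _) d+[n∸d]≡n n≤r)))
      where d+[n∸d]≡n = m+[n∸m]≡n d≤n
    ...   | κ₁ , sch₁ , lo₁ , up₁ with lowers-schedule m (suc f) (g ∘ suc) {κ₁} (λ i → trans (g≡ (suc i)) (+-suc f i)) lo₁
    ...     | κ₂ , sch₂ , lo₂ , up₂ = κ₂ , Schedule-++ sch₁ sch₂
              , (λ d≤r r<n → trans (lo₂ d≤r r<n) (sym (+-suc f m))) , λ r<d → trans (up₂ r<d) (up₁ r<d)

    steps-schedule : ∀ N → ∃[ κ′ ] Schedule d n (steps d n N) (λ _ → 0) κ′ ×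
      (∀ {r} → r < d → κ′ r ≡ N) × (∀ {r} → d ≤ r → r < n → κ′ r ≡ n)
    steps-schedule N with uppers-schedule N 0 id {λ _ → 0} (λ _ → refl) (λ _ → refl)
    ... | κ₁ , sch₁ , up₁ , lo₁ with lowers-schedule n 0 id {κ₁} (λ _ → refl) (λ d≤r _ → lo₁ d≤r)
    ...   | κ₂ , sch₂ , lo₂ , up₂ = κ₂ , Schedule-++ sch₁ sch₂ , (λ r<d → trans (up₂ r<d) (up₁ r<d)) , lo₂

  -- Partitions as functions of the row index

  rows : Partition → ℕ → ℕ
  rows lam = nth (parts lam)

  -- The proofs stored in a `Partition` are irrelevant; decidability makes them available again.
  parts-linked : ∀ lam → Linked _≥_ (parts lam)
  parts-linked (partition ps dec _) = recompute (linked? _≥?_ ps) dec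

  parts-positive : ∀ lam → All (0 <_) (parts lam)
  parts-positive (partition ps _ pos) = recompute (all? (0 <?_) ps) pos

  parts-injective : ∀ {lam μ} → parts lam ≡ parts μ → lam ≡ μ
  parts-injective {partition ps _ _} {partition .ps _ _} refl = refl

  nth-decreasing : ∀ {ps} → Linked _≥_ ps → Decreasing (nth ps)
  nth-decreasing []            r       = z≤n
  nth-decreasing [-]           zero    = z≤n
  nth-decreasing [-]           (suc r) = z≤n
  nth-decreasing (p≥q ∷ _)     zero    = p≥q
  nth-decreasing (_ ∷ linked)  (suc r) = nth-decreasing linked r

  decreasing-nth : ∀ ps → Decreasing (nth ps) → Linked _≥_ ps
  decreasing-nth []           dec = []
  decreasing-nth (p ∷ [])     dec = [-]
  decreasing-nth (p ∷ q ∷ ps) dec = dec 0 ∷ decreasing-nth (q ∷ ps) (dec ∘ suc)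

  rows-decreasing : ∀ lam → Decreasing (rows lam)
  rows-decreasing lam = nth-decreasing (parts-linked lam)

  nth-beyond : ∀ ps {r} → length ps ≤ r → nth ps r ≡ 0
  nth-beyond []       _         = refl
  nth-beyond (p ∷ ps) (s≤s len) = nth-beyond ps len

  nth-within : ∀ ps {r} → 0 < nth ps r → r < length ps
  nth-within ps {r} 0<nth with r <? length ps
  ... | yes p = p
  ... | no ¬p = contradiction (nth-beyond ps (≮⇒≥ ¬p)) (≢-sym (<⇒≢ 0<nth))

  nth-positive : ∀ {ps} → All (0 <_) ps → ∀ {r} → r < length ps → 0 < nth ps r
  nth-positive (p ∷ ps) {zero}  _       = p
  nth-positive (p ∷ ps) {suc r} (s≤s l) = nth-positive ps l

  -- Positivity distinguishes a part from the zeros that `nth` returns past the end.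
  nth-injective : ∀ {ps qs} → All (0 <_) ps → All (0 <_) qs → (∀ r → nth ps r ≡ nth qs r) → ps ≡ qs
  nth-injective []       []       eq = refl
  nth-injective []       (q ∷ _)  eq = contradiction (eq 0) (<⇒≢ q)
  nth-injective (p ∷ _)  []       eq = contradiction (sym (eq 0)) (<⇒≢ p)
  nth-injective (_ ∷ ps) (_ ∷ qs) eq = cong₂ _∷_ (eq 0) (nth-injective ps qs (eq ∘ suc))

  module _ {p} {P : ℕ → Set p} (P? : Decidable P) where

    filter-all-¬ : ∀ {xs} → All (λ x → ¬ P x) xs → length (filter P? xs) ≡ 0
    filter-all-¬ []         = refl
    filter-all-¬ {x ∷ _} (¬p ∷ ¬ps) with P? x
    ... | yes p = contradiction p ¬p
    ... | no _  = filter-all-¬ ¬ps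

    -- The hypothesis makes the entries satisfying `P` a prefix of the list, so their number tells
    -- where they end. Both `diag` and `conj` are counts of this kind.
    <count⁻ : ∀ {xs} → AllPairs (λ x y → P y → P x) xs → ∀ {r} → r < length (filter P? xs) → P (nth xs r)
    <count⁻ {x ∷ xs} (closed ∷ closeds) {r} r< with P? x
    <count⁻ {x ∷ xs} (closed ∷ closeds) {zero}  r<       | yes p = p
    <count⁻ {x ∷ xs} (closed ∷ closeds) {suc r} (s≤s r<) | yes p = <count⁻ closeds r<
    ... | no ¬p with () ← subst (r <_) (filter-all-¬ (All.map (λ c → ¬p ∘ c) closed)) r<

    <count⁺ : ∀ {xs} → AllPairs (λ x y → P y → P x) xs → ∀ {r} → r < length xs → P (nth xs r) →
      r < length (filter P? xs)
    <count⁺ {x ∷ xs} (closed ∷ closeds) {r} r< p with P? x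
    <count⁺ {x ∷ xs} (closed ∷ closeds) {zero}  r< p       | yes _ = s≤s z≤n
    <count⁺ {x ∷ xs} (closed ∷ closeds) {suc r} (s≤s r<) p | yes _ = s≤s (<count⁺ closeds r< p)
    <count⁺ {x ∷ xs} (closed ∷ closeds) {zero}  r< p       | no ¬p = contradiction p ¬p
    <count⁺ {x ∷ xs} (closed ∷ closeds) {suc r} (s≤s r<) p | no ¬p = contradiction (nth-lookup closed r<) λ c → ¬p (c p)
      where
      nth-lookup : ∀ {q} {Q : ℕ → Set q} {ys r} → All Q ys → r < length ys → Q (nth ys r)
      nth-lookup {r = zero}  (q ∷ _)  _       = q
      nth-lookup {r = suc r} (_ ∷ qs) (s≤s l) = nth-lookup qs l

  nth-1… : ∀ m {r} → r < m → nth (1… m) r ≡ suc r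
  nth-1… m {r} r<m = trans (cong (λ xs → nth xs r) (map-upTo suc m)) (go suc m r<m)
    where
    go : ∀ f m {r} → r < m → nth (applyUpTo f m) r ≡ f r
    go f (suc m) {zero}  _       = refl
    go f (suc m) {suc r} (s≤s l) = go (f ∘ suc) m l

  length-1… : ∀ m → length (1… m) ≡ m
  length-1… m = trans (length-map suc (upTo m)) (length-upTo m)

  module _ (lam : Partition) where

    private
      closed : AllPairs (λ i j → j ≤ part lam j → i ≤ part lam i) (1… ℓ lam)
      closed = AllPairs.map⁺ (AllPairs.applyUpTo⁺₁ id (ℓ lam) λ i<j _ j≤ →
        ≤-trans i<j (≤-trans (≤-trans (n≤1+n _) j≤) (decreasing-≤ (rows-decreasing lam) (<⇒≤ i<j))))

    <diag⁻ : ∀ {r} → r < diag lam → r < rows lam r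
    <diag⁻ {r} r<d = subst (λ i → i ≤ part lam i) (nth-1… (ℓ lam) r<ℓ) (<count⁻ (λ i → i ≤? part lam i) closed r<d)
      where
      r<ℓ : r < ℓ lam
      r<ℓ = <-≤-trans r<d (≤-trans (length-filter (λ i → i ≤? part lam i) (1… ℓ lam)) (≤-reflexive (length-1… (ℓ lam))))

    <diag⁺ : ∀ {r} → r < rows lam r → r < diag lam
    <diag⁺ {r} r<row = <count⁺ (λ i → i ≤? part lam i) closed
      (subst (r <_) (sym (length-1… (ℓ lam))) r<ℓ)
      (subst (λ i → i ≤ part lam i) (sym (nth-1… (ℓ lam) r<ℓ)) r<row)
      where
      r<ℓ : r < ℓ lam
      r<ℓ = nth-within (parts lam) (≤-trans (s≤s z≤n) r<row)

    <conj⁻ : ∀ {r c} → r < conj lam c → c ≤ rows lam r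
    <conj⁻ {c = c} = <count⁻ (c ≤?_) (AllPairs.map (λ x≥y c≤y → ≤-trans c≤y x≥y)
      (Linked⇒AllPairs (λ p q → ≤-trans q p) (parts-linked lam)))

    <conj⁺ : ∀ {r c} → 0 < c → c ≤ rows lam r → r < conj lam c
    <conj⁺ {c = c} 0<c c≤ = <count⁺ (c ≤?_) (AllPairs.map (λ x≥y c≤y → ≤-trans c≤y x≥y)
      (Linked⇒AllPairs (λ p q → ≤-trans q p) (parts-linked lam)))
      (nth-within (parts lam) (≤-trans 0<c c≤)) c≤

    hook : Hook (diag lam) (rows lam)
    hook = record { decreasing = rows-decreasing lam ; d≤s = λ {r} → d≤s r ; s≤d = s≤d }
      where
      d≤s : ∀ r → r < diag lam → diag lam ≤ rows lam r
      d≤s r r<d with diag lam in eq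
      ... | suc d = ≤-trans (<diag⁻ (≤-reflexive (sym eq))) (decreasing-≤ (rows-decreasing lam) (≤-pred r<d))
      s≤d : ∀ {r} → diag lam ≤ r → rows lam r ≤ diag lam
      -- If the row of index `diag lam` were longer than `diag lam`, it would meet the diagonal and
      -- be counted itself.
      s≤d d≤r = ≤-trans (decreasing-≤ (rows-decreasing lam) d≤r) (≮⇒≥ λ d<s → <-irrefl refl (<diag⁺ d<s))

    hook-diag : ∀ {d} → Hook d (rows lam) → diag lam ≡ d
    hook-diag {d} h with <-cmp (diag lam) d
    ... | tri≈ _ eq _ = eq
    ... | tri< c<d _ _ = contradiction (<diag⁺ (≤-trans c<d (Hook.d≤s h c<d))) (<-irrefl refl)
    ... | tri> _ _ d<c = contradiction (<diag⁻ d<c) (≤⇒≯ (Hook.s≤d h ≤-refl))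

  -- Stopping at the first zero makes all parts positive and loses nothing of a decreasing function
  -- that vanishes from `n` on.
  shape : ℕ → (ℕ → ℕ) → List ℕ
  shape zero    s = []
  shape (suc n) s with s 0 ≟ 0
  ... | yes _ = []
  ... | no  _ = s 0 ∷ shape n (s ∘ suc)

  nth-shape : ∀ n {s} → Decreasing s → (∀ {r} → n ≤ r → s r ≡ 0) → ∀ r → nth (shape n s) r ≡ s r
  nth-shape zero    dec 0≡ r = sym (0≡ z≤n)
  nth-shape (suc n) {s} dec 0≡ r with s 0 ≟ 0
  ... | yes s0≡0 = sym (n≤0⇒n≡0 (≤-trans (decreasing-≤ dec z≤n) (≤-reflexive s0≡0)))
  nth-shape (suc n) {s} dec 0≡ zero    | no _ = refl
  nth-shape (suc n) {s} dec 0≡ (suc r) | no _ = nth-shape n (dec ∘ suc) (0≡ ∘ s≤s) r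

  shape-positive : ∀ n s → All (0 <_) (shape n s)
  shape-positive zero    s = []
  shape-positive (suc n) s with s 0 ≟ 0
  ... | yes _    = []
  ... | no s0≢0 = n≢0⇒n>0 s0≢0 ∷ shape-positive n (s ∘ suc)

  length-shape : ∀ n s → length (shape n s) ≤ n
  length-shape zero    s = z≤n
  length-shape (suc n) s with s 0 ≟ 0
  ... | yes _ = z≤n
  ... | no _  = s≤s (length-shape n (s ∘ suc))

  -- The empty partition is a junk value.
  toPartition : List ℕ → Partition
  toPartition ps with linked? _≥?_ ps | all? (0 <?_) ps
  ... | yes dec | yes pos = partition ps dec pos
  ... | _       | _       = partition [] [] []

  parts-toPartition : ∀ {ps} → Linked _≥_ ps → All (0 <_) ps → parts (toPartition ps) ≡ ps
  parts-toPartition {ps} dec pos with linked? _≥?_ ps | all? (0 <?_) ps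
  ... | yes _   | yes _   = refl
  ... | no ¬dec | _       = contradiction dec ¬dec
  ... | yes _   | no ¬pos = contradiction pos ¬pos

  -- Boxes of a skew shape and their fillings

  InSkew : Partition → Partition → Box → Set
  InSkew lam μ (i , j) = ∃[ r ] i ≡ suc r × rows μ r < j × j ≤ rows lam r

  module _ (lam μ : Partition) where

    ∈-skew⁻ : ∀ {b} → b ∈ skew lam μ → InSkew lam μ b
    ∈-skew⁻ {i , j} b∈ with ∈-filter⁻ _ {xs = boxes lam} b∈
    ... | b∈′ , μ<j with find (∈-concatMap⁻ (λ i → map (i ,_) (1… part lam i)) {xs = 1… ℓ lam} b∈′)
    ...   | i , i∈ , b∈″ with ∈-map⁻ suc i∈ | ∈-map⁻ (i ,_) b∈″
    ...     | r , _ , refl | j , j∈ , refl with ∈-map⁻ suc j∈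
    ...       | c , c∈ , refl = r , refl , μ<j , ∈-upTo⁻ c∈

    ∈-skew⁺ : ∀ {r c} → rows μ r < c → c ≤ rows lam r → (suc r , c) ∈ skew lam μ
    ∈-skew⁺ {r} {suc c} μ<c c≤ = ∈-filter⁺ _ {xs = boxes lam}
      (∈-concatMap⁺ (λ i → map (i ,_) (1… part lam i))
        (lose (∈-map⁺ suc (∈-upTo⁺ (nth-within (parts lam) (≤-trans (s≤s z≤n) c≤))))
          (∈-map⁺ (suc r ,_) (∈-map⁺ suc (∈-upTo⁺ c≤))))) μ<c

    skew-unique : Unique (skew lam μ)
    skew-unique = filter⁺ _ {xs = boxes lam} (Unique-concatMap (λ i → map (i ,_) (1… part lam i))
      (map⁺ suc-injective (upTo⁺ (ℓ lam)))
      (λ {i} _ → map⁺ (cong proj₂) (map⁺ suc-injective (upTo⁺ (part lam i))))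
      λ {i} {i′} p q → same (∈-map⁻ (i ,_) p) (∈-map⁻ (i′ ,_) q))
      where
      same : ∀ {i i′ : ℕ} {v : Box} {xs ys : List ℕ} →
        (∃[ j ] j ∈ xs × v ≡ (i , j)) → (∃[ j ] j ∈ ys × v ≡ (i′ , j)) → i ≡ i′
      same (_ , _ , refl) (_ , _ , refl) = refl

  module _ (E : Box → List ℤ) where

    private
      ext : Box → ℤ → (Box → ℤ) → Box → ℤ
      ext b v T c = if does (c ≟ᴮ b) then v else T c

      ext-≡ : ∀ b v T → ext b v T b ≡ v
      ext-≡ b v T rewrite dec-true (b ≟ᴮ b) refl = refl

      ext-≢ : ∀ {b} v T {c} → c ≢ b → ext b v T c ≡ T c
      ext-≢ {b} v T {c} c≢b rewrite dec-false (c ≟ᴮ b) c≢b = refl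

    ∈-fillings⁻ : ∀ bs {T} → T ∈ fillings E bs → ∀ {b} → b ∈ bs → T b ∈ E b
    ∈-fillings⁻ (b ∷ bs) T∈ {c} c∈ with find (∈-concatMap⁻ (λ v → map (ext b v) (fillings E bs)) {xs = E b} T∈)
    ... | v , v∈ , T∈′ with ∈-map⁻ (ext b v) T∈′
    ...   | T , T∈″ , refl = ext∈ c c∈ (c ≟ᴮ b)
      where
      ext∈ : ∀ c → c ∈ b ∷ bs → Dec (c ≡ b) → ext b v T c ∈ E c
      ext∈ c c∈ (yes refl) = subst (_∈ E b) (sym (ext-≡ b v T)) v∈
      ext∈ c (here c≡b) (no c≢b) = contradiction c≡b c≢b
      ext∈ c (there c∈) (no c≢b) = subst (_∈ E c) (sym (ext-≢ v T c≢b)) (∈-fillings⁻ bs T∈″ c∈)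

    -- The listed filling agrees with `g` on `bs` only, as its values elsewhere are 0. Later
    -- comparisons of fillings therefore look at the values on the boxes.
    ∈-fillings⁺ : ∀ bs {g : Box → ℤ} → (∀ {b} → b ∈ bs → g b ∈ E b) →
      ∃[ T ] T ∈ fillings E bs × (∀ {b} → b ∈ bs → T b ≡ g b)
    ∈-fillings⁺ []       g∈ = _ , here refl , λ ()
    ∈-fillings⁺ (b ∷ bs) {g} g∈ with ∈-fillings⁺ bs {g} (g∈ ∘ there)
    ... | T , T∈ , T≡ = ext b (g b) T
      , ∈-concatMap⁺ (λ v → map (ext b v) (fillings E bs)) (lose (g∈ (here refl)) (∈-map⁺ (ext b (g b)) T∈))
      , λ {c} c∈ → ext≡ c c∈ (c ≟ᴮ b)
      where
      ext≡ : ∀ c → c ∈ b ∷ bs → Dec (c ≡ b) → ext b (g b) T c ≡ g c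
      ext≡ c c∈ (yes refl) = ext-≡ b (g b) T
      ext≡ c (here c≡b) (no c≢b) = contradiction c≡b c≢b
      ext≡ c (there c∈) (no c≢b) = trans (ext-≢ (g b) T c≢b) (T≡ c∈)

    -- Distinctness is asserted for the lists of values, which is stronger than for the functions:
    -- these lists will represent the tableaux in `tableauCodes`.
    fillings-unique : ∀ {bs} → Unique bs → (∀ b → Unique (E b)) →
      AllPairs (λ T T′ → map T bs ≢ map T′ bs) (fillings E bs)
    fillings-unique {[]}     _ uE = [] ∷ []
    fillings-unique {b ∷ bs} (b∉ ∷ u) uE = AllPairs.concat⁺
      (All.map⁺ (All.tabulate λ {v} _ → AllPairs.map⁺ (AllPairs.map
        (λ {T} {T′} ne eq → ne (trans (sym (ext-map v T)) (trans (∷-injectiveʳ eq) (ext-map v T′)))) (fillings-unique u uE))))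
      (AllPairs.map⁺ (AllPairs.map (λ {v} {v′} v≢v′ → All.map⁺ (All.tabulate λ {T} _ → All.map⁺ (All.tabulate λ {T′} _ eq →
        v≢v′ (trans (sym (ext-≡ b v T)) (trans (∷-injectiveˡ eq) (ext-≡ b v′ T′)))))) (uE b)))
      where
      ext-map : ∀ v T → map (ext b v T) bs ≡ map T bs
      ext-map v T = map-cong-local (All.map (λ b≢c → ext-≢ v T (≢-sym b≢c)) b∉)

  -- Translating between steps and entries

  toStep : ℕ → ℤ → Step
  toStep r (ℤ.+ zero)    = upper 0 r
  toStep r (ℤ.+ (suc k)) = lower k r
  toStep r -[1+ k ]      = upper (suc k) r

  toStep-value : ∀ σ → toStep (row σ) (value σ) ≡ σ
  toStep-value (upper zero r)    = refl
  toStep-value (upper (suc k) r) = refl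
  toStep-value (lower k r)       = refl

  value-toStep : ∀ r z → value (toStep r z) ≡ z
  value-toStep r (ℤ.+ zero)    = refl
  value-toStep r (ℤ.+ (suc k)) = refl
  value-toStep r -[1+ k ]      = refl

  row-toStep : ∀ r z → row (toStep r z) ≡ r
  row-toStep r (ℤ.+ zero)    = refl
  row-toStep r (ℤ.+ (suc k)) = refl
  row-toStep r -[1+ k ]      = refl

  neg : ℕ → ℤ
  neg k = ℤ.- (ℤ.+ k)

  neg-cancel-< : ∀ {k k′} → neg k′ ℤ.< neg k → k < k′
  neg-cancel-< {k} {k′} p = ℤ.drop‿+<+ (ℤ.neg-cancel-< p)

  neg-cancel-≤ : ∀ {k k′} → neg k′ ℤ.≤ neg k → k ≤ k′
  neg-cancel-≤ {k} {k′} p = ℤ.drop‿+≤+ (ℤ.neg-cancel-≤ p)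

  neg-injective : ∀ {k k′} → neg k ≡ neg k′ → k ≡ k′
  neg-injective p = ℤ.+-injective (ℤ.neg-injective p)

  adderAt : List Step → (ℕ → ℕ) → List ℕ → Box → ℤ
  adderAt σs s ts (i , j) = value (adder σs s ts (i ∸ 1) j)

  -- Dual hook tableaux correspond to runs

  module _ {d : ℕ} {lam μ : Partition} (hλ : Hook d (rows lam)) (hμ : Hook d (rows μ)) where

    private
      λ↓ = Hook.decreasing hλ
      μ↓ = Hook.decreasing hμ

      entries-upper : ∀ {r c} → r < d → entries d lam (suc r , c) ≡ map (λ k → ℤ.- (ℤ.+ k)) (upTo (rows lam r ∸ suc r))
      entries-upper {r} r<d rewrite dec-true (suc r ≤? d) r<d = refl

      entries-lower : ∀ {r c} → d ≤ r → entries d lam (suc r , c) ≡ map ℤ.+_ (1… (conj lam c ∸ c))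
      entries-lower {r} d≤r rewrite dec-false (suc r ≤? d) (≤⇒≯ d≤r) = refl

      -- Together with `upper-column`: as both shapes have Durfee square of side `d`, a box of λ/μ
      -- lies in the first `d` columns exactly if it lies below the first `d` rows. Hence each box
      -- is subject to one half of the tableau conditions.
      lower-column : ∀ {r c} → rows μ r < c → c ≤ rows lam r → d ≤ r → c ≤ d
      lower-column μ<c c≤ d≤r = ≤-trans c≤ (Hook.s≤d hλ d≤r)

      upper-column : ∀ {r c} → rows μ r < c → c ≤ d → d ≤ r
      upper-column {r} μ<c c≤d with d ≤? r
      ... | yes p = p
      ... | no ¬p = contradiction (≤-trans c≤d (Hook.d≤s hμ (≰⇒> ¬p))) (<⇒≱ μ<c)

    entries-unique : ∀ b → Unique (entries d lam b)
    entries-unique (i , j) with i ≤? d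
    ... | yes p rewrite dec-true (i ≤? d) p = map⁺ neg-injective (upTo⁺ _)
    ... | no ¬p rewrite dec-false (i ≤? d) ¬p = map⁺ ℤ.+-injective (map⁺ suc-injective (upTo⁺ _))

    module FromTableau {T : Box → ℤ} (T∈ : T ∈ dualHookTableaux d lam μ) where

      data Entry (r c : ℕ) : Set where
        upper : ∀ k → r < d → T (suc r , c) ≡ neg k → k < rows lam r ∸ suc r → Entry r c
        lower : ∀ k → d ≤ r → T (suc r , c) ≡ ℤ.+ (suc k) → k < conj lam c ∸ c → Entry r c

      T∈fillings : T ∈ fillings (entries d lam) (skew lam μ)
      T∈fillings = proj₁ (∈-filter⁻ (isTableau? d (skew lam μ)) {xs = fillings (entries d lam) (skew lam μ)} T∈)

      isTableau : IsTableau d (skew lam μ) T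
      isTableau = proj₂ (∈-filter⁻ (isTableau? d (skew lam μ)) {xs = fillings (entries d lam) (skew lam μ)} T∈)

      entry : ∀ {r c} → rows μ r < c → c ≤ rows lam r → Entry r c
      entry {r} {c} μ<c c≤ with ∈-fillings⁻ (entries d lam) (skew lam μ) T∈fillings (∈-skew⁺ lam μ μ<c c≤) | r <? d
      ... | Tb∈ | yes r<d with ∈-map⁻ (λ k → ℤ.- (ℤ.+ k)) (subst (T (suc r , c) ∈_) (entries-upper {r} {c} r<d) Tb∈)
      ...   | k , k∈ , eq = upper k r<d eq (∈-upTo⁻ k∈)
      entry {r} {c} μ<c c≤ | Tb∈ | no r≮d with ∈-map⁻ ℤ.+_ (subst (T (suc r , c) ∈_) (entries-lower {r} {c} (≮⇒≥ r≮d)) Tb∈)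
      ...   | k₁ , k₁∈ , eq with ∈-map⁻ suc k₁∈
      ...     | k , k∈ , refl = lower k (≮⇒≥ r≮d) eq (∈-upTo⁻ k∈)

      compatible : ∀ {r c r′ c′} → rows μ r < c → c ≤ rows lam r → rows μ r′ < c′ → c′ ≤ rows lam r′ →
        Compatible d T (suc r , c) (suc r′ , c′)
      compatible p q p′ q′ = All.lookup (All.lookup isTableau (∈-skew⁺ lam μ p q)) (∈-skew⁺ lam μ p′ q′)

      along-upper : ∀ {r c c′ k k′} → r < d → rows μ r < c → c < c′ → c′ ≤ rows lam r →
        T (suc r , c) ≡ neg k → T (suc r , c′) ≡ neg k′ → k < k′
      along-upper r<d μ<c c<c′ c′≤ eq eq′ = neg-cancel-< (subst₂ ℤ._<_ eq′ eq
        (proj₁ (compatible μ<c (≤-trans (<⇒≤ c<c′) c′≤) (<-trans μ<c c<c′) c′≤) refl c<c′ r<d))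

      down-lower : ∀ {r c k k′} → d ≤ r → rows μ r < c → c ≤ rows lam (suc r) →
        T (suc r , c) ≡ ℤ.+ (suc k) → T (suc (suc r) , c) ≡ ℤ.+ (suc k′) → k < k′
      down-lower {r} {c} d≤r μ<c c≤ eq eq′ = ≤-pred (ℤ.drop‿+<+ (subst₂ ℤ._<_ eq eq′
        (proj₁ (proj₂ (proj₂ (compatible μ<c c≤′ (≤-<-trans (μ↓ r) μ<c) c≤))) refl (n<1+n _) (lower-column μ<c c≤′ d≤r))))
        where
        c≤′ : c ≤ rows lam r
        c≤′ = ≤-trans c≤ (λ↓ r)

      -- Induction on the distance `m` from the end of the row, where membership in `entries` is the
      -- bound itself. Each box further left has a strictly smaller `k`, which makes up for its
      -- smaller column number.
      flag-upper : ∀ m {r c k} → c + m ≡ rows lam r → r < d → rows μ r < c → T (suc r , c) ≡ neg k →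
        suc (k + r) < c
      flag-upper zero {r} {c} {k} c≡ r<d μ<c eq with entry μ<c (≤-reflexive (trans (sym (+-identityʳ c)) c≡))
      ... | lower _ d≤r _ _ = contradiction r<d (≤⇒≯ d≤r)
      ... | upper k′ _ eq′ k′< with neg-injective (trans (sym eq) eq′)
      ...   | refl = subst₂ _≤_ (cong suc (+-suc k r)) (trans (sym c≡) (+-identityʳ c)) (m≤n∸o⇒m+o≤n k′<)
        where
        m≤n∸o⇒m+o≤n : suc k ≤ rows lam r ∸ suc r → suc k + suc r ≤ rows lam r
        m≤n∸o⇒m+o≤n p = subst (_≤ rows lam r) (+-comm (suc r) (suc k)) (≤∸⇒+≤ {suc r} p)
      flag-upper (suc m) {r} {c} {k} c≡ r<d μ<c eq with entry (m≤n⇒m≤1+n μ<c) (≤-trans (≤-trans (≤-reflexive (+-comm 1 c)) (+-monoʳ-≤ c (s≤s z≤n))) (≤-reflexive c≡))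
      ... | lower _ d≤r _ _ = contradiction r<d (≤⇒≯ d≤r)
      ... | upper k′ _ eq′ _ = <-≤-trans (s≤s (+-monoˡ-< r (along-upper r<d μ<c (n<1+n c)
              (≤-trans (≤-trans (≤-reflexive (+-comm 1 c)) (+-monoʳ-≤ c (s≤s z≤n))) (≤-reflexive c≡)) eq eq′)))
            (≤-pred (flag-upper m (trans (sym (+-suc c m)) c≡) r<d (m≤n⇒m≤1+n μ<c) eq′))

      -- As `flag-upper`, with the distance from the bottom of the column in place of that from the
      -- end of the row.
      flag-lower : ∀ m {r c k} → suc r + m ≡ conj lam c → d ≤ r → rows μ r < c → c ≤ rows lam r →
        T (suc r , c) ≡ ℤ.+ (suc k) → k + c ≤ r
      flag-lower zero {r} {c} {k} r≡ d≤r μ<c c≤ eq with entry μ<c c≤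
      ... | upper _ r<d _ _ = contradiction r<d (≤⇒≯ d≤r)
      ... | lower k′ _ eq′ k′< with ℤ.+-injective (trans (sym eq) eq′)
      ...   | refl = ≤-pred (subst₂ _≤_ (+-comm c (suc k)) (trans (sym r≡) (+-identityʳ (suc r))) (≤∸⇒+≤ k′<))
      flag-lower (suc m) {r} {c} {k} r≡ d≤r μ<c c≤ eq with <conj⁻ lam (≤-trans (≤-reflexive (+-comm 1 (suc r))) (≤-trans (+-monoʳ-≤ (suc r) (s≤s z≤n)) (≤-reflexive r≡)))
      ... | c≤′ with entry (≤-<-trans (μ↓ r) μ<c) c≤′
      ...   | upper _ r<d _ _ = contradiction (<-trans (n<1+n r) r<d) (≤⇒≯ d≤r)
      ...   | lower k′ _ eq′ _ = ≤-pred (<-≤-trans (s≤s (+-monoˡ-≤ c (≤-refl {k})))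
              (≤-trans (+-monoˡ-≤ c (down-lower d≤r μ<c c≤′ eq eq′))
                (flag-lower m (trans (cong suc (sym (+-suc r m))) r≡) (≤-trans d≤r (n≤1+n r)) (≤-<-trans (μ↓ r) μ<c) c≤′ eq′)))

      private
        step : ℕ → ℕ → Step
        step r c = toStep r (T (suc r , c))

        toStep-neg : ∀ r k → toStep r (neg k) ≡ upper k r
        toStep-neg r k = toStep-value (upper k r)

        step-upper : ∀ {r c k} → T (suc r , c) ≡ neg k → step r c ≡ upper k r
        step-upper {r} {k = k} eq = trans (cong (toStep r) eq) (toStep-neg r k)

        step-lower : ∀ {r c k} → T (suc r , c) ≡ ℤ.+ (suc k) → step r c ≡ lower k r
        step-lower {r} eq = cong (toStep r) eq

      filling : ∀ {n N} → d ≤ n → ℓ lam ≤ n → rows lam 0 ≤ N → μ ⊆ lam →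
        Filling (steps d n N) (rows μ) (rows lam) step
      filling {n} {N} d≤n ℓ≤n λ₁≤N μ⊆λ = record
        { s≤l    = μ⊆λ ∘ suc
        ; isStep = isStep
        ; isRow  = λ {r} {c} _ _ → row-toStep r (T (suc r , c))
        ; flag   = flag
        ; along  = along
        ; down   = down
        }
        where
        isStep : ∀ {r c} → rows μ r < c → c ≤ rows lam r → step r c ∈ steps d n N
        isStep {r} {c} p q with entry p q
        ... | upper k r<d eq k< = subst (_∈ steps d n N) (sym (step-upper eq)) (∈-steps⁺ d≤n (upper k r)
                (<-≤-trans k< (≤-trans (m∸n≤m _ (suc r)) (≤-trans (decreasing-≤ λ↓ z≤n) λ₁≤N)) , r<d))
        ... | lower k d≤r eq k< = subst (_∈ steps d n N) (sym (step-lower eq)) (∈-steps⁺ {N = N} d≤n (lower k r)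
                ( <-≤-trans k< (≤-trans (m∸n≤m (conj lam c) c) (≤-trans (length-filter (c ≤?_) (parts lam)) ℓ≤n))
                , d≤r , <-≤-trans (nth-within (parts lam) (≤-trans (s≤s z≤n) (≤-trans p q))) ℓ≤n))

        flag : ∀ {r c} → rows μ r < c → c ≤ rows lam r → Flag (step r c) c
        flag {r} {c} p q with entry p q
        ... | upper k r<d eq _ = subst (λ σ → Flag σ c) (sym (step-upper eq))
                (flag-upper (rows lam r ∸ c) (m+[n∸m]≡n q) r<d p eq)
        ... | lower k d≤r eq _ = subst (λ σ → Flag σ c) (sym (step-lower eq))
                (flag-lower (conj lam c ∸ suc r) (m+[n∸m]≡n (<conj⁺ lam (≤-trans (s≤s z≤n) p) q)) d≤r p q eq)

        along : ∀ {r c c′} → rows μ r < c → c < c′ → c′ ≤ rows lam r →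
          step r c ≺ step r c′ ⊎ (step r c ≡ step r c′ × IsLower (step r c))
        along {r} {c} {c′} p c<c′ q with entry p (≤-trans (<⇒≤ c<c′) q) | entry (<-trans p c<c′) q
        ... | upper k r<d eq _ | upper k′ _ eq′ _ = inj₁ (subst₂ _≺_ (sym (step-upper eq)) (sym (step-upper eq′))
                (inj₁ (along-upper r<d p c<c′ q eq eq′)))
        ... | upper _ r<d _ _ | lower _ d≤r _ _ = contradiction r<d (≤⇒≯ d≤r)
        ... | lower _ d≤r _ _ | upper _ r<d _ _ = contradiction r<d (≤⇒≯ d≤r)
        ... | lower k d≤r eq _ | lower k′ _ eq′ _ with m≤n⇒m<n∨m≡n (≤-pred (ℤ.drop‿+≤+ (subst₂ ℤ._≤_ eq eq′
                (proj₂ (proj₂ (proj₂ (compatible p (≤-trans (<⇒≤ c<c′) q) (<-trans p c<c′) q))) refl c<c′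
                  (lower-column (<-trans p c<c′) q d≤r)))))
        ...   | inj₁ k<k′ = inj₁ (subst₂ _≺_ (sym (step-lower eq)) (sym (step-lower eq′)) (inj₁ k<k′))
        -- Equal neighbours in a lower row come from one step that adds both boxes.
        ...   | inj₂ refl = inj₂ (trans (step-lower eq) (sym (step-lower eq′)) , subst IsLower (sym (step-lower eq)) tt)

        down : ∀ {r c} → rows μ r < c → c ≤ rows lam (suc r) → step r c ≺ step (suc r) c
        down {r} {c} p q with entry p (≤-trans q (λ↓ r)) | entry (≤-<-trans (μ↓ r) p) q
        ... | upper k r<d eq _ | lower k′ _ eq′ _ = subst₂ _≺_ (sym (step-upper eq)) (sym (step-lower eq′)) tt
        ... | lower _ d≤r _ _ | upper _ r<d _ _ = contradiction (<-trans (n<1+n r) r<d) (≤⇒≯ d≤r)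
        ... | lower k d≤r eq _ | lower k′ _ eq′ _ = subst₂ _≺_ (sym (step-lower eq)) (sym (step-lower eq′))
                (inj₁ (down-lower d≤r p q eq eq′))
        ... | upper k r<d eq _ | upper k′ r′<d eq′ _ = subst₂ _≺_ (sym (step-upper eq)) (sym (step-upper eq′)) k≼k′
          where
          k≼k′ : upper k r ≺ upper k′ (suc r)
          k≼k′ with m≤n⇒m<n∨m≡n (neg-cancel-≤ (subst₂ ℤ._≤_ eq′ eq
              (proj₁ (proj₂ (compatible p (≤-trans q (λ↓ r)) (≤-<-trans (μ↓ r) p) q)) refl (n<1+n _) r′<d)))
          ... | inj₁ k<k′ = inj₁ k<k′
          -- Equal entries in a column of the upper part are in order because `upperBlock` goes from
          -- top to bottom.
          ... | inj₂ refl = inj₂ (refl , n<1+n r)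

      -- The sign of an entry tells whether its box is counted by `m`; this is what allows `weight`
      -- to absorb the sign of a term.
      sign-≤d : ∀ {b} → b ∈ skew lam μ → (proj₁ b ≤ d × ∃[ k ] T b ≡ neg k) ⊎ (¬ proj₁ b ≤ d × ∃[ k ] T b ≡ ℤ.+ (suc k))
      sign-≤d b∈ with ∈-skew⁻ lam μ b∈
      ... | r , refl , p , q with entry p q
      ...   | upper k r<d eq _ = inj₁ (r<d , k , eq)
      ...   | lower k d≤r eq _ = inj₂ (≤⇒≯ d≤r , k , eq)

      tableau⇒run : ∀ {n N} → d ≤ n → ℓ lam ≤ n → rows lam 0 ≤ N → μ ⊆ lam →
        ∃[ ts ] Run (steps d n N) (rows μ) ts × (∀ r → final (steps d n N) (rows μ) ts r ≡ rows lam r) ×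
          (∀ {b} → b ∈ skew lam μ → adderAt (steps d n N) (rows μ) ts b ≡ T b)
      tableau⇒run {n} {N} d≤n ℓ≤n λ₁≤N μ⊆λ
        with filling⇒run (steps-sorted d n N) μ↓ λ↓ (filling d≤n ℓ≤n λ₁≤N μ⊆λ)
      ... | ts , run , fin , add = ts , run , fin , λ b∈ → add′ (∈-skew⁻ lam μ b∈)
        where
        add′ : ∀ {b} → InSkew lam μ b → adderAt (steps d n N) (rows μ) ts b ≡ T b
        add′ {_ , c} (r , refl , p , q) = trans (cong value (add p q)) (value-toStep r (T (suc r , c)))

    module FromRun {n N : ℕ} (d≤n : d ≤ n) {ts : List ℕ} (run : Run (steps d n N) (rows μ) ts)
      (fin : ∀ r → final (steps d n N) (rows μ) ts r ≡ rows lam r) where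

      private
        σs = steps d n N
        A : ℕ → ℕ → Step
        A = adder σs (rows μ) ts

        T₀ : Box → ℤ
        T₀ = adderAt σs (rows μ) ts

        ≤fin : ∀ {r c} → c ≤ rows lam r → c ≤ final σs (rows μ) ts r
        ≤fin {r} = subst (_ ≤_) (sym (fin r))

      data Added (r c : ℕ) : Set where
        upper : ∀ k → r < d → A r c ≡ upper k r → suc (k + r) < c → Added r c
        lower : ∀ k → d ≤ r → A r c ≡ lower k r → k + c ≤ r → Added r c

      added : ∀ {r c} → rows μ r < c → c ≤ rows lam r → Added r c
      added {r} {c} p q with adder-∈ run p (≤fin q)
      ... | A∈ , row≡ , flag = go (A r c) refl (∈-steps⁻ d≤n A∈) row≡ flag
        where
        go : ∀ σ → A r c ≡ σ → InRange d n N σ → row σ ≡ r → Flag σ c → Added r c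
        go (upper k .r) eq (_ , r<d) refl flag = upper k r<d eq flag
        go (lower k .r) eq (_ , d≤r , _) refl flag = lower k d≤r eq flag

      T₀∈ : ∀ {b} → b ∈ skew lam μ → T₀ b ∈ entries d lam b
      T₀∈ {_ , c} b∈ with ∈-skew⁻ lam μ b∈
      ... | r , refl , p , q with added p q
      ...   | upper k r<d eq flag = subst₂ _∈_ (sym (cong value eq)) (sym (entries-upper {r} {c} r<d))
              (∈-map⁺ (λ k → ℤ.- (ℤ.+ k)) (∈-upTo⁺ (m+n≤o⇒m≤o∸n (suc k) (≤-trans (≤-reflexive (cong suc (+-suc k r))) (≤-trans flag q)))))
      ...   | lower k d≤r eq flag = subst₂ _∈_ (sym (cong value eq)) (sym (entries-lower {r} {c} d≤r))
              (∈-map⁺ ℤ.+_ (∈-map⁺ suc (∈-upTo⁺ (m+n≤o⇒m≤o∸n (suc k) (≤-trans (s≤s flag) (<conj⁺ lam (≤-trans (s≤s z≤n) p) q))))))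

      neg-mono-< : ∀ {k k′} → k < k′ → neg k′ ℤ.< neg k
      neg-mono-< k<k′ = ℤ.neg-mono-< (ℤ.+<+ k<k′)

      compatible : ∀ {r c r′ c′} → rows μ r < c → c ≤ rows lam r → rows μ r′ < c′ → c′ ≤ rows lam r′ →
        Compatible d T₀ (suc r , c) (suc r′ , c′)
      compatible {r} {c} {r′} {c′} p q p′ q′ = along-upper , down-upper , down-lower , along-lower
        where
        along-upper : suc r ≡ suc r′ → c < c′ → suc r ≤ d → value (A r′ c′) ℤ.< value (A r c)
        along-upper refl c<c′ r<d with added p q | added p′ q′ | adder-row (steps-sorted d n N) run p c<c′ (≤fin q′)
        ... | lower _ d≤r _ _ | _ | _ = contradiction r<d (≤⇒≯ d≤r)
        ... | _ | lower _ d≤r _ _ | _ = contradiction r<d (≤⇒≯ d≤r)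
        ... | upper k _ eq _ | upper k′ _ eq′ _ | inj₂ (_ , l) = ⊥-elim (subst IsLower eq l)
        ... | upper k _ eq _ | upper k′ _ eq′ _ | inj₁ A≺ with subst₂ _≺_ eq eq′ A≺
        ...   | inj₁ k<k′ = subst₂ ℤ._<_ (sym (cong value eq′)) (sym (cong value eq)) (neg-mono-< k<k′)
        ...   | inj₂ (_ , r<r) = contradiction r<r (<-irrefl refl)

        down-upper : c ≡ c′ → suc r < suc r′ → suc r′ ≤ d → value (A r′ c′) ℤ.≤ value (A r c)
        down-upper refl (s≤s r<r′) r′<d with added p q | added p′ q′ | adder-column (steps-sorted d n N) μ↓ run r<r′ p (≤fin q′)
        ... | lower _ d≤r _ _ | _ | _ = contradiction (<-trans r<r′ r′<d) (≤⇒≯ d≤r)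
        ... | _ | lower _ d≤r′ _ _ | _ = contradiction r′<d (≤⇒≯ d≤r′)
        ... | upper k _ eq _ | upper k′ _ eq′ _ | A≺ with subst₂ _≺_ eq eq′ A≺
        ...   | inj₁ k<k′ = ℤ.<⇒≤ (subst₂ ℤ._<_ (sym (cong value eq′)) (sym (cong value eq)) (neg-mono-< k<k′))
        ...   | inj₂ (refl , _) = ℤ.≤-reflexive (trans (cong value eq′) (sym (cong value eq)))

        down-lower : c ≡ c′ → suc r < suc r′ → c ≤ d → value (A r c) ℤ.< value (A r′ c′)
        down-lower refl (s≤s r<r′) c≤d with added p q | added p′ q′ | adder-column (steps-sorted d n N) μ↓ run r<r′ p (≤fin q′)
        ... | upper _ r<d _ _ | _ | _ = contradiction r<d (≤⇒≯ (upper-column p c≤d))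
        ... | lower _ d≤r _ _ | upper _ r′<d _ _ | _ = contradiction (<-trans r<r′ r′<d) (≤⇒≯ d≤r)
        ... | lower k _ eq _ | lower k′ _ eq′ _ | A≺ with subst₂ _≺_ eq eq′ A≺
        ...   | inj₁ k<k′ = subst₂ ℤ._<_ (sym (cong value eq)) (sym (cong value eq′)) (ℤ.+<+ (s≤s k<k′))
        -- Equal entries would mean that the lower of the two boxes was added first.
        ...   | inj₂ (_ , r′<r) = contradiction r′<r (<-asym r<r′)

        along-lower : suc r ≡ suc r′ → c < c′ → c′ ≤ d → value (A r c) ℤ.≤ value (A r′ c′)
        along-lower refl c<c′ c′≤d with added p q | added p′ q′ | adder-row (steps-sorted d n N) run p c<c′ (≤fin q′)
        ... | upper _ r<d _ _ | _ | _ = contradiction r<d (≤⇒≯ (upper-column p (≤-trans (<⇒≤ c<c′) c′≤d)))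
        ... | lower _ d≤r _ _ | upper _ r<d _ _ | _ = contradiction r<d (≤⇒≯ d≤r)
        ... | lower k _ eq _ | lower k′ _ eq′ _ | inj₂ (A≡ , _) = ℤ.≤-reflexive (cong value A≡)
        ... | lower k _ eq _ | lower k′ _ eq′ _ | inj₁ A≺ with subst₂ _≺_ eq eq′ A≺
        ...   | inj₁ k<k′ = ℤ.<⇒≤ (subst₂ ℤ._<_ (sym (cong value eq)) (sym (cong value eq′)) (ℤ.+<+ (s≤s k<k′)))
        ...   | inj₂ (_ , r<r) = contradiction r<r (<-irrefl refl)

      -- The listed fillings are 0 off the shape while `T₀` has junk values there, so membership is
      -- claimed for a filling that equals `T₀` on the boxes.
      run⇒tableau : ∃[ T ] T ∈ dualHookTableaux d lam μ × (∀ {b} → b ∈ skew lam μ → T b ≡ T₀ b)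
      run⇒tableau with ∈-fillings⁺ (entries d lam) (skew lam μ) {T₀} T₀∈
      ... | T , T∈ , T≡ = T , ∈-filter⁺ (isTableau? d (skew lam μ)) T∈
          (All.tabulate λ b∈ → All.tabulate λ c∈ → go b∈ c∈ (∈-skew⁻ lam μ b∈) (∈-skew⁻ lam μ c∈)) , T≡
        where
        go : ∀ {b c} → b ∈ skew lam μ → c ∈ skew lam μ → InSkew lam μ b → InSkew lam μ c → Compatible d T b c
        go b∈ c∈ (r , refl , p , q) (r′ , refl , p′ , q′) with compatible p q p′ q′
        ... | a , b , c , e rewrite T≡ b∈ | T≡ c∈ = a , b , c , e

  -- Lists without repetition

  Unique-map : ∀ {a b} {A : Set a} {B : Set b} (f : A → B) {xs} →
    (∀ {x y} → x ∈ xs → y ∈ xs → f x ≡ f y → x ≡ y) → Unique xs → Unique (map f xs)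
  Unique-map f inj []       = []
  Unique-map f inj (x∉ ∷ u) = All.map⁺ (All.tabulate λ y∈ eq → All.lookup x∉ y∈ (inj (here refl) (there y∈) eq))
    ∷ Unique-map f (λ x∈ y∈ → inj (there x∈) (there y∈)) u

  unique∧same-members⇒↭ : ∀ {a} {A : Set a} {xs ys : List A} → Unique xs → Unique ys →
    (∀ {x} → x ∈ xs → x ∈ ys) → (∀ {x} → x ∈ ys → x ∈ xs) → xs ↭ ys
  unique∧same-members⇒↭ u v f g = ∼bag⇒↭ (unique∧set⇒bag u v (mk⇔ f g))

  map-≡⁻ : ∀ {a b} {A : Set a} {B : Set b} {f g : A → B} {xs} → map f xs ≡ map g xs → ∀ {x} → x ∈ xs → f x ≡ g x
  map-≡⁻ eq (here refl) = ∷-injectiveˡ eq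
  map-≡⁻ eq (there x∈)    = map-≡⁻ (∷-injectiveʳ eq) x∈

  _≟ᴾ_ : (lam μ : Partition) → Dec (lam ≡ μ)
  lam ≟ᴾ μ = map′ parts-injective (cong parts) (≡-dec _≟_ (parts lam) (parts μ))

  diag≤ℓ : ∀ lam → diag lam ≤ ℓ lam
  diag≤ℓ lam = ≤-trans (length-filter (λ i → i ≤? part lam i) (1… ℓ lam)) (≤-reflexive (length-1… (ℓ lam)))

  ⊆⇒ℓ≤ℓ : ∀ {μ lam} → μ ⊆ lam → ℓ μ ≤ ℓ lam
  ⊆⇒ℓ≤ℓ {μ} {lam} μ⊆λ = go (ℓ μ) refl
    where
    go : ∀ k → k ≡ ℓ μ → k ≤ ℓ lam
    go zero    _  = z≤n
    go (suc r) eq = nth-within (parts lam)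
      (≤-trans (nth-positive (parts-positive μ) (≤-reflexive eq)) (μ⊆λ (suc r)))

  -- The shape and the boxes produced by a run

  final-hook : ∀ {d n σs κ κ′ s ts} → Schedule d n σs κ κ′ → Run σs s ts → Hook d s → Hook d (final σs s ts)
  final-hook done [] h = h
  final-hook (upper {k = k} {r = r} r<d _ _ _ sch) (ok ∷ run) h =
    final-hook sch run (Hook-bump-upper r<d (Ok⇒Room (upper k r) (Hook.decreasing h) ok) h)
  final-hook (lower d≤r _ _ _ sch) (ok ∷ run) h = final-hook sch run (Hook-bump-lower d≤r ok h)

  -- The boxes of λ/μ in the order in which they are added, so that the product of their weights
  -- splits along the run.
  newBoxes : List Step → (ℕ → ℕ) → List ℕ → List Box
  newBoxes (σ ∷ σs) s (t ∷ ts) =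
    map (λ j → suc (row σ) , s (row σ) + j) (1… t) ++ newBoxes σs (bump s (row σ) t) ts
  newBoxes _        _ _        = []

  ∈-newBoxes⁻ : ∀ {σs s ts} → Run σs s ts → ∀ {b} → b ∈ newBoxes σs s ts →
    ∃[ r ] proj₁ b ≡ suc r × s r < proj₂ b × proj₂ b ≤ final σs s ts r
  ∈-newBoxes⁻ {σ ∷ σs} {s} (_∷_ {t = t} ok run) b∈ with ∈-++⁻ (map (λ j → suc (row σ) , s (row σ) + j) (1… t)) b∈
  ... | inj₂ b∈′ with ∈-newBoxes⁻ run b∈′
  ...   | r , eq , p , q = r , eq , ≤-<-trans (≤-bump s (row σ) t r) p , q
  ∈-newBoxes⁻ {σ ∷ σs} {s} (_∷_ {t = t} ok run) b∈ | inj₁ b∈′ with ∈-map⁻ _ b∈′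
  ...   | j , j∈ , refl with ∈-map⁻ suc j∈
  ...     | i , i∈ , refl = row σ , refl , m<m+n _ (s≤s z≤n)
            , ≤-trans (+-monoʳ-≤ (s (row σ)) (∈-upTo⁻ i∈))
                (≤-trans (≤-reflexive (sym (bump-≡ s (row σ) t))) (≤-final run (row σ)))

  ∈-newBoxes⁺ : ∀ {σs s ts} → Run σs s ts → ∀ {r c} → s r < c → c ≤ final σs s ts r → (suc r , c) ∈ newBoxes σs s ts
  ∈-newBoxes⁺ [] p q = contradiction q (<⇒≱ p)
  ∈-newBoxes⁺ {σ ∷ σs} {s} (_∷_ {t = t} ok run) {r} {c} p q with c ≤? bump s (row σ) t r
  ... | no c≰ = ∈-++⁺ʳ (map (λ j → suc (row σ) , s (row σ) + j) (1… t)) (∈-newBoxes⁺ run (≰⇒> c≰) q)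
  ... | yes c≤ with bump-row s (row σ) t p c≤
  ...   | refl = ∈-++⁺ˡ (subst (λ x → (suc r , x) ∈ map (λ j → suc r , s r + j) (1… t)) s+[c∸s]≡c
            (∈-map⁺ (λ j → suc r , s r + j) (∈-map⁺ suc (∈-upTo⁺ c∸s<t))))
    where
    s+[c∸s]≡c : s r + suc (c ∸ suc (s r)) ≡ c
    s+[c∸s]≡c = trans (+-suc (s r) _) (m+[n∸m]≡n p)
    c∸s<t : c ∸ suc (s r) < t
    c∸s<t = +-cancelˡ-≤ (s r) _ _ (≤-trans (≤-reflexive s+[c∸s]≡c) (≤-trans c≤ (≤-reflexive (bump-≡ s r t))))

  newBoxes-unique : ∀ {σs s ts} → Run σs s ts → Unique (newBoxes σs s ts)
  newBoxes-unique [] = []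
  newBoxes-unique {σ ∷ σs} {s} (_∷_ {t = t} ok run) = ++⁺
    (map⁺ (λ eq → +-cancelˡ-≡ (s (row σ)) _ _ (cong proj₂ eq)) (map⁺ suc-injective (upTo⁺ t)))
    (newBoxes-unique run)
    λ (p , q) → disjoint (∈-map⁻ _ p) (∈-newBoxes⁻ run q)
    where
    disjoint : ∀ {b} → (∃[ j ] j ∈ 1… t × b ≡ (suc (row σ) , s (row σ) + j)) →
      ¬ (∃[ r ] proj₁ b ≡ suc r × bump s (row σ) t r < proj₂ b × proj₂ b ≤ final σs (bump s (row σ) t) _ r)
    disjoint (j , j∈ , refl) (_ , refl , p , _) with ∈-map⁻ suc j∈
    ... | i , i∈ , refl = <⇒≱ p (≤-trans (+-monoʳ-≤ (s (row σ)) (∈-upTo⁻ i∈)) (≤-reflexive (sym (bump-≡ s (row σ) t))))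

open import Algebra.Bundles using (CommutativeRing)
open import Data.Empty using (⊥; ⊥-elim)
open import Data.Fin.Base as Fin using (Fin; zero; suc; toℕ; punchIn; punchOut; inject₁; fromℕ<)
open import Data.Fin.Properties as Fin using (punchInᵢ≢i; punchIn-injective; punchIn-punchOut; toℕ-inject₁; toℕ<n; toℕ-fromℕ<; toℕ-injective)
open import Data.Integer.Base as ℤ using (ℤ; -[1+_])
open import Data.List.Base using (List; []; _∷_; [_]; _++_; map; length; filter; concatMap; foldr; upTo; allFin; cartesianProduct; deduplicate)
open import Data.List.Membership.Propositional using (_∈_; _∉_; find; lose)
open import Data.List.Membership.Propositional.Properties
open import Data.List.Properties using (foldr-∷ʳ; upTo-∷ʳ; map-++; length-map; map-cong-local)
open import Data.List.Relation.Binary.Permutation.Propositional as ↭ using (_↭_)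
open import Data.List.Relation.Unary.All as All using ([])
open import Data.List.Relation.Unary.AllPairs as AllPairs using ([])
import Data.List.Relation.Unary.AllPairs.Properties as AllPairs
open import Data.List.Relation.Unary.Any using (here; there)
import Data.List.Relation.Unary.Unique.DecPropositional.Properties as UniqueDec
open import Data.List.Relation.Unary.Unique.Propositional using (Unique)
open import Data.List.Relation.Unary.Unique.Propositional.Properties using (filter⁺)
open import Data.Nat.Base as ℕ using (ℕ; zero; suc; _∸_; _⊓_; _≤_; _<_; z≤n; s≤s)
open import Data.Nat.Properties as ℕ using (_≟_; _<?_; _≤?_)
open import Data.Product using (∃-syntax; _×_; _,_; proj₁; proj₂)
open import Data.Sum using (_⊎_; inj₁; inj₂)
open import Data.Unit using (tt)
open import Data.Vec.Base as Vec using (Vec; []; _∷_; lookup; _[_]%=_)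
open import Function using (_∘_)
open import Level using (Level)
open import Relation.Binary.PropositionalEquality as ≡ using (_≡_; _≢_)
open import Relation.Nullary using (¬_; Dec; yes; no; contradiction)
open import Relation.Nullary.Decidable using (dec-true; dec-false)
open import Relation.Unary using (Decidable)
open import Defs using (module DualSchur; Partition; parts; ℓ; nth; part; 1…_; _⊆_; diag; Box; skew; m; dualHookTableaux; isTableau?; entries)
open Tableaux

-- Finite sums and determinants over a commutative ring

module Determinants {c ℓ′ : Level} (R : CommutativeRing c ℓ′) (a : ℤ → CommutativeRing.Carrier R) where

  open DualSchur R a using (module Ops)
  open CommutativeRing R hiding (zero)
  open Ops rawRing public using (sum; _^_; sumᴸ; prodᴸ; det)
  open import Algebra.Properties.Ring ring using (-1*x≈-x; -‿distribˡ-*)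
  open import Algebra.Properties.CommutativeMonoid.Sum +-commutativeMonoid
    using (sum-cong-≋; sum-remove; sum-replicate-zero; ∑-distrib-+) public
  open import Algebra.Properties.Semiring.Sum semiring using (*-distribˡ-sum) public
  open import Algebra.Solver.Ring.NaturalCoefficients.Default commutativeSemiring public
    using (solve; _:=_; _:+_; _:*_)
  open import Relation.Binary.Reasoning.Setoid setoid

  sum≈0 : ∀ {n} (f : Fin n → Carrier) → (∀ i → f i ≈ 0#) → sum f ≈ 0#
  sum≈0 {n} f f≈0 = trans (sum-cong-≋ f≈0) (sum-replicate-zero n)

  module _ {x : Level} {X : Set x} where

    sumᴸ-cong : ∀ {f g : X → Carrier} xs → (∀ {x} → x ∈ xs → f x ≈ g x) → sumᴸ f xs ≈ sumᴸ g xs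
    sumᴸ-cong []       f≈g = refl
    sumᴸ-cong (x ∷ xs) f≈g = +-cong (f≈g (here ≡.refl)) (sumᴸ-cong xs (f≈g ∘ there))

    prodᴸ-cong : ∀ {f g : X → Carrier} xs → (∀ {x} → x ∈ xs → f x ≈ g x) → prodᴸ f xs ≈ prodᴸ g xs
    prodᴸ-cong []       f≈g = refl
    prodᴸ-cong (x ∷ xs) f≈g = *-cong (f≈g (here ≡.refl)) (prodᴸ-cong xs (f≈g ∘ there))

    sumᴸ≈0 : ∀ {f : X → Carrier} xs → (∀ {x} → x ∈ xs → f x ≈ 0#) → sumᴸ f xs ≈ 0#
    sumᴸ≈0 []       f≈0 = refl
    sumᴸ≈0 (x ∷ xs) f≈0 = trans (+-cong (f≈0 (here ≡.refl)) (sumᴸ≈0 xs (f≈0 ∘ there))) (+-identityˡ 0#)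

    sumᴸ-++ : ∀ (f : X → Carrier) xs {ys} → sumᴸ f (xs ++ ys) ≈ sumᴸ f xs + sumᴸ f ys
    sumᴸ-++ f []       = sym (+-identityˡ _)
    sumᴸ-++ f (x ∷ xs) = trans (+-congˡ (sumᴸ-++ f xs)) (sym (+-assoc _ _ _))

    prodᴸ-++ : ∀ (f : X → Carrier) xs {ys} → prodᴸ f (xs ++ ys) ≈ prodᴸ f xs * prodᴸ f ys
    prodᴸ-++ f []       = sym (*-identityˡ _)
    prodᴸ-++ f (x ∷ xs) = trans (*-congˡ (prodᴸ-++ f xs)) (sym (*-assoc _ _ _))

    sumᴸ-*ˡ : ∀ u (f : X → Carrier) xs → sumᴸ (λ x → u * f x) xs ≈ u * sumᴸ f xs
    sumᴸ-*ˡ u f []       = sym (zeroʳ u)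
    sumᴸ-*ˡ u f (x ∷ xs) = trans (+-congˡ (sumᴸ-*ˡ u f xs)) (sym (distribˡ _ _ _))

    sumᴸ-*ʳ : ∀ u (f : X → Carrier) xs → sumᴸ (λ x → f x * u) xs ≈ sumᴸ f xs * u
    sumᴸ-*ʳ u f []       = sym (zeroˡ u)
    sumᴸ-*ʳ u f (x ∷ xs) = trans (+-congˡ (sumᴸ-*ʳ u f xs)) (sym (distribʳ _ _ _))

    sumᴸ-+ : ∀ (f g : X → Carrier) xs → sumᴸ (λ x → f x + g x) xs ≈ sumᴸ f xs + sumᴸ g xs
    sumᴸ-+ f g []       = sym (+-identityˡ 0#)
    sumᴸ-+ f g (x ∷ xs) = trans (+-congˡ (sumᴸ-+ f g xs))
      (solve 4 (λ a b c d → (a :+ b) :+ (c :+ d) := (a :+ c) :+ (b :+ d)) refl _ _ _ _)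

    sumᴸ-↭ : ∀ (f : X → Carrier) {xs ys} → xs ↭ ys → sumᴸ f xs ≈ sumᴸ f ys
    sumᴸ-↭ f ↭.refl          = refl
    sumᴸ-↭ f (↭.prep x p)    = +-congˡ (sumᴸ-↭ f p)
    sumᴸ-↭ f (↭.swap x y p)  = trans (+-congˡ (+-congˡ (sumᴸ-↭ f p)))
      (solve 3 (λ a b c → a :+ (b :+ c) := b :+ (a :+ c)) refl _ _ _)
    sumᴸ-↭ f (↭.trans p q)   = trans (sumᴸ-↭ f p) (sumᴸ-↭ f q)

    prodᴸ-↭ : ∀ (f : X → Carrier) {xs ys} → xs ↭ ys → prodᴸ f xs ≈ prodᴸ f ys
    prodᴸ-↭ f ↭.refl          = refl
    prodᴸ-↭ f (↭.prep x p)    = *-congˡ (prodᴸ-↭ f p)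
    prodᴸ-↭ f (↭.swap x y p)  = trans (*-congˡ (*-congˡ (prodᴸ-↭ f p)))
      (solve 3 (λ a b c → a :* (b :* c) := b :* (a :* c)) refl _ _ _)
    prodᴸ-↭ f (↭.trans p q)   = trans (prodᴸ-↭ f p) (prodᴸ-↭ f q)

  module _ {x y : Level} {X : Set x} {Y : Set y} where

    sumᴸ-map : ∀ (f : Y → Carrier) (g : X → Y) xs → sumᴸ f (map g xs) ≡ sumᴸ (f ∘ g) xs
    sumᴸ-map f g []       = ≡.refl
    sumᴸ-map f g (x ∷ xs) = ≡.cong (f (g x) +_) (sumᴸ-map f g xs)

    prodᴸ-map : ∀ (f : Y → Carrier) (g : X → Y) xs → prodᴸ f (map g xs) ≡ prodᴸ (f ∘ g) xs
    prodᴸ-map f g []       = ≡.refl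
    prodᴸ-map f g (x ∷ xs) = ≡.cong (f (g x) *_) (prodᴸ-map f g xs)

    sumᴸ-concatMap : ∀ (f : Y → Carrier) (g : X → List Y) xs →
      sumᴸ f (concatMap g xs) ≈ sumᴸ (λ x → sumᴸ f (g x)) xs
    sumᴸ-concatMap f g []       = refl
    sumᴸ-concatMap f g (x ∷ xs) = trans (sumᴸ-++ f (g x)) (+-congˡ (sumᴸ-concatMap f g xs))

    sumᴸ-comm : ∀ (f : X → Y → Carrier) xs ys →
      sumᴸ (λ x → sumᴸ (f x) ys) xs ≈ sumᴸ (λ y → sumᴸ (λ x → f x y) xs) ys
    sumᴸ-comm f []       ys = sym (sumᴸ≈0 ys (λ _ → refl))
    sumᴸ-comm f (x ∷ xs) ys = trans (+-congˡ (sumᴸ-comm f xs ys)) (sym (sumᴸ-+ _ _ ys))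

  minor : ∀ {n} → (Fin (suc n) → Fin (suc n) → Carrier) → Fin (suc n) → Fin n → Fin n → Carrier
  minor M j i k = M (suc i) (punchIn j k)

  det-cong : ∀ {n} {M N : Fin n → Fin n → Carrier} → (∀ i j → M i j ≈ N i j) → det M ≈ det N
  det-cong {zero}  M≈N = refl
  det-cong {suc n} M≈N = sum-cong-≋ λ j →
    *-congˡ {(- 1#) ^ toℕ j} (*-cong (M≈N zero j) (det-cong λ i k → M≈N (suc i) (punchIn j k)))

  -- Stated for three matrices that agree off column `c`, so that columns never have to be replaced.
  -- In the expansion along the first row, either column `c` is deleted, or it survives in the minor
  -- and induction applies.
  det-linear : ∀ {n} (c : Fin n) x y {M U V : Fin n → Fin n → Carrier} →
    (∀ i j → j ≢ c → M i j ≈ U i j) → (∀ i j → j ≢ c → M i j ≈ V i j) →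
    (∀ i → M i c ≈ x * U i c + y * V i c) →
    det M ≈ x * det U + y * det V
  det-linear {suc n} c x y {M} {U} {V} M≈U M≈V Mᶜ = begin
    det M
      ≈⟨ sum-cong-≋ term ⟩
    sum (λ j → x * T U j + y * T V j)
      ≈⟨ ∑-distrib-+ (λ j → x * T U j) (λ j → y * T V j) ⟩
    sum (λ j → x * T U j) + sum (λ j → y * T V j)
      ≈⟨ +-cong (*-distribˡ-sum x (T U)) (*-distribˡ-sum y (T V)) ⟨
    x * det U + y * det V ∎
    where
    T : (Fin (suc n) → Fin (suc n) → Carrier) → Fin (suc n) → Carrier
    T N j = ((- 1#) ^ toℕ j) * (N zero j * det (minor N j))

    term : ∀ j → T M j ≈ x * T U j + y * T V j
    term j with j Fin.≟ c
    ... | yes ≡.refl = begin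
      e * (M zero j * det (minor M j))
        ≈⟨ *-congˡ (*-cong (Mᶜ zero) (det-cong λ i k → M≈U (suc i) (punchIn j k) (punchInᵢ≢i j k))) ⟩
      e * ((x * U zero j + y * V zero j) * det (minor U j))
        ≈⟨ solve 6 (λ e x u y v d → e :* ((x :* u :+ y :* v) :* d)
                      := x :* (e :* (u :* d)) :+ y :* (e :* (v :* d)))
             refl e x (U zero j) y (V zero j) _ ⟩
      x * T U j + y * (e * (V zero j * det (minor U j)))
        -- Once column `c` is deleted, the minors of `U` and `V` coincide.
        ≈⟨ +-congˡ (*-congˡ (*-congˡ (*-congˡ (det-cong λ i k →
             let ne = punchInᵢ≢i j k in
             trans (sym (M≈U (suc i) (punchIn j k) ne)) (M≈V (suc i) (punchIn j k) ne))))) ⟩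
      x * T U j + y * T V j ∎
      where e = (- 1#) ^ toℕ j
    ... | no j≢c = begin
      e * (M zero j * det (minor M j))
        ≈⟨ *-congˡ (*-congˡ (det-linear (punchOut j≢c) x y
             (λ i k k≢ → M≈U (suc i) (punchIn j k) (off k k≢))
             (λ i k k≢ → M≈V (suc i) (punchIn j k) (off k k≢))
             (λ i → ≡.subst (λ z → M (suc i) z ≈ x * U (suc i) z + y * V (suc i) z)
                      (≡.sym (punchIn-punchOut j≢c)) (Mᶜ (suc i))))) ⟩
      e * (M zero j * (x * det (minor U j) + y * det (minor V j)))
        ≈⟨ solve 6 (λ e m x u y v → e :* (m :* (x :* u :+ y :* v))
                      := x :* (e :* (m :* u)) :+ y :* (e :* (m :* v)))
             refl e (M zero j) x _ y _ ⟩
      x * (e * (M zero j * det (minor U j))) + y * (e * (M zero j * det (minor V j)))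
        ≈⟨ +-cong (*-congˡ (*-congˡ (*-congʳ (M≈U zero j j≢c))))
                  (*-congˡ (*-congˡ (*-congʳ (M≈V zero j j≢c)))) ⟩
      x * T U j + y * T V j ∎
      where
      e = (- 1#) ^ toℕ j
      off : ∀ k → k ≢ punchOut j≢c → punchIn j k ≢ c
      off k k≢ eq = k≢ (punchIn-injective j k (punchOut j≢c)
                          (≡.trans eq (≡.sym (punchIn-punchOut j≢c))))

  punchIn-inject₁ : ∀ {n} (c : Fin n) → punchIn (inject₁ c) c ≡ suc c
  punchIn-inject₁ zero    = ≡.refl
  punchIn-inject₁ (suc c) = ≡.cong suc (punchIn-inject₁ c)

  punchIn-adjacent : ∀ {n} (c : Fin n) k → punchIn (inject₁ c) k ≡ punchIn (suc c) k ⊎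
    (punchIn (inject₁ c) k ≡ suc c × punchIn (suc c) k ≡ inject₁ c)
  punchIn-adjacent zero    zero    = inj₂ (≡.refl , ≡.refl)
  punchIn-adjacent zero    (suc k) = inj₁ ≡.refl
  punchIn-adjacent (suc c) zero    = inj₁ ≡.refl
  punchIn-adjacent (suc c) (suc k) with punchIn-adjacent c k
  ... | inj₁ p       = inj₁ (≡.cong suc p)
  ... | inj₂ (p , q) = inj₂ (≡.cong suc p , ≡.cong suc q)

  adjacent-punchIn : ∀ {n} (c : Fin (suc n)) j → j ≢ inject₁ c → j ≢ suc c →
    ∃[ c′ ] punchIn j (inject₁ c′) ≡ inject₁ c × punchIn j (suc c′) ≡ suc c
  adjacent-punchIn zero    zero          p q = ⊥-elim (p ≡.refl)
  adjacent-punchIn zero    (suc zero)    p q = ⊥-elim (q ≡.refl)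
  adjacent-punchIn {suc n} zero (suc (suc j)) p q = zero , ≡.refl , ≡.refl
  adjacent-punchIn (suc c) zero          p q = c , ≡.refl , ≡.refl
  adjacent-punchIn {suc n} (suc c) (suc j) p q
    with adjacent-punchIn c j (p ∘ ≡.cong suc) (q ∘ ≡.cong suc)
  ... | c′ , r , s = suc c′ , ≡.cong suc r , ≡.cong suc s

  -- The terms of the two equal columns have the same entry and the same minor but opposite signs.
  -- Deleting any other column leaves the two adjacent, so the remaining minors vanish by induction.
  -- Adjacency avoids general permutations of columns.
  det-adjacent : ∀ {n} (c : Fin n) {M : Fin (suc n) → Fin (suc n) → Carrier} →
    (∀ i → M i (inject₁ c) ≈ M i (suc c)) → det M ≈ 0#
  det-adjacent {suc n} c {M} eq = begin
    det M
      ≈⟨ sum-remove {i = inject₁ c} T ⟩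
    T (inject₁ c) + sum (T ∘ punchIn (inject₁ c))
      -- Once position `inject₁ c` is removed, the index `suc c` sits at position `c`.
      ≈⟨ +-congˡ (sum-remove {i = c} (T ∘ punchIn (inject₁ c))) ⟩
    T (inject₁ c) + (T (punchIn (inject₁ c) c) + sum (T ∘ punchIn (inject₁ c) ∘ punchIn c))
      ≈⟨ +-congˡ (+-cong (reflexive (≡.cong T (punchIn-inject₁ c))) (sum≈0 _ rest)) ⟩
    T (inject₁ c) + (T (suc c) + 0#)
      ≈⟨ +-congˡ (+-identityʳ _) ⟩
    T (inject₁ c) + T (suc c)
      ≈⟨ +-cong (*-cong (reflexive (≡.cong ((- 1#) ^_) (toℕ-inject₁ c))) (*-cong (eq zero) (det-cong same)))
                (trans (*-congʳ (-1*x≈-x _)) (sym (-‿distribˡ-* _ _))) ⟩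
    S + - S
      ≈⟨ -‿inverseʳ S ⟩
    0# ∎
    where
    T : Fin (suc (suc n)) → Carrier
    T j = ((- 1#) ^ toℕ j) * (M zero j * det (minor M j))
    S = ((- 1#) ^ toℕ c) * (M zero (suc c) * det (minor M (suc c)))

    same : ∀ i k → minor M (inject₁ c) i k ≈ minor M (suc c) i k
    same i k with punchIn-adjacent c k
    ... | inj₁ p       = reflexive (≡.cong (M (suc i)) p)
    ... | inj₂ (p , q) = trans (reflexive (≡.cong (M (suc i)) p))
      (trans (sym (eq (suc i))) (reflexive (≡.cong (M (suc i)) (≡.sym q))))

    rest : ∀ k → T (punchIn (inject₁ c) (punchIn c k)) ≈ 0#
    rest k with adjacent-punchIn c (punchIn (inject₁ c) (punchIn c k))
                  (punchInᵢ≢i (inject₁ c) _)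
                  (λ e → punchInᵢ≢i c k (punchIn-injective (inject₁ c) _ c
                           (≡.trans e (≡.sym (punchIn-inject₁ c)))))
    ... | c′ , p , q = trans (*-congˡ (trans (*-congˡ (det-adjacent c′ {minor M (punchIn (inject₁ c) (punchIn c k))} λ i →
            trans (reflexive (≡.cong (M (suc i)) p))
              (trans (eq (suc i)) (reflexive (≡.cong (M (suc i)) (≡.sym q))))))
          (zeroʳ _))) (zeroʳ _)

-- Power series in several variables and their determinants

module PowerSeries {c ℓ′ : Level} (R : CommutativeRing c ℓ′) (a : ℤ → CommutativeRing.Carrier R) where
  open DualSchur R a hiding (module Ops)
  open CommutativeRing R hiding (zero)
  open import Algebra.Properties.Ring ring using (-1*x≈-x)
  open Determinants R a
  open import Relation.Binary.Reasoning.Setoid setoid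

  infix 4 _≈ˢ_
  _≈ˢ_ : ∀ {n} → Series n → Series n → Set ℓ′
  f ≈ˢ g = ∀ α → f α ≈ g α

  conv-cong : ∀ {n} {f f′ g g′ : Series n} → f ≈ˢ f′ → g ≈ˢ g′ → conv f g ≈ˢ conv f′ g′
  conv-cong f≈ g≈ []      = *-cong (f≈ []) (g≈ [])
  conv-cong f≈ g≈ (k ∷ α) = sum-cong-≋ {suc k} λ l →
    conv-cong (λ β → f≈ (toℕ l ∷ β)) (λ β → g≈ (k ∸ toℕ l ∷ β)) α

  conv-• : ∀ {n} x y (f g : Series n) → conv (x • f) (y • g) ≈ˢ (x * y) • conv f g
  conv-• x y f g []      = solve 4 (λ x y f g → (x :* f) :* (y :* g) := (x :* y) :* (f :* g)) refl x y (f []) (g [])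
  conv-• x y f g (k ∷ α) = trans
    (sum-cong-≋ {suc k} λ l → conv-• x y (λ β → f (toℕ l ∷ β)) (λ β → g (k ∸ toℕ l ∷ β)) α)
    (sym (*-distribˡ-sum {suc k} (x * y) (λ l → conv (λ β → f (toℕ l ∷ β)) (λ β → g (k ∸ toℕ l ∷ β)) α)))

  conv-zeroˡ : ∀ {n} (f g : Series n) → (∀ α → f α ≈ 0#) → ∀ α → conv f g α ≈ 0#
  conv-zeroˡ f g f≈0 []      = trans (*-congʳ (f≈0 [])) (zeroˡ _)
  conv-zeroˡ f g f≈0 (k ∷ α) = sum≈0 {suc k} _ λ l →
    conv-zeroˡ (λ β → f (toℕ l ∷ β)) (λ β → g (k ∸ toℕ l ∷ β)) (λ β → f≈0 (toℕ l ∷ β)) α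

  conv-zeroʳ : ∀ {n} (f g : Series n) → (∀ α → g α ≈ 0#) → ∀ α → conv f g α ≈ 0#
  conv-zeroʳ f g g≈0 []      = trans (*-congˡ (g≈0 [])) (zeroʳ _)
  conv-zeroʳ f g g≈0 (k ∷ α) = sum≈0 {suc k} _ λ l →
    conv-zeroʳ (λ β → f (toℕ l ∷ β)) (λ β → g (k ∸ toℕ l ∷ β)) (λ β → g≈0 (k ∸ toℕ l ∷ β)) α

  sum-head : ∀ {n} (f : Fin (suc n) → Carrier) → (∀ i → f (suc i) ≈ 0#) → sum f ≈ f zero
  sum-head f f≈0 = trans (+-congˡ (sum≈0 _ f≈0)) (+-identityʳ _)

  -- Convolution with a series that does not involve the first variable has only this one nonzero
  -- term.
  sum-last : ∀ k (F : ℕ → ℕ → Carrier) → (∀ l j → F l (suc j) ≈ 0#) →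
    sum {suc k} (λ l → F (toℕ l) (k ∸ toℕ l)) ≈ F k 0
  sum-last zero    F F≈0 = +-identityʳ _
  sum-last (suc k) F F≈0 = trans (+-cong (F≈0 0 k) (sum-last k (F ∘ suc) (F≈0 ∘ suc))) (+-identityˡ _)

  conv-identityˡ : ∀ {n} (f : Series n) → conv one f ≈ˢ f
  conv-identityˡ f []      = *-identityˡ _
  conv-identityˡ f (k ∷ α) = trans
    (sum-head {k} (λ l → conv (λ β → one (toℕ l ∷ β)) (λ β → f (k ∸ toℕ l ∷ β)) α)
      (λ l → conv-zeroˡ _ (λ β → f (k ∸ suc (toℕ l) ∷ β)) (λ _ → refl) α))
    (conv-identityˡ (λ β → f (k ∷ β)) α)

  sumˢ : ∀ {n m} (f : Fin m → Series n) α → S.sum f α ≡ sum (λ j → f j α)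
  sumˢ {m = zero}  f α = ≡.refl
  sumˢ {m = suc m} f α = ≡.cong (f zero α +_) (sumˢ (f ∘ suc) α)

  signˢ : ∀ {n} k → (S.- S.1#) S.^ k ≈ˢ ((- 1#) ^ k) • one {n}
  signˢ zero    α = sym (*-identityˡ _)
  signˢ (suc k) α = begin
    conv (λ β → - one β) ((S.- S.1#) S.^ k) α
      ≈⟨ conv-cong (λ β → sym (-1*x≈-x (one β))) (signˢ k) α ⟩
    conv ((- 1#) • one) (((- 1#) ^ k) • one) α
      ≈⟨ conv-• (- 1#) ((- 1#) ^ k) one one α ⟩
    ((- 1#) * ((- 1#) ^ k)) * conv one one α
      ≈⟨ *-congˡ (conv-identityˡ one α) ⟩
    ((- 1#) ^ suc k) * one α ∎

  -- Turns the signs in `S.det` into scalars, so that cofactor expansions can be compared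
  -- coefficient by coefficient.
  conv-signˢ : ∀ {n} k (f : Series n) → conv ((S.- S.1#) S.^ k) f ≈ˢ ((- 1#) ^ k) • f
  conv-signˢ k f α = begin
    conv ((S.- S.1#) S.^ k) f α
      ≈⟨ conv-cong (signˢ k) (λ β → sym (*-identityˡ (f β))) α ⟩
    conv (((- 1#) ^ k) • one) (1# • f) α
      ≈⟨ conv-• ((- 1#) ^ k) 1# one f α ⟩
    ((- 1#) ^ k * 1#) * conv one f α
      ≈⟨ *-cong (*-identityʳ _) (conv-identityˡ f α) ⟩
    ((- 1#) ^ k) * f α ∎

  det-congˢ : ∀ {n m} {M N : Fin m → Fin m → Series n} → (∀ i j → M i j ≈ˢ N i j) → S.det M ≈ˢ S.det N
  det-congˢ {m = zero}  M≈N α = refl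
  det-congˢ {m = suc m} {M} {N} M≈N α = begin
    S.det M α
      ≡⟨ sumˢ (λ j → conv ((S.- S.1#) S.^ toℕ j) (conv (M zero j) (S.det λ i k → M (suc i) (punchIn j k)))) α ⟩
    sum (λ j → conv ((S.- S.1#) S.^ toℕ j) (conv (M zero j) (S.det λ i k → M (suc i) (punchIn j k))) α)
      ≈⟨ sum-cong-≋ (λ j → conv-cong {f = (S.- S.1#) S.^ toℕ j} (λ _ → refl)
           (conv-cong (M≈N zero j) (det-congˢ λ i k → M≈N (suc i) (punchIn j k))) α) ⟩
    sum (λ j → conv ((S.- S.1#) S.^ toℕ j) (conv (N zero j) (S.det λ i k → N (suc i) (punchIn j k))) α)
      ≡⟨ sumˢ (λ j → conv ((S.- S.1#) S.^ toℕ j) (conv (N zero j) (S.det λ i k → N (suc i) (punchIn j k)))) α ⟨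
    S.det N α ∎

  -- A series in the variables other than the first. The rows that remain in `det-at` after the
  -- first row is expanded consist of such series.
  lift : ∀ {n} → Series n → Series (suc n)
  lift f (zero  ∷ α) = f α
  lift f (suc _ ∷ α) = 0#

  conv-liftʳ : ∀ {n} (f : Series (suc n)) g k (α : Vec ℕ n) →
    conv f (lift g) (k ∷ α) ≈ conv (λ β → f (k ∷ β)) g α
  conv-liftʳ f g k α = sum-last k (λ l j → conv (λ β → f (l ∷ β)) (λ β → lift g (j ∷ β)) α)
    (λ l j → conv-zeroʳ (λ β → f (l ∷ β)) _ (λ _ → refl) α)

  conv-lift : ∀ {n} (f g : Series n) → conv (lift f) (lift g) ≈ˢ lift (conv f g)
  conv-lift f g (zero  ∷ α) = conv-liftʳ (lift f) g 0 α
  conv-lift f g (suc k ∷ α) = trans (conv-liftʳ (lift f) g (suc k) α) (conv-zeroˡ _ g (λ _ → refl) α)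

  lift-cong : ∀ {n} {f g : Series n} → f ≈ˢ g → lift f ≈ˢ lift g
  lift-cong f≈g (zero  ∷ α) = f≈g α
  lift-cong f≈g (suc _ ∷ α) = refl

  det-lift : ∀ {n m} (M : Fin m → Fin m → Series n) →
    S.det (λ i j → lift (M i j)) ≈ˢ lift (S.det M)
  det-lift {m = zero}  M (zero  ∷ α) = refl
  det-lift {m = zero}  M (suc _ ∷ α) = refl
  det-lift {m = suc m} M (k ∷ α) = begin
    S.det (λ i j → lift (M i j)) (k ∷ α)
      ≡⟨ sumˢ (λ j → conv (e j) (conv (lift (M zero j)) (S.det λ i l → lift (M (suc i) (punchIn j l))))) (k ∷ α) ⟩
    sum (λ j → conv (e j) (conv (lift (M zero j)) (S.det λ i l → lift (M (suc i) (punchIn j l)))) (k ∷ α))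
      ≈⟨ sum-cong-≋ (term k) ⟩
    sum (λ j → lift (conv (e j) (conv (M zero j) (S.det λ i l → M (suc i) (punchIn j l)))) (k ∷ α))
      ≈⟨ out k ⟩
    lift (S.det M) (k ∷ α) ∎
    where
    e : ∀ {n} → Fin (suc m) → Series n
    e j = (S.- S.1#) S.^ toℕ j
    T : Fin (suc m) → Series _
    T j = conv (M zero j) (S.det λ i l → M (suc i) (punchIn j l))
    scale-lift : ∀ x f k → x * lift f (k ∷ α) ≈ lift (x • f) (k ∷ α)
    scale-lift x f zero    = refl
    scale-lift x f (suc _) = zeroʳ x
    term : ∀ k j → conv (e j) (conv (lift (M zero j)) (S.det λ i l → lift (M (suc i) (punchIn j l)))) (k ∷ α)
         ≈ lift (conv (e j) (T j)) (k ∷ α)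
    term k j = begin
      conv (e j) (conv (lift (M zero j)) (S.det λ i l → lift (M (suc i) (punchIn j l)))) (k ∷ α)
        ≈⟨ conv-signˢ (toℕ j) (conv (lift (M zero j)) (S.det λ i l → lift (M (suc i) (punchIn j l)))) (k ∷ α) ⟩
      ((- 1#) ^ toℕ j) * conv (lift (M zero j)) (S.det λ i l → lift (M (suc i) (punchIn j l))) (k ∷ α)
        ≈⟨ *-congˡ (conv-cong {f = lift (M zero j)} (λ _ → refl)
             (det-lift (λ i l → M (suc i) (punchIn j l))) (k ∷ α)) ⟩
      ((- 1#) ^ toℕ j) * conv (lift (M zero j)) (lift (S.det λ i l → M (suc i) (punchIn j l))) (k ∷ α)
        ≈⟨ *-congˡ (conv-lift (M zero j) _ (k ∷ α)) ⟩
      ((- 1#) ^ toℕ j) * lift (T j) (k ∷ α)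
        ≈⟨ scale-lift _ (T j) k ⟩
      lift (((- 1#) ^ toℕ j) • T j) (k ∷ α)
        ≈⟨ lift-cong (λ β → sym (conv-signˢ (toℕ j) (T j) β)) (k ∷ α) ⟩
      lift (conv (e j) (T j)) (k ∷ α) ∎
    out : ∀ k → sum (λ j → lift (conv (e j) (T j)) (k ∷ α)) ≈ lift (S.det M) (k ∷ α)
    out zero    = reflexive (≡.sym (sumˢ (λ j → conv (e j) (T j)) α))
    out (suc k) = sum≈0 {suc m} _ (λ _ → refl)

  at-cong : ∀ {n} (i : Fin n) {f g : ℕ → Carrier} → (∀ k → f k ≈ g k) → at i f ≈ˢ at i g
  at-cong zero    f≈g (k     ∷ α) = *-congʳ (f≈g k)
  at-cong (suc i) f≈g (zero  ∷ α) = at-cong i f≈g α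
  at-cong (suc i) f≈g (suc _ ∷ α) = refl

  at-suc : ∀ {n} (i : Fin n) f → at (suc i) f ≈ˢ lift (at i f)
  at-suc i f (zero  ∷ α) = refl
  at-suc i f (suc _ ∷ α) = refl

  -- The i-th row involves xᵢ only, so the coefficient of x^α is itself a
  -- determinant over the ground ring.
  det-at : ∀ {n} (f : Fin n → ℕ → Carrier) (α : Vec ℕ n) →
    S.det (λ i j → at i (f j)) α ≈ det (λ i j → f j (lookup α i))
  det-at f []      = refl
  det-at {suc n} f (k ∷ α) = begin
    S.det (λ i j → at i (f j)) (k ∷ α)
      ≡⟨ sumˢ (λ j → conv (e j) (conv (at zero (f j)) (S.det λ i l → at (suc i) (f (punchIn j l))))) (k ∷ α) ⟩
    sum (λ j → conv (e j) (conv (at zero (f j)) (S.det λ i l → at (suc i) (f (punchIn j l)))) (k ∷ α))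
      ≈⟨ sum-cong-≋ term ⟩
    det (λ i j → f j (lookup (k ∷ α) i)) ∎
    where
    e : Fin (suc n) → Series (suc n)
    e j = (S.- S.1#) S.^ toℕ j
    term : ∀ j → conv (e j) (conv (at zero (f j)) (S.det λ i l → at (suc i) (f (punchIn j l)))) (k ∷ α)
         ≈ ((- 1#) ^ toℕ j) * (f j k * det (λ i l → f (punchIn j l) (lookup α i)))
    term j = begin
      conv (e j) (conv (at zero (f j)) (S.det λ i l → at (suc i) (f (punchIn j l)))) (k ∷ α)
        ≈⟨ conv-signˢ (toℕ j) (conv (at zero (f j)) (S.det λ i l → at (suc i) (f (punchIn j l)))) (k ∷ α) ⟩
      ((- 1#) ^ toℕ j) * conv (at zero (f j)) (S.det λ i l → at (suc i) (f (punchIn j l))) (k ∷ α)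
        ≈⟨ *-congˡ (conv-cong {f = at zero (f j)} (λ _ → refl)
             (λ β → trans (det-congˢ (λ i l → at-suc i (f (punchIn j l))) β)
                          (det-lift (λ i l → at i (f (punchIn j l))) β)) (k ∷ α)) ⟩
      ((- 1#) ^ toℕ j) * conv (at zero (f j)) (lift D) (k ∷ α)
        ≈⟨ *-congˡ (conv-liftʳ (at zero (f j)) D k α) ⟩
      ((- 1#) ^ toℕ j) * conv (f j k • one) D α
        ≈⟨ *-congˡ (conv-cong {f = f j k • one} (λ _ → refl) (λ β → sym (*-identityˡ (D β))) α) ⟩
      ((- 1#) ^ toℕ j) * conv (f j k • one) (1# • D) α
        ≈⟨ *-congˡ (conv-• (f j k) 1# one D α) ⟩
      ((- 1#) ^ toℕ j) * ((f j k * 1#) * conv one D α)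
        ≈⟨ *-congˡ (*-cong (*-identityʳ _) (trans (conv-identityˡ D α) (det-at (λ l → f (punchIn j l)) α))) ⟩
      ((- 1#) ^ toℕ j) * (f j k * det (λ i l → f (punchIn j l) (lookup α i))) ∎
      where
      D : Series n
      D = S.det λ i l → at i (f (punchIn j l))

  -- Hence linear identities between determinants carry over to their ratios.
  ÷Δ-sum : ∀ {n} (α : Vec ℕ n) → ∃[ L ] ∀ (f : Series n) → (f ÷Δ) α ≈ sumᴸ f L
  ÷Δ-sum {n} α = go (filter _ (cartesianProduct (allFin n) (allFin n))) α
    where
    ÷-sum : ∀ p (α : Vec ℕ n) → ∃[ L ] ∀ (f : Series n) → (f ÷ p) α ≈ sumᴸ f L
    ÷-sum (i , j) α = tabulate-sum (suc (lookup α j))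
      λ k → (α [ i ]%= (suc (toℕ k) ℕ.+_)) [ j ]%= (_∸ toℕ k)
      where
      tabulate-sum : ∀ m (h : Fin m → Vec ℕ n) → ∃[ L ] ∀ (f : Series n) → sum (f ∘ h) ≈ sumᴸ f L
      tabulate-sum zero    h = [] , λ f → refl
      tabulate-sum (suc m) h with tabulate-sum m (h ∘ suc)
      ... | L , eq = h zero ∷ L , λ f → +-congˡ (eq f)
    go : ∀ ps (α : Vec ℕ n) → ∃[ L ] ∀ (f : Series n) → foldr (λ p g → g ÷ p) f ps α ≈ sumᴸ f L
    go []       α = [ α ] , λ f → sym (+-identityʳ _)
    go (p ∷ ps) α with ÷-sum p α
    ... | L , eq = concatMap (λ β → proj₁ (go ps β)) L , λ f → begin
      (foldr (λ p g → g ÷ p) f ps ÷ p) α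
        ≈⟨ eq _ ⟩
      sumᴸ (foldr (λ p g → g ÷ p) f ps) L
        ≈⟨ sumᴸ-cong L (λ {β} _ → proj₂ (go ps β) f) ⟩
      sumᴸ (λ β → sumᴸ f (proj₁ (go ps β))) L
        ≈⟨ sumᴸ-concatMap f (λ β → proj₁ (go ps β)) L ⟨
      sumᴸ f (concatMap (λ β → proj₁ (go ps β)) L) ∎

-- Columns as power series in one variable

module Columns {c ℓ′ : Level} (R : CommutativeRing c ℓ′) (a : ℤ → CommutativeRing.Carrier R) where
  open DualSchur R a hiding (module Ops)
  open CommutativeRing R hiding (zero)
  open import Algebra.Properties.Ring ring using (-‿distribˡ-*)
  open import Algebra.Properties.Semiring.Sum semiring using (*-distribʳ-sum)
  open Determinants R a
  open PowerSeries R a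
  open import Relation.Binary.Reasoning.Setoid setoid

  U : Set c
  U = ℕ → Carrier

  infix 4 _≈ᵁ_
  _≈ᵁ_ : U → U → Set ℓ′
  f ≈ᵁ g = ∀ k → f k ≈ g k

  infixl 7 _⋆_
  _⋆_ : U → U → U
  (f ⋆ g) k = sum {suc k} λ l → f (toℕ l) * g (k ∸ toℕ l)

  at-⋆ : ∀ {n} (i : Fin n) f g → conv (at i f) (at i g) ≈ˢ at i (f ⋆ g)
  at-⋆ zero f g (k ∷ α) = begin
    sum {suc k} (λ l → conv (f (toℕ l) • one) (g (k ∸ toℕ l) • one) α)
      ≈⟨ sum-cong-≋ {suc k} (λ l → trans (conv-• (f (toℕ l)) (g (k ∸ toℕ l)) one one α)
           (*-congˡ (conv-identityˡ one α))) ⟩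
    sum {suc k} (λ l → (f (toℕ l) * g (k ∸ toℕ l)) * one α)
      ≈⟨ *-distribʳ-sum {suc k} (one α) (λ l → f (toℕ l) * g (k ∸ toℕ l)) ⟨
    (f ⋆ g) k * one α ∎
  at-⋆ (suc i) f g α = begin
    conv (at (suc i) f) (at (suc i) g) α
      ≈⟨ conv-cong (at-suc i f) (at-suc i g) α ⟩
    conv (lift (at i f)) (lift (at i g)) α
      ≈⟨ conv-lift (at i f) (at i g) α ⟩
    lift (conv (at i f) (at i g)) α
      ≈⟨ lift-cong (at-⋆ i f g) α ⟩
    lift (at i (f ⋆ g)) α
      ≈⟨ at-suc i (f ⋆ g) α ⟨
    at (suc i) (f ⋆ g) α ∎

  δ : U
  δ zero    = 1#
  δ (suc _) = 0#

  shift : U → U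
  shift f zero    = 0#
  shift f (suc k) = f k

  -- multiply u f = (1 - u t) f and divide u f = f / (1 - u t)
  multiply divide : Carrier → U → U
  multiply u f k = f k + (- u) * shift f k
  divide u f zero    = f 0
  divide u f (suc k) = f (suc k) + u * divide u f k

  shift^ : ℕ → U → U
  shift^ zero    f = f
  shift^ (suc e) f = shift (shift^ e f)

  shift-cong : ∀ {f g} → f ≈ᵁ g → shift f ≈ᵁ shift g
  shift-cong f≈g zero    = refl
  shift-cong f≈g (suc k) = f≈g k

  δ-⋆ : ∀ f → δ ⋆ f ≈ᵁ f
  δ-⋆ f k = trans (sum-head {k} (λ l → δ (toℕ l) * f (k ∸ toℕ l)) (λ _ → zeroˡ _)) (*-identityˡ _)

  shift-⋆ : ∀ f g → shift f ⋆ g ≈ᵁ shift (f ⋆ g)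
  shift-⋆ f g zero    = trans (+-identityʳ _) (zeroˡ _)
  shift-⋆ f g (suc k) = trans (+-congʳ (zeroˡ _)) (+-identityˡ _)

  shift^-⋆ : ∀ e f → shift^ e δ ⋆ f ≈ᵁ shift^ e f
  shift^-⋆ zero    f = δ-⋆ f
  shift^-⋆ (suc e) f k = trans (shift-⋆ (shift^ e δ) f k) (shift-cong (shift^-⋆ e f) k)

  multiply-⋆ : ∀ u f → multiply u δ ⋆ f ≈ᵁ multiply u f
  multiply-⋆ u f k = trans (+-cong (*-congʳ (trans (+-congˡ (zeroʳ _)) (+-identityʳ 1#))) (tail k))
    (+-congʳ (*-identityˡ _))
    where
    tail : ∀ k → sum {k} (λ l → multiply u δ (suc (toℕ l)) * f (k ∸ suc (toℕ l))) ≈ (- u) * shift f k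
    tail zero    = sym (zeroʳ _)
    tail (suc k) = trans
      (sum-head {k} (λ l → multiply u δ (suc (toℕ l)) * f (k ∸ toℕ l))
        (λ _ → trans (*-congʳ (trans (+-identityˡ _) (zeroʳ _))) (zeroˡ _)))
      (*-congʳ (trans (+-identityˡ _) (*-identityʳ _)))

  divide-⋆ : ∀ u f → (u ^_) ⋆ f ≈ᵁ divide u f
  divide-⋆ u f zero    = trans (+-identityʳ _) (*-identityˡ _)
  divide-⋆ u f (suc k) = +-cong (*-identityˡ _) (begin
    sum {suc k} (λ l → (u * u ^ toℕ l) * f (k ∸ toℕ l))
      ≈⟨ sum-cong-≋ {suc k} (λ l → *-assoc u (u ^ toℕ l) (f (k ∸ toℕ l))) ⟩
    sum {suc k} (λ l → u * (u ^ toℕ l * f (k ∸ toℕ l)))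
      ≈⟨ *-distribˡ-sum {suc k} u (λ l → u ^ toℕ l * f (k ∸ toℕ l)) ⟨
    u * ((u ^_) ⋆ f) k
      ≈⟨ *-congˡ (divide-⋆ u f k) ⟩
    u * divide u f k ∎)

  at-δ : ∀ {n} (i : Fin n) → one ≈ˢ at i δ
  at-δ zero    (zero  ∷ α) = sym (*-identityˡ _)
  at-δ zero    (suc _ ∷ α) = sym (zeroˡ _)
  at-δ (suc i) (zero  ∷ α) = at-δ i α
  at-δ (suc i) (suc _ ∷ α) = refl

  X-at : ∀ {n} (i : Fin n) → X i ≈ˢ at i (shift δ)
  X-at i = at-cong i λ { 0 → refl ; 1 → refl ; (suc (suc _)) → refl }

  X^-at : ∀ {n} (i : Fin n) e → X i S.^ e ≈ˢ at i (shift^ e δ)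
  X^-at i zero    = at-δ i
  X^-at i (suc e) α = begin
    conv (X i) (X i S.^ e) α                  ≈⟨ conv-cong (X-at i) (X^-at i e) α ⟩
    conv (at i (shift δ)) (at i (shift^ e δ)) α ≈⟨ at-⋆ i (shift δ) (shift^ e δ) α ⟩
    at i (shift δ ⋆ shift^ e δ) α             ≈⟨ at-cong i (λ k → trans (shift-⋆ δ _ k) (shift-cong (δ-⋆ _) k)) α ⟩
    at i (shift^ (suc e) δ) α                 ∎

  at-+ : ∀ {n} (i : Fin n) f g u α → at i f α + u * at i g α ≈ at i (λ k → f k + u * g k) α
  at-+ zero    f g u (k ∷ α) = solve 4 (λ f g u o → f :* o :+ u :* (g :* o) := (f :+ u :* g) :* o) refl (f k) (g k) u (one α)
  at-+ (suc i) f g u (zero ∷ α)  = at-+ i f g u α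
  at-+ (suc i) f g u (suc _ ∷ α) = trans (+-identityˡ _) (zeroʳ u)

  linear-at : ∀ {n} u (i : Fin n) → linear u i ≈ˢ at i (multiply u δ)
  linear-at u i α = begin
    one α + - (u * X i α)               ≈⟨ +-cong (at-δ i α) (trans (-‿distribˡ-* u _) (*-congˡ (X-at i α))) ⟩
    at i δ α + (- u) * at i (shift δ) α ≈⟨ at-+ i δ (shift δ) (- u) α ⟩
    at i (multiply u δ) α               ∎

  divide-cong : ∀ u {f g} → f ≈ᵁ g → divide u f ≈ᵁ divide u g
  divide-cong u f≈g zero    = f≈g 0
  divide-cong u f≈g (suc k) = +-cong (f≈g (suc k)) (*-congˡ (divide-cong u f≈g k))

  multiply-cong : ∀ u {f g} → f ≈ᵁ g → multiply u f ≈ᵁ multiply u g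
  multiply-cong u f≈g k = +-cong (f≈g k) (*-congˡ (shift-cong f≈g k))

  module _ {x : Level} {X : Set x} where

    geometrics-at : ∀ {n} (i : Fin n) (u : X → Carrier) ks →
      S.prodᴸ (λ k → geometric (u k) i) ks ≈ˢ at i (foldr (divide ∘ u) δ ks)
    geometrics-at i u []       = at-δ i
    geometrics-at i u (k ∷ ks) α = begin
      conv (geometric (u k) i) (S.prodᴸ (λ k → geometric (u k) i) ks) α
        ≈⟨ conv-cong {f = geometric (u k) i} (λ _ → refl) (geometrics-at i u ks) α ⟩
      conv (at i (u k ^_)) (at i (foldr (divide ∘ u) δ ks)) α
        ≈⟨ at-⋆ i (u k ^_) _ α ⟩
      at i ((u k ^_) ⋆ foldr (divide ∘ u) δ ks) α
        ≈⟨ at-cong i (divide-⋆ (u k) _) α ⟩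
      at i (foldr (divide ∘ u) δ (k ∷ ks)) α ∎

    linears-at : ∀ {n} (i : Fin n) (u : X → Carrier) ks →
      S.prodᴸ (λ k → linear (u k) i) ks ≈ˢ at i (foldr (multiply ∘ u) δ ks)
    linears-at i u []       = at-δ i
    linears-at i u (k ∷ ks) α = begin
      conv (linear (u k) i) (S.prodᴸ (λ k → linear (u k) i) ks) α
        ≈⟨ conv-cong (linear-at (u k) i) (linears-at i u ks) α ⟩
      conv (at i (multiply (u k) δ)) (at i (foldr (multiply ∘ u) δ ks)) α
        ≈⟨ at-⋆ i (multiply (u k) δ) _ α ⟩
      at i (multiply (u k) δ ⋆ foldr (multiply ∘ u) δ ks) α
        ≈⟨ at-cong i (multiply-⋆ (u k) _) α ⟩
      at i (foldr (multiply ∘ u) δ (k ∷ ks)) α ∎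

  X^-times : ∀ {n} (i : Fin n) e {F : Series n} {f} → F ≈ˢ at i f → conv (X i S.^ e) F ≈ˢ at i (shift^ e f)
  X^-times i e {F} {f} F≈ α = begin
    conv (X i S.^ e) F α               ≈⟨ conv-cong (X^-at i e) F≈ α ⟩
    conv (at i (shift^ e δ)) (at i f) α ≈⟨ at-⋆ i (shift^ e δ) f α ⟩
    at i (shift^ e δ ⋆ f) α            ≈⟨ at-cong i (shift^-⋆ e f) α ⟩
    at i (shift^ e f) α                ∎

  -- Linearity over the polynomials in t, in the one form that is needed.
  record Linear (Φ : U → U) : Set (c Level.⊔ ℓ′) where
    field
      cong   : ∀ {f g} → f ≈ᵁ g → Φ f ≈ᵁ Φ g
      axpy   : ∀ f u g → Φ (λ k → f k + u * shift g k) ≈ᵁ (λ k → Φ f k + u * shift (Φ g) k)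
  open Linear

  shift-linear : Linear shift
  shift-linear .cong = shift-cong
  shift-linear .axpy f u g zero    = sym (trans (+-identityˡ _) (zeroʳ u))
  shift-linear .axpy f u g (suc k) = +-congˡ (*-congˡ (refl))

  multiply-linear : ∀ v → Linear (multiply v)
  multiply-linear v .cong = multiply-cong v
  multiply-linear v .axpy f u g k = begin
    (f k + u * shift g k) + (- v) * shift (λ k → f k + u * shift g k) k
      ≈⟨ +-congˡ (*-congˡ (shift-linear .axpy f u g k)) ⟩
    (f k + u * shift g k) + (- v) * (shift f k + u * shift (shift g) k)
      ≈⟨ solve 6 (λ f u g v f′ g″ → (f :+ u :* g) :+ v :* (f′ :+ u :* g″)
                      := (f :+ v :* f′) :+ u :* (g :+ v :* g″)) refl
           (f k) u (shift g k) (- v) (shift f k) (shift (shift g) k) ⟩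
    multiply v f k + u * (shift g k + (- v) * shift (shift g) k)
      ≈⟨ +-congˡ (*-congˡ (shift-linear .axpy g (- v) g k)) ⟨
    multiply v f k + u * shift (multiply v g) k ∎

  -- The equation (1 - v t) · `divide v f` = f, in a form that does not single out the constant
  -- coefficient.
  divide-unfold : ∀ v f k → divide v f k ≈ f k + v * shift (divide v f) k
  divide-unfold v f zero    = sym (trans (+-congˡ (zeroʳ v)) (+-identityʳ _))
  divide-unfold v f (suc k) = refl

  divide-linear : ∀ v → Linear (divide v)
  divide-linear v .cong = divide-cong v
  divide-linear v .axpy f u g zero    = refl
  divide-linear v .axpy f u g (suc k) = begin
    (f (suc k) + u * g k) + v * divide v (λ k → f k + u * shift g k) k
      ≈⟨ +-congˡ (*-congˡ (divide-linear v .axpy f u g k)) ⟩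
    (f (suc k) + u * g k) + v * (divide v f k + u * shift (divide v g) k)
      ≈⟨ solve 6 (λ f u g v f′ g″ → (f :+ u :* g) :+ v :* (f′ :+ u :* g″)
                      := (f :+ v :* f′) :+ u :* (g :+ v :* g″)) refl
           (f (suc k)) u (g k) v (divide v f k) (shift (divide v g) k) ⟩
    divide v f (suc k) + u * (g k + v * shift (divide v g) k)
      ≈⟨ +-congˡ (*-congˡ (divide-unfold v g k)) ⟨
    divide v f (suc k) + u * divide v g k ∎

  foldr-linear : ∀ {x} {X : Set x} {Φ : X → U → U} → (∀ x → Linear (Φ x)) → ∀ xs →
    Linear (λ f → foldr Φ f xs)
  foldr-linear lin []       .cong f≈g = f≈g
  foldr-linear lin []       .axpy f u g k = refl
  foldr-linear lin (x ∷ xs) .cong f≈g = lin x .cong (foldr-linear lin xs .cong f≈g)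
  foldr-linear lin (x ∷ xs) .axpy f u g k = trans
    (lin x .cong (foldr-linear lin xs .axpy f u g) k) (lin x .axpy _ u _ k)

  shift^-linear : ∀ e → Linear (shift^ e)
  shift^-linear zero    .cong f≈g = f≈g
  shift^-linear zero    .axpy f u g k = refl
  shift^-linear (suc e) .cong f≈g = shift-cong (shift^-linear e .cong f≈g)
  shift^-linear (suc e) .axpy f u g k = trans
    (shift-cong (shift^-linear e .axpy f u g) k) (shift-linear .axpy _ u _ k)

  shift^≈0 : ∀ e f {k} → k < e → shift^ e f k ≈ 0#
  shift^≈0 (suc e) f {zero}  _         = refl
  shift^≈0 (suc e) f {suc k} (s≤s k<e) = shift^≈0 e f k<e

  -- Absorbs the sign of a term: in a tableau the entries that are at most 0 are exactly those in
  -- the first `d` rows, whose boxes `m` counts.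
  weight : ℤ → Carrier
  weight (ℤ.+ zero)  = - a (ℤ.+ zero)
  weight (ℤ.+ suc k) = a (ℤ.+ suc k)
  weight -[1+ k ]  = - a -[1+ k ]

  upperFactors lowerFactors : ℕ → U
  upperFactors K = foldr (λ k → divide (a (ℤ.- (ℤ.+ k)))) δ (upTo K)
  lowerFactors K = foldr (λ k → multiply (a (ℤ.+ k))) δ (1… K)

  -- The last factor is innermost in the fold. There `δ` is written as (1 - v t) times `divide v δ`,
  -- and the outer factors preserve this identity by linearity.
  upperFactors-suc : ∀ K → upperFactors K ≈ᵁ
    λ k → upperFactors (suc K) k + (- a (ℤ.- (ℤ.+ K))) * shift (upperFactors (suc K)) k
  upperFactors-suc K = ≡.subst (λ G → upperFactors K ≈ᵁ λ k → G k + (- v) * shift G k)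
    (≡.sym (≡.trans (≡.cong (foldr _ δ) (≡.sym (upTo-∷ʳ K))) (foldr-∷ʳ _ δ K (upTo K)))) λ k → begin
    upperFactors K k
      ≈⟨ L .cong (λ k → trans (sym (+-identityʳ _)) (trans (+-congˡ (sym (trans (*-congʳ (-‿inverseʳ v)) (zeroˡ _))))
           (trans (solve 4 (λ d v v′ e → d :+ (v :+ v′) :* e := (d :+ v :* e) :+ v′ :* e) refl (δ k) v (- v) _)
             (+-congʳ (sym (divide-unfold v δ k)))))) k ⟩
    foldr Φ (λ k → divide v δ k + (- v) * shift (divide v δ) k) (upTo K) k
      ≈⟨ L .axpy (divide v δ) (- v) (divide v δ) k ⟩
    foldr Φ (divide v δ) (upTo K) k + (- v) * shift (foldr Φ (divide v δ) (upTo K)) k ∎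
    where
    v = a (ℤ.- (ℤ.+ K))
    Φ : ℕ → U → U
    Φ k = divide (a (ℤ.- (ℤ.+ k)))
    L = foldr-linear (λ k → divide-linear (a (ℤ.- (ℤ.+ k)))) (upTo K)

  -- From 1 = (1 - v t) + v t. The shifted series keeps `K` factors, so the identity can be applied
  -- to it again.
  lowerFactors-suc : ∀ K → lowerFactors K ≈ᵁ
    λ k → lowerFactors (suc K) k + a (ℤ.+ suc K) * shift (lowerFactors K) k
  lowerFactors-suc K = ≡.subst (λ G → lowerFactors K ≈ᵁ λ k → G k + v * shift (lowerFactors K) k)
    (≡.sym (≡.trans (≡.cong (foldr _ δ) (≡.trans (≡.cong (map suc) (≡.sym (upTo-∷ʳ K))) (map-++ suc (upTo K) (K ∷ []))))
      (foldr-∷ʳ _ δ (suc K) (1… K)))) λ k → begin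
    F k
      ≈⟨ +-identityʳ _ ⟨
    F k + 0#
      ≈⟨ +-congˡ (trans (*-congʳ (-‿inverseˡ v)) (zeroˡ _)) ⟨
    F k + (- v + v) * shift F k
      ≈⟨ solve 4 (λ d v v′ e → d :+ (v′ :+ v) :* e := (d :+ v′ :* e) :+ v :* e) refl (F k) v (- v) (shift F k) ⟩
    (F k + (- v) * shift F k) + v * shift F k
      ≈⟨ +-congʳ (L .axpy δ (- v) δ k) ⟨
    foldr (λ k → multiply (a (ℤ.+ k))) (multiply v δ) (1… K) k + v * shift F k ∎
    where
    v = a (ℤ.+ suc K)
    F = lowerFactors K
    L = foldr-linear (λ k → multiply-linear (a (ℤ.+ k))) (1… K)

-- Expanding a determinant of scalars step by step

module Expansion {c ℓ′ : Level} (R : CommutativeRing c ℓ′) (a : ℤ → CommutativeRing.Carrier R)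
  (d : ℕ) {n : ℕ} (β : Vec ℕ n) where
  open DualSchur R a hiding (module Ops)
  open CommutativeRing R hiding (zero)
  open Determinants R a
  open PowerSeries R a
  open Columns R a
  open Linear
  open import Relation.Binary.Reasoning.Setoid setoid

  alternant : (ℕ → U) → Carrier
  alternant φ = det {n} λ i j → φ (toℕ j) (lookup β i)

  alternant-cong : ∀ {φ φ′} → (∀ r → r < n → φ r ≈ᵁ φ′ r) → alternant φ ≈ alternant φ′
  alternant-cong φ≈ = det-cong λ i j → φ≈ (toℕ j) (toℕ<n j) (lookup β i)

  alternant-linear : ∀ {r} → r < n → ∀ x y {φ φ₁ φ₂} →
    (∀ r′ → r′ ≢ r → φ r′ ≈ᵁ φ₁ r′) → (∀ r′ → r′ ≢ r → φ r′ ≈ᵁ φ₂ r′) →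
    (φ r ≈ᵁ λ k → x * φ₁ r k + y * φ₂ r k) →
    alternant φ ≈ x * alternant φ₁ + y * alternant φ₂
  alternant-linear {r} r<n x y {φ} {φ₁} {φ₂} φ₁≈ φ₂≈ φ≈ = det-linear (fromℕ< r<n) x y
    (λ i j j≢ → φ₁≈ (toℕ j) (off j j≢) (lookup β i))
    (λ i j j≢ → φ₂≈ (toℕ j) (off j j≢) (lookup β i))
    (λ i → ≡.subst (λ r → φ r (lookup β i) ≈ x * φ₁ r (lookup β i) + y * φ₂ r (lookup β i))
      (≡.sym (toℕ-fromℕ< r<n)) (φ≈ (lookup β i)))
    where
    off : ∀ j → j ≢ fromℕ< r<n → toℕ j ≢ r
    off j j≢ eq = j≢ (toℕ-injective (≡.trans eq (≡.sym (toℕ-fromℕ< r<n))))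

  alternant-adjacent : ∀ {r} → suc r < n → ∀ φ → φ r ≈ᵁ φ (suc r) → alternant φ ≈ 0#
  alternant-adjacent {r} r<n φ φ≈ = go r<n β
    where
    go : ∀ {n} → suc r < n → (β : Vec ℕ n) → det {n} (λ i j → φ (toℕ j) (lookup β i)) ≈ 0#
    go {suc n} (s≤s r<n) β = det-adjacent (fromℕ< r<n) {λ i j → φ (toℕ j) (lookup β i)} λ i → begin
      φ (toℕ (inject₁ (fromℕ< r<n))) (lookup β i)
        ≡⟨ ≡.cong (λ r → φ r (lookup β i)) (≡.trans (toℕ-inject₁ _) (toℕ-fromℕ< r<n)) ⟩
      φ r (lookup β i)
        ≈⟨ φ≈ (lookup β i) ⟩
      φ (suc r) (lookup β i)
        ≡⟨ ≡.cong (λ r → φ (suc r) (lookup β i)) (toℕ-fromℕ< r<n) ⟨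
      φ (suc (toℕ (fromℕ< r<n))) (lookup β i) ∎

  -- The column of the determinant for a row r of length s in which κ values
  -- have been processed.
  col : (κ s r : ℕ) → U
  col κ s r with r <? d
  ... | yes _ = shift^ (s ℕ.+ n ∸ suc r) (upperFactors (κ ⊓ (s ∸ r)))
  ... | no  _ = shift^ (s ℕ.+ n ∸ suc r) (lowerFactors (κ ⊓ (r ∸ s)))

  cols : (κ s : ℕ → ℕ) → ℕ → U
  cols κ s r = col (κ r) (s r) r

  Δ : (κ s : ℕ → ℕ) → Carrier
  Δ κ s = alternant (cols κ s)

  Δ-cong : ∀ {κ κ′ s s′} → (∀ r → κ r ≡ κ′ r) → (∀ r → s r ≡ s′ r) → Δ κ s ≈ Δ κ′ s′
  Δ-cong κ≡ s≡ = alternant-cong λ r _ k → reflexive (≡.cong₂ (λ κ s → col κ s r k) (κ≡ r) (s≡ r))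

  gap : ∀ k r s → k ℕ.+ r < s → k < s ∸ r
  gap k r s = ℕ.m+n≤o⇒m≤o∸n (suc k)

  -- By `k + r < s` the cap `s ∸ r` on the number of factors allows `k + 1` factors, both for `s`
  -- and for `s + 1`.
  col-upper-suc : ∀ {k s r} → r < d → r < n → k ℕ.+ r < s →
    col k s r ≈ᵁ λ j → col (suc k) s r j + (- a (ℤ.- (ℤ.+ k))) * col (suc k) (suc s) r j
  col-upper-suc {k} {s} {r} r<d r<n k+r<s j with r <? d
  ... | no r≮d = contradiction r<d r≮d
  ... | yes _ rewrite ℕ.m≤n⇒m⊓n≡m (ℕ.<⇒≤ (gap k r s k+r<s)) | ℕ.m≤n⇒m⊓n≡m (gap k r s k+r<s)
      | ℕ.m≤n⇒m⊓n≡m (ℕ.≤-trans (gap k r s k+r<s) (ℕ.∸-monoˡ-≤ r (ℕ.n≤1+n s)))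
      | ℕ.+-∸-assoc 1 (ℕ.≤-trans r<n (ℕ.m≤n+m n s)) = trans
        (shift^-linear e .cong (upperFactors-suc k) j)
        (shift^-linear e .axpy _ _ (upperFactors (suc k)) j)
    where
    e = s ℕ.+ n ∸ suc r

  -- An added box lowers the cap `r ∸ s` by one. By `k + s < r` it allows `k + 1` factors before and
  -- still `k` factors after.
  col-lower-suc : ∀ {k s r} → d ≤ r → r < n → k ℕ.+ s < r →
    col k s r ≈ᵁ λ j → col (suc k) s r j + a (ℤ.+ suc k) * col k (suc s) r j
  col-lower-suc {k} {s} {r} d≤r r<n k+s<r j with r <? d
  ... | yes r<d = contradiction d≤r (ℕ.<⇒≱ r<d)
  ... | no _ rewrite ℕ.m≤n⇒m⊓n≡m (ℕ.<⇒≤ (gap k s r k+s<r)) | ℕ.m≤n⇒m⊓n≡m (gap k s r k+s<r)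
      | ℕ.m≤n⇒m⊓n≡m (ℕ.m+n≤o⇒m≤o∸n k (ℕ.≤-trans (ℕ.≤-reflexive (ℕ.+-suc k s)) k+s<r))
      | ℕ.+-∸-assoc 1 (ℕ.≤-trans r<n (ℕ.m≤n+m n s)) = trans
        (shift^-linear e .cong (lowerFactors-suc k) j)
        (shift^-linear e .axpy _ _ (lowerFactors k) j)
    where
    e = s ℕ.+ n ∸ suc r

  ≮⇒∸≤ : ∀ k r s → ¬ k ℕ.+ r < s → s ∸ r ≤ k
  ≮⇒∸≤ k r s ≮ = ℕ.m≤n+o⇒m∸n≤o s r (ℕ.≤-trans (ℕ.≮⇒≥ ≮) (ℕ.≤-reflexive (ℕ.+-comm k r)))

  col-upper-stable : ∀ {k s r} → r < d → ¬ k ℕ.+ r < s → col k s r ≡ col (suc k) s r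
  col-upper-stable {k} {s} {r} r<d ≮ with r <? d
  ... | no r≮d = contradiction r<d r≮d
  ... | yes _ rewrite ℕ.m≥n⇒m⊓n≡n (≮⇒∸≤ k r s ≮) | ℕ.m≥n⇒m⊓n≡n (ℕ.m≤n⇒m≤1+n (≮⇒∸≤ k r s ≮)) = ≡.refl

  col-lower-stable : ∀ {k s r} → d ≤ r → ¬ k ℕ.+ s < r → col k s r ≡ col (suc k) s r
  col-lower-stable {k} {s} {r} d≤r ≮ with r <? d
  ... | yes r<d = contradiction d≤r (ℕ.<⇒≱ r<d)
  ... | no _ rewrite ℕ.m≥n⇒m⊓n≡n (≮⇒∸≤ k s r ≮) | ℕ.m≥n⇒m⊓n≡n (ℕ.m≤n⇒m≤1+n (≮⇒∸≤ k s r ≮)) = ≡.refl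

  -- Exponent and cap do not change when row index and length both grow by one. Hence a box added
  -- below a row of the same length produces two equal neighbouring columns.
  col-upper-diagonal : ∀ {k s r} → suc r < d → col k s r ≡ col k (suc s) (suc r)
  col-upper-diagonal {k} {s} {r} r<d with r <? d | suc r <? d
  ... | yes _   | yes _   = ≡.refl
  ... | _       | no r≮d  = contradiction r<d r≮d
  ... | no r≮d  | _       = contradiction (ℕ.<-trans (ℕ.n<1+n r) r<d) r≮d

  col-lower-diagonal : ∀ {k s r} → d ≤ r → col k s r ≡ col k (suc s) (suc r)
  col-lower-diagonal {k} {s} {r} d≤r with r <? d | suc r <? d
  ... | no _    | no _    = ≡.refl
  ... | yes r<d | _       = contradiction d≤r (ℕ.<⇒≱ r<d)
  ... | _       | yes r<d = contradiction d≤r (ℕ.<⇒≱ (ℕ.<-trans (ℕ.n<1+n r) r<d))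

  module _ (κ s : ℕ → ℕ) (r : ℕ) (r<n : r < n) where

    private
      Φ : ℕ → ℕ → ℕ → U
      Φ i t = cols (bump κ r i) (bump s r t)

      D : ℕ → ℕ → Carrier
      D i t = Δ (bump κ r i) (bump s r t)

      off : ∀ {i t i′ t′ r′} → r′ ≢ r → Φ i t r′ ≈ᵁ Φ i′ t′ r′
      off {i} {t} {i′} {t′} ≢r k = reflexive (≡.cong₂ (λ κ s → col κ s _ k)
        (≡.trans (bump-≢ κ i ≢r) (≡.sym (bump-≢ κ i′ ≢r)))
        (≡.trans (bump-≢ s t ≢r) (≡.sym (bump-≢ s t′ ≢r))))

      on : ∀ i t k → Φ i t r k ≡ col (κ r ℕ.+ i) (s r ℕ.+ t) r k
      on i t k = ≡.cong₂ (λ κ s → col κ s r k) (bump-≡ κ r i) (bump-≡ s r t)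

      D₀ : Δ κ s ≈ D 0 0
      D₀ = Δ-cong (λ r′ → ≡.sym (bump-0 κ r′)) (λ r′ → ≡.sym (bump-0 s r′))
        where
        bump-0 : ∀ s r′ → bump s r 0 r′ ≡ s r′
        bump-0 s r′ with r′ ≟ r
        ... | yes _ = ℕ.+-identityʳ _
        ... | no _  = ≡.refl

      +0 : ∀ x → x ℕ.+ 0 ≡ x
      +0 = ℕ.+-identityʳ

      +1 : ∀ x → x ℕ.+ 1 ≡ suc x
      +1 x = ℕ.+-comm x 1

      stable : ∀ t → col (κ r) (s r ℕ.+ t) r ≡ col (suc (κ r)) (s r ℕ.+ t) r → D 0 t ≈ D 1 t
      stable t eq = alternant-cong λ r′ _ k → same r′ k (r′ ≟ r)
        where
        same : ∀ r′ k → Dec (r′ ≡ r) → Φ 0 t r′ k ≈ Φ 1 t r′ k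
        same r′ k (no r′≢r)    = off r′≢r k
        same r′ k (yes ≡.refl) = reflexive (≡.trans (on 0 t k) (≡.trans
          (≡.cong (λ x → col x (s r ℕ.+ t) r k) (+0 (κ r))) (≡.trans (≡.cong (λ f → f k) eq)
          (≡.trans (≡.cong (λ x → col x (s r ℕ.+ t) r k) (≡.sym (+1 (κ r)))) (≡.sym (on 1 t k))))))

      -- The parameter `i` is the level of the longer column: 1 for an upper row, 0 for a lower one.
      split : ∀ t i v → col (κ r) (s r ℕ.+ t) r ≈ᵁ
          (λ j → col (suc (κ r)) (s r ℕ.+ t) r j + v * col (κ r ℕ.+ i) (suc (s r ℕ.+ t)) r j) →
        D 0 t ≈ D 1 t + v * D i (suc t)
      split t i v eq = trans (alternant-linear r<n 1# v {Φ 0 t} {Φ 1 t} {Φ i (suc t)}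
          (λ _ → off) (λ _ → off) λ k → begin
          Φ 0 t r k
            ≡⟨ ≡.trans (on 0 t k) (≡.cong (λ x → col x (s r ℕ.+ t) r k) (+0 (κ r))) ⟩
          col (κ r) (s r ℕ.+ t) r k
            ≈⟨ eq k ⟩
          col (suc (κ r)) (s r ℕ.+ t) r k + v * col (κ r ℕ.+ i) (suc (s r ℕ.+ t)) r k
            ≡⟨ ≡.cong₂ (λ x y → x + v * y)
                 (≡.trans (≡.cong (λ x → col x (s r ℕ.+ t) r k) (≡.sym (+1 (κ r)))) (≡.sym (on 1 t k)))
                 (≡.trans (≡.cong (λ x → col (κ r ℕ.+ i) x r k) (≡.sym (ℕ.+-suc (s r) t))) (≡.sym (on i (suc t) k))) ⟩
          Φ 1 t r k + v * Φ i (suc t) r k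
            ≈⟨ +-congʳ (*-identityˡ _) ⟨
          1# * Φ 1 t r k + v * Φ i (suc t) r k ∎)
        (+-congʳ (*-identityˡ _))

    -- Below the cap, `D 0 0` splits into `D 1 0` and `w * D 1 1`; at the cap the column does not
    -- change. If there is no room for the box, the longer column equals that of the row above,
    -- which the hypothesis on `κ` puts at the new level already, and the second determinant
    -- vanishes.
    expand-upper : r < d → (∀ r′ → r ≡ suc r′ → κ r′ ≡ suc (κ r)) → Hook d s →
      Δ κ s ≈ sumᴸ (λ t → weight (value (upper (κ r) r)) ^ t * Δ (bump κ r 1) (bump s r t))
                   (choices (upper (κ r) r) s)
    expand-upper r<d κ≡ h = trans D₀ go
      where
      w = weight (value (upper (κ r) r))
      w≈ : ∀ k → weight (ℤ.- (ℤ.+ k)) ≈ - a (ℤ.- (ℤ.+ k))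
      w≈ zero    = refl
      w≈ (suc k) = refl
      splits : κ r ℕ.+ r < s r → D 0 0 ≈ D 1 0 + w * D 1 1
      splits k+r<s = trans (split 0 1 (- a (ℤ.- (ℤ.+ κ r)))
        (≡.subst₂ (λ x y → col (κ r) x r ≈ᵁ λ j → col (suc (κ r)) x r j + (- a (ℤ.- (ℤ.+ κ r))) * col y (suc x) r j)
          (≡.sym (+0 (s r))) (≡.sym (+1 (κ r))) (col-upper-suc r<d r<n k+r<s)))
        (+-congˡ (*-congʳ (sym (w≈ (κ r)))))
      only : D 1 0 ≈ w ^ 0 * D 1 0 + 0#
      only = sym (trans (+-identityʳ _) (*-identityˡ _))
      blocked : ¬ Addable s (κ r) r → D 0 0 ≈ D 1 0
      blocked ¬p with κ r ℕ.+ r <? s r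
      ... | no ≮ = stable 0 (≡.subst (λ x → col (κ r) x r ≡ col (suc (κ r)) x r) (≡.sym (+0 (s r))) (col-upper-stable r<d ≮))
      ... | yes k+r<s = trans (splits k+r<s) (trans (+-congˡ (trans (*-congˡ (zero-term r ≡.refl)) (zeroʳ w))) (+-identityʳ _))
        where
        zero-term : ∀ r′ → r′ ≡ r → D 1 1 ≈ 0#
        zero-term zero    ≡.refl = contradiction (k+r<s , tt) ¬p
        zero-term (suc r′) ≡.refl with s (suc r′) ℕ.+ 1 ℕ.≤? s r′
        ... | yes room = contradiction (k+r<s , room) ¬p
        ... | no ¬room = alternant-adjacent r<n (Φ 1 1) λ k → reflexive (≡.trans
          (≡.cong₂ (λ κ s → col κ s r′ k)
            (≡.trans (bump-≢ κ 1 (λ e → ℕ.1+n≢n (≡.sym e))) (κ≡ r′ ≡.refl))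
            (≡.trans (bump-≢ s 1 (λ e → ℕ.1+n≢n (≡.sym e))) s≡))
          (≡.trans (≡.cong (λ f → f k) (col-upper-diagonal {suc (κ r)} {s r} r<d))
          (≡.trans (≡.cong₂ (λ κ s → col κ s r k) (≡.sym (+1 (κ r))) (≡.sym (+1 (s r)))) (≡.sym (on 1 1 k)))))
          where
          s≡ : s r′ ≡ s (suc r′)
          s≡ = ℕ.≤-antisym (ℕ.≤-pred (ℕ.≤-trans (ℕ.≰⇒> ¬room) (ℕ.≤-reflexive (+1 _)))) (Hook.decreasing h r′)
      go : D 0 0 ≈ sumᴸ (λ t → w ^ t * D 1 t) (choices (upper (κ r) r) s)
      go with addable? s (κ r) r
      ... | yes (k+r<s , _) = trans (splits k+r<s) (+-cong (sym (*-identityˡ _))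
              (sym (trans (+-identityʳ _) (*-congʳ (*-identityʳ w)))))
      ... | no ¬p = trans (blocked ¬p) only

    -- The splitting is repeated on the term with the longer row and ends after `M` boxes, the bound
    -- used in `choices`: either the cap is reached, or row `r` has become as long as the row above
    -- and the next term has two equal columns.
    expand-lower : d ≤ r → (∀ r′ → r ≡ suc r′ → d ≤ r′ → κ r′ ≡ κ r) → Hook d s →
      Δ κ s ≈ sumᴸ (λ t → weight (value (lower (κ r) r)) ^ t * Δ (bump κ r 1) (bump s r t))
                   (choices (lower (κ r) r) s)
    expand-lower d≤r κ≡ h = trans D₀ (go r ≡.refl)
      where
      w = a (ℤ.+ suc (κ r))
      splits : ∀ t → κ r ℕ.+ (s r ℕ.+ t) < r → D 0 t ≈ D 1 t + w * D 0 (suc t)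
      splits t p = split t 0 w (≡.subst
        (λ x → col (κ r) (s r ℕ.+ t) r ≈ᵁ λ j → col (suc (κ r)) (s r ℕ.+ t) r j + w * col x (suc (s r ℕ.+ t)) r j)
        (≡.sym (+0 (κ r))) (col-lower-suc d≤r r<n p))
      stops : ∀ t → ¬ κ r ℕ.+ (s r ℕ.+ t) < r → D 0 t ≈ D 1 t
      stops t ≮ = stable t (col-lower-stable d≤r ≮)
      unroll : ∀ M → (∀ t → t < M → κ r ℕ.+ (s r ℕ.+ t) < r) →
        D 0 0 ≈ sumᴸ (λ t → w ^ t * D 1 t) (upTo M) + w ^ M * D 0 M
      unroll zero    p = sym (trans (+-identityˡ _) (*-identityˡ _))
      unroll (suc M) p = begin
        D 0 0
          ≈⟨ unroll M (λ t t<M → p t (ℕ.m≤n⇒m≤1+n t<M)) ⟩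
        Σ M + w ^ M * D 0 M
          ≈⟨ +-congˡ (*-congˡ (splits M (p M ℕ.≤-refl))) ⟩
        Σ M + w ^ M * (D 1 M + w * D 0 (suc M))
          ≈⟨ solve 5 (λ s v x w y → s :+ v :* (x :+ w :* y) := (s :+ v :* x) :+ (w :* v) :* y) refl
               (Σ M) (w ^ M) (D 1 M) w (D 0 (suc M)) ⟩
        (Σ M + w ^ M * D 1 M) + w ^ suc M * D 0 (suc M)
          ≈⟨ +-congʳ (Σ-suc M) ⟨
        Σ (suc M) + w ^ suc M * D 0 (suc M) ∎
        where
        Σ : ℕ → Carrier
        Σ M = sumᴸ (λ t → w ^ t * D 1 t) (upTo M)
        Σ-suc : ∀ M → Σ (suc M) ≈ Σ M + w ^ M * D 1 M
        Σ-suc M = trans (reflexive (≡.cong (sumᴸ _) (≡.sym (upTo-∷ʳ M))))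
          (trans (sumᴸ-++ _ (upTo M)) (+-congˡ (+-identityʳ _)))
      unroll-stop : ∀ M → (∀ t → t < M → κ r ℕ.+ (s r ℕ.+ t) < r) → D 0 M ≈ D 1 M →
        D 0 0 ≈ sumᴸ (λ t → w ^ t * D 1 t) (upTo (suc M))
      unroll-stop M p eq = trans (unroll M p) (trans (+-congˡ (*-congˡ eq))
        (sym (trans (reflexive (≡.cong (sumᴸ _) (≡.sym (upTo-∷ʳ M))))
          (trans (sumᴸ-++ _ (upTo M)) (+-congˡ (+-identityʳ _))))))
      go : ∀ r′ → r′ ≡ r → D 0 0 ≈ sumᴸ (λ t → w ^ t * D 1 t) (choices (lower (κ r) r′) s)
      go zero     r≡ = unroll-stop 0 (λ _ ()) (stops 0 (≡.subst (λ r′ → ¬ κ r ℕ.+ (s r ℕ.+ 0) < r′) r≡ λ ()))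
      go (suc r′) ≡.refl = unroll-stop M below last
        where
        M = (suc r′ ∸ κ r ∸ s r) ⊓ (s r′ ∸ s r)
        M≤ : M ≤ r ∸ κ r ∸ s r
        M≤ = ℕ.m⊓n≤m _ _
        below : ∀ t → t < M → κ r ℕ.+ (s r ℕ.+ t) < r
        below t t<M = ≡.subst (_≤ r) (≡.trans (ℕ.+-assoc (κ r) (s r) (suc t))
            (≡.trans (≡.cong (κ r ℕ.+_) (ℕ.+-suc (s r) t)) (ℕ.+-suc (κ r) (s r ℕ.+ t))))
          (≤∸⇒+≤ (≡.subst (suc t ≤_) (ℕ.∸-+-assoc r (κ r) (s r)) (ℕ.≤-trans t<M M≤)))
        last : D 0 M ≈ D 1 M
        last with κ r ℕ.+ (s r ℕ.+ M) <? r
        ... | no ≮  = stops M ≮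
        ... | yes p = trans (splits M p) (trans (+-congˡ (trans (*-congˡ zero-term) (zeroʳ w))) (+-identityʳ _))
          where
          M< : M < r ∸ κ r ∸ s r
          M< = ≡.subst (M <_) (≡.sym (ℕ.∸-+-assoc r (κ r) (s r))) (ℕ.m+n≤o⇒m≤o∸n (suc M)
            (≡.subst (λ x → suc x ≤ r) (≡.trans (≡.sym (ℕ.+-assoc (κ r) (s r) M)) (ℕ.+-comm _ M)) p))
          -- As `M` falls short of the first argument of the minimum, it is the second.
          M≡ : M ≡ s r′ ∸ s r
          M≡ with ℕ.⊓-sel (suc r′ ∸ κ r ∸ s r) (s r′ ∸ s r)
          ... | inj₁ e = contradiction (≡.sym e) (ℕ.<⇒≢ M< ∘ ≡.sym)
          ... | inj₂ e = e
          s+M≡ : s r ℕ.+ M ≡ s r′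
          s+M≡ = ≡.trans (≡.cong (s r ℕ.+_) M≡) (ℕ.m+[n∸m]≡n (Hook.decreasing h r′))
          -- If the row above were one of the first `d`, then `s r + M`, which is its length, would
          -- be at least `d` and hence at least `r`, contrary to `p`.
          d≤r′ : d ≤ r′
          d≤r′ with d ℕ.≤? r′
          ... | yes q = q
          ... | no ¬q = contradiction (ℕ.≤-trans p (ℕ.≤-trans (ℕ.≰⇒> ¬q) (ℕ.≤-trans (Hook.d≤s h (ℕ.≰⇒> ¬q))
                  (ℕ.≤-trans (ℕ.≤-reflexive (≡.sym s+M≡)) (ℕ.m≤n+m _ (κ r)))))) (ℕ.<-irrefl ≡.refl)
          zero-term : D 0 (suc M) ≈ 0#
          zero-term = alternant-adjacent r<n (Φ 0 (suc M)) λ k → reflexive (≡.trans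
            (≡.cong₂ (λ κ s → col κ s r′ k)
              (≡.trans (bump-≢ κ 0 (λ e → ℕ.1+n≢n (≡.sym e))) (κ≡ r′ ≡.refl d≤r′))
              (≡.trans (bump-≢ s (suc M) (λ e → ℕ.1+n≢n (≡.sym e))) (≡.sym s+M≡)))
            (≡.trans (≡.cong (λ f → f k) (col-lower-diagonal {κ r} {s r ℕ.+ M} d≤r′))
            (≡.trans (≡.cong₂ (λ κ s → col κ s r k) (≡.sym (+0 (κ r))) (≡.sym (ℕ.+-suc (s r) M))) (≡.sym (on 0 (suc M) k)))))

  runWeight : List Step → List ℕ → Carrier
  runWeight (σ ∷ σs) (t ∷ ts) = weight (value σ) ^ t * runWeight σs ts
  runWeight _        _        = 1#

  -- Iterates the two identities for single steps: `Schedule` provides the levels they require, and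
  -- every admissible choice preserves `Hook`.
  expand : ∀ {σs κ κ′ s} → Schedule d n σs κ κ′ → Hook d s →
    Δ κ s ≈ sumᴸ (λ ts → runWeight σs ts * Δ κ′ (final σs s ts)) (runs σs s)
  expand done h = sym (trans (+-identityʳ _) (*-identityˡ _))
  expand {σ ∷ σs} {κ} {κ′} {s} schedule h = begin
    Δ κ s
      ≈⟨ step schedule ⟩
    sumᴸ (λ t → w ^ t * Δ (bump κ (row σ) 1) (bump s (row σ) t)) (choices σ s)
      ≈⟨ sumᴸ-cong (choices σ s) (λ {t} t∈ → begin
           w ^ t * Δ (bump κ (row σ) 1) (bump s (row σ) t)
             ≈⟨ *-congˡ (expand (rest schedule) (hook′ schedule t∈)) ⟩
           w ^ t * sumᴸ (λ ts → runWeight σs ts * Δ κ′ (final σs (bump s (row σ) t) ts)) (runs σs (bump s (row σ) t))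
             ≈⟨ sumᴸ-*ˡ (w ^ t) _ (runs σs (bump s (row σ) t)) ⟨
           sumᴸ (λ ts → w ^ t * (runWeight σs ts * Δ κ′ (final σs (bump s (row σ) t) ts))) (runs σs (bump s (row σ) t))
             ≈⟨ sumᴸ-cong (runs σs (bump s (row σ) t)) (λ _ → sym (*-assoc _ _ _)) ⟩
           sumᴸ (F ∘ (t ∷_)) (runs σs (bump s (row σ) t))
             ≡⟨ sumᴸ-map F (t ∷_) (runs σs (bump s (row σ) t)) ⟨
           sumᴸ F (map (t ∷_) (runs σs (bump s (row σ) t))) ∎) ⟩
    sumᴸ (λ t → sumᴸ F (map (t ∷_) (runs σs (bump s (row σ) t)))) (choices σ s)
      ≈⟨ sumᴸ-concatMap F _ (choices σ s) ⟨
    sumᴸ F (runs (σ ∷ σs) s) ∎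
    where
    w = weight (value σ)
    F : List ℕ → Carrier
    F ts = runWeight (σ ∷ σs) ts * Δ κ′ (final (σ ∷ σs) s ts)
    step : Schedule d n (σ ∷ σs) κ κ′ →
      Δ κ s ≈ sumᴸ (λ t → w ^ t * Δ (bump κ (row σ) 1) (bump s (row σ) t)) (choices σ s)
    step (upper {r = r} r<d r<n ≡.refl κ≡ _) = expand-upper κ s r r<n r<d κ≡ h
    step (lower {r = r} d≤r r<n ≡.refl κ≡ _) = expand-lower κ s r r<n d≤r κ≡ h
    rest : Schedule d n (σ ∷ σs) κ κ′ → Schedule d n σs (bump κ (row σ) 1) κ′
    rest (upper _ _ _ _ sch) = sch
    rest (lower _ _ _ _ sch) = sch
    hook′ : Schedule d n (σ ∷ σs) κ κ′ → ∀ {t} → t ∈ choices σ s → Hook d (bump s (row σ) t)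
    hook′ (upper {k = k} {r = r} r<d _ _ _ _) t∈ =
      Hook-bump-upper r<d (Ok⇒Room (upper k r) (Hook.decreasing h) (∈-choices⁻ (upper k r) t∈)) h
    hook′ (lower {k = k} {r = r} d≤r _ _ _ _) t∈ = Hook-bump-lower d≤r (∈-choices⁻ (lower k r) t∈) h

-- Matching the expansion with tableaux and dual Schur functions

module SchurExpansion {c ℓ′ : Level} (R : CommutativeRing c ℓ′) (a : ℤ → CommutativeRing.Carrier R) where
  open DualSchur R a hiding (module Ops)
  open CommutativeRing R hiding (zero)
  open import Algebra.Properties.Ring ring using (-1*x≈-x)
  open Determinants R a
  open PowerSeries R a
  open Columns R a
  open import Relation.Binary.Reasoning.Setoid setoid

  sumᴸ-filter : ∀ {x p : Level} {X : Set x} {P : X → Set p} (P? : Decidable P) (f : X → Carrier) xs →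
    (∀ {x} → x ∈ xs → ¬ P x → f x ≈ 0#) → sumᴸ f (filter P? xs) ≈ sumᴸ f xs
  sumᴸ-filter P? f []       f≈0 = refl
  sumᴸ-filter P? f (x ∷ xs) f≈0 with P? x
  ... | yes _ = +-congˡ (sumᴸ-filter P? f xs (f≈0 ∘ there))
  ... | no ¬p = trans (sumᴸ-filter P? f xs (f≈0 ∘ there))
                  (trans (sym (+-identityˡ _)) (+-congʳ (sym (f≈0 (here ≡.refl) ¬p))))

  weight-neg : ∀ k → weight (neg k) ≈ - a (neg k)
  weight-neg zero    = refl
  weight-neg (suc k) = refl

  sign-prod : ∀ {p : Level} {P : Box → Set p} (P? : Decidable P) (T : Box → ℤ) bs →
    (∀ {b} → b ∈ bs → (P b × ∃[ k ] T b ≡ neg k) ⊎ (¬ P b × ∃[ k ] T b ≡ ℤ.+ (suc k))) →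
    sign (length (filter P? bs)) * prodᴸ (a ∘ T) bs ≈ prodᴸ (weight ∘ T) bs
  sign-prod P? T []       cases = *-identityˡ _
  sign-prod P? T (b ∷ bs) cases with P? b | cases (here ≡.refl)
  ... | yes p | inj₂ (¬p , _) = contradiction p ¬p
  ... | no ¬p | inj₁ (p , _)  = contradiction p ¬p
  ... | no _  | inj₂ (_ , k , eq) rewrite eq = trans
    (solve 3 (λ s x y → s :* (x :* y) := x :* (s :* y)) refl _ (a (ℤ.+ (suc k))) _)
    (*-congˡ (sign-prod P? T bs (cases ∘ there)))
  ... | yes _ | inj₁ (_ , k , eq) rewrite eq = trans
    (solve 4 (λ e s x y → (e :* s) :* (x :* y) := (e :* x) :* (s :* y)) refl (- 1#) _ (a (neg k)) _)
    (*-cong (trans (-1*x≈-x _) (sym (weight-neg k))) (sign-prod P? T bs (cases ∘ there)))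

  -- A step labels all `t` boxes that it adds, which gives the factor `w ^ t`; the labels of the
  -- other boxes are those of the remaining run.
  prod-run : ∀ {σs s ts} → Run σs s ts → ∀ d {n} (β : Vec ℕ n) →
    prodᴸ (weight ∘ adderAt σs s ts) (newBoxes σs s ts) ≈ Expansion.runWeight R a d β σs ts
  prod-run [] d β = refl
  prod-run {σ ∷ σs} {s} (_∷_ {t = t} {ts} ok run) d β = begin
    prodᴸ W (block ++ newBoxes σs s′ ts)
      ≈⟨ prodᴸ-++ W block ⟩
    prodᴸ W block * prodᴸ W (newBoxes σs s′ ts)
      ≈⟨ *-cong (trans (prodᴸ-cong block block-weight) (prod-const block))
                (trans (prodᴸ-cong (newBoxes σs s′ ts) tail-weight) (prod-run run d β)) ⟩
    w ^ length block * runWeight σs ts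
      ≡⟨ ≡.cong (λ k → w ^ k * runWeight σs ts) (≡.trans (length-map _ (1… t)) (length-1… t)) ⟩
    w ^ t * runWeight σs ts ∎
    where
    open Expansion R a d β using (runWeight)
    s′ = bump s (row σ) t
    w = weight (value σ)
    W : Box → Carrier
    W = weight ∘ adderAt (σ ∷ σs) s (t ∷ ts)
    block = map (λ j → suc (row σ) , s (row σ) ℕ.+ j) (1… t)
    prod-const : ∀ (bs : List Box) → prodᴸ (λ _ → w) bs ≈ w ^ length bs
    prod-const []       = refl
    prod-const (_ ∷ bs) = *-congˡ (prod-const bs)
    block-weight : ∀ {b} → b ∈ block → W b ≈ w
    block-weight b∈ with ∈-map⁻ (λ j → suc (row σ) , s (row σ) ℕ.+ j) b∈
    ... | j , j∈ , ≡.refl with ∈-map⁻ suc j∈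
    ...   | i , i∈ , ≡.refl with s (row σ) ℕ.+ suc i ≤? bump s (row σ) t (row σ)
    ...     | yes _ = refl
    ...     | no ¬p = contradiction (ℕ.≤-trans (ℕ.+-monoʳ-≤ (s (row σ)) (∈-upTo⁻ i∈)) (ℕ.≤-reflexive (≡.sym (bump-≡ s (row σ) t)))) ¬p
    tail-weight : ∀ {b} → b ∈ newBoxes σs s′ ts → W b ≈ weight (adderAt σs s′ ts b)
    tail-weight {_ , c} b∈ with ∈-newBoxes⁻ run b∈
    ... | r , ≡.refl , p , _ with c ≤? bump s (row σ) t r
    ...   | yes q = contradiction q (ℕ.<⇒≱ p)
    ...   | no _  = refl

  finalCol : (d n s r : ℕ) → U
  finalCol d n s r with r <? d
  ... | yes _ = shift^ (s ℕ.+ n ∸ suc r) (upperFactors (s ∸ r))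
  ... | no  _ = shift^ (s ℕ.+ n ∸ suc r) (lowerFactors (r ∸ s))

  A-at : ∀ lam {n} (i : Fin n) r → A lam n i (suc r) ≈ˢ at i (finalCol (diag lam) n (rows lam r) r)
  A-at lam {n} i r with r <? diag lam
  ... | yes r<d rewrite dec-true (suc r ≤? diag lam) r<d = X^-times i (rows lam r ℕ.+ n ∸ suc r)
        (≡.subst (λ K → S.prodᴸ (λ k → geometric (a (ℤ.- (ℤ.+ k))) i) (upTo (suc (rows lam r ∸ suc r))) ≈ˢ at i (upperFactors K))
          -- The product has `suc (s ∸ suc r)` factors for `s = rows lam r`. This is `s ∸ r` because
          -- the diagonal box of row `r` lies in λ, that is `r < s`.
          (≡.sym (ℕ.+-∸-assoc 1 (<diag⁻ lam r<d)))
          (geometrics-at i (λ k → a (ℤ.- (ℤ.+ k))) (upTo (suc (rows lam r ∸ suc r)))))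
  ... | no r≮d rewrite dec-false (suc r ≤? diag lam) r≮d = X^-times i (rows lam r ℕ.+ n ∸ suc r)
        (≡.subst (λ K → S.prodᴸ (λ k → linear (a (ℤ.+ k)) i) (1… (suc r ∸ rows lam r ∸ 1)) ≈ˢ at i (lowerFactors K))
          (≡.trans (ℕ.∸-+-assoc (suc r) (rows lam r) 1) (≡.cong (suc r ∸_) (ℕ.+-comm (rows lam r) 1)))
          (linears-at i (λ k → a (ℤ.+ k)) (1… (suc r ∸ rows lam r ∸ 1))))

  detA : Partition → ∀ {n} → Series n
  detA lam {n} = S.det (λ i j → A lam n i (suc (toℕ j)))

  detX : Partition → ∀ {n} → Series n
  detX μ {n} = S.det {n} (λ i j → X i S.^ (part μ (suc (toℕ j)) ℕ.+ n ∸ suc (toℕ j)))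

  module _ {n : ℕ} (β : Vec ℕ n) where

    detA≈ : ∀ lam → detA lam β ≈ Expansion.alternant R a (diag lam) β (λ r → finalCol (diag lam) n (rows lam r) r)
    detA≈ lam = trans (det-congˢ (λ i j → A-at lam i (toℕ j)) β)
      (det-at (λ j → finalCol (diag lam) n (rows lam (toℕ j)) (toℕ j)) β)

    -- At level 0 the columns carry no factors, whichever rows count as upper.
    detX≈ : ∀ d μ → detX μ β ≈ Expansion.Δ R a d β (λ _ → 0) (rows μ)
    detX≈ d μ = trans (det-congˢ (λ i j → X^-at i (e j)) β)
      (trans (det-at (λ j → shift^ (e j) δ) β) (det-cong λ i j → same (toℕ j) (lookup β i)))
      where
      e : Fin n → ℕ
      e j = rows μ (toℕ j) ℕ.+ n ∸ suc (toℕ j)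
      same : ∀ r k → shift^ (rows μ r ℕ.+ n ∸ suc r) δ k ≈ Expansion.cols R a d β (λ _ → 0) (rows μ) r k
      same r k with r <? d
      ... | yes _ = refl
      ... | no _  = refl

    module _ {N : ℕ} (bound : ∀ i → lookup β i ≤ N) where

      zero-column : ∀ {M : Fin n → Fin n → Carrier} → 0 < n → (∀ i j → toℕ j ≡ 0 → M i j ≈ 0#) → det M ≈ 0#
      zero-column {M} (s≤s _) M≈0 = trans
        -- A zero column is 0 times itself plus 0 times itself.
        (det-linear zero 0# 0# {M} {M} {M} (λ _ _ _ → refl) (λ _ _ _ → refl)
          (λ i → trans (M≈0 i zero ≡.refl) (sym (trans (+-cong (zeroˡ _) (zeroˡ _)) (+-identityʳ 0#)))))
        (trans (+-cong (zeroˡ _) (zeroˡ _)) (+-identityʳ 0#))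

      big-exponent : ∀ {s k} → 0 < n → N < s → k ≤ N → k < s ℕ.+ n ∸ 1
      big-exponent {s} {k} 0<n N<s k≤N = ℕ.≤-trans (ℕ.≤-trans (s≤s k≤N) N<s)
        (ℕ.≤-trans (ℕ.m≤m+n s (n ∸ 1)) (ℕ.≤-reflexive (≡.sym (ℕ.+-∸-assoc s 0<n))))

      finalCol≈0 : ∀ d {s r k} → r ≡ 0 → 0 < n → N < s → k ≤ N → finalCol d n s r k ≈ 0#
      finalCol≈0 d ≡.refl 0<n N<s k≤N with 0 <? d
      ... | yes _ = shift^≈0 _ _ (big-exponent 0<n N<s k≤N)
      ... | no _  = shift^≈0 _ _ (big-exponent 0<n N<s k≤N)

      col≈0 : ∀ d {κ s r k} → r ≡ 0 → 0 < n → N < s → k ≤ N → Expansion.col R a d β κ s r k ≈ 0#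
      col≈0 d ≡.refl 0<n N<s k≤N with 0 <? d
      ... | yes _ = shift^≈0 _ _ (big-exponent 0<n N<s k≤N)
      ... | no _  = shift^≈0 _ _ (big-exponent 0<n N<s k≤N)

      -- The first column is divisible by a power of the variable larger than `N`, and all exponents
      -- in `β` are at most `N`.
      detA≈0 : ∀ lam → ℓ lam ≤ n → N < rows lam 0 → detA lam β ≈ 0#
      detA≈0 lam ℓ≤n N<λ₁ = trans (detA≈ lam) (zero-column 0<n λ i j j≡0 →
        finalCol≈0 (diag lam) j≡0 0<n (≡.subst (λ r → N < rows lam r) (≡.sym j≡0) N<λ₁) (bound i))
        where
        0<n : 0 < n
        0<n = ℕ.<-≤-trans (nth-within (parts lam) (ℕ.≤-trans (s≤s z≤n) N<λ₁)) ℓ≤n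

      Δ≈0 : ∀ d κ s → 0 < n → N < s 0 → Expansion.Δ R a d β κ s ≈ 0#
      Δ≈0 d κ s 0<n N<s = zero-column 0<n λ i j j≡0 →
        col≈0 d j≡0 0<n (≡.subst (λ r → N < s r) (≡.sym j≡0) N<s) (bound i)

  module _ {n : ℕ} (N : ℕ) (μ : Partition) (ℓμ≤n : ℓ μ ≤ n) where

    private
      d = diag μ
      d≤n : d ≤ n
      d≤n = ℕ.≤-trans (diag≤ℓ μ) ℓμ≤n
      σs = steps d n N
      fin : List ℕ → ℕ → ℕ
      fin = final σs (rows μ)
      adds : List ℕ → Box → ℤ
      adds = adderAt σs (rows μ)
      κ′ = proj₁ (steps-schedule d≤n N)
      schedule = proj₁ (proj₂ (steps-schedule d≤n N))
      κ′-upper : ∀ {r} → r < d → κ′ r ≡ N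
      κ′-upper = proj₁ (proj₂ (proj₂ (steps-schedule d≤n N)))
      κ′-lower : ∀ {r} → d ≤ r → r < n → κ′ r ≡ n
      κ′-lower = proj₂ (proj₂ (proj₂ (steps-schedule d≤n N)))
      hμ = hook μ

      small? : ∀ ts → Dec (fin ts 0 ≤ N)
      small? ts = fin ts 0 ≤? N

      rs : List (List ℕ)
      rs = filter small? (runs σs (rows μ))

      lamOf : List ℕ → Partition
      lamOf ts = toPartition (shape n (fin ts))

      fin-beyond : ∀ {ts} → Run σs (rows μ) ts → ∀ {r} → n ≤ r → fin ts r ≡ 0
      fin-beyond {ts} run {r} n≤r with rows μ r <? fin ts r
      ... | no ≮ = ℕ.n≤0⇒n≡0 (ℕ.≤-trans (ℕ.≮⇒≥ ≮) (ℕ.≤-reflexive (nth-beyond (parts μ) (ℕ.≤-trans ℓμ≤n n≤r))))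
      ... | yes p with adder-∈ run p ℕ.≤-refl
      ...   | A∈ , row≡ , _ = contradiction n≤r (ℕ.<⇒≱ (go _ row≡ (∈-steps⁻ d≤n A∈)))
        where
        go : ∀ σ → row σ ≡ r → InRange d n N σ → r < n
        go (upper _ _) ≡.refl (_ , r<d)     = ℕ.<-≤-trans r<d d≤n
        go (lower _ _) ≡.refl (_ , _ , r<n) = r<n

      module _ {ts : List ℕ} (run : Run σs (rows μ) ts) where

        hook-fin : Hook d (fin ts)
        hook-fin = final-hook schedule run hμ

        parts-lamOf : parts (lamOf ts) ≡ shape n (fin ts)
        parts-lamOf = parts-toPartition
          (decreasing-nth _ λ r → ≡.subst₂ _≤_ (≡.sym (eq (suc r))) (≡.sym (eq r)) (Hook.decreasing hook-fin r))
          (shape-positive n (fin ts))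
          where
          eq = nth-shape n (Hook.decreasing hook-fin) (fin-beyond run)

        rows-lamOf : ∀ r → fin ts r ≡ rows (lamOf ts) r
        rows-lamOf r = ≡.sym (≡.trans (≡.cong (λ ps → nth ps r) parts-lamOf)
          (nth-shape n (Hook.decreasing hook-fin) (fin-beyond run) r))

        ℓ-lamOf : ℓ (lamOf ts) ≤ n
        ℓ-lamOf = ≡.subst (λ ps → length ps ≤ n) (≡.sym parts-lamOf) (length-shape n (fin ts))

        ⊆-lamOf : μ ⊆ lamOf ts
        ⊆-lamOf i = ℕ.≤-trans (≤-final run (i ∸ 1)) (ℕ.≤-reflexive (rows-lamOf (i ∸ 1)))

        diag-lamOf : diag (lamOf ts) ≡ d
        diag-lamOf = hook-diag (lamOf ts) (record
          { decreasing = rows-decreasing (lamOf ts)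
          ; d≤s        = λ {r} p → ≡.subst (d ≤_) (rows-lamOf r) (Hook.d≤s hook-fin p)
          ; s≤d        = λ {r} p → ≡.subst (_≤ d) (rows-lamOf r) (Hook.s≤d hook-fin p) })

        lamOf-≡ : ∀ lam → (∀ r → fin ts r ≡ rows lam r) → lamOf ts ≡ lam
        lamOf-≡ lam eq = parts-injective (nth-injective (parts-positive (lamOf ts)) (parts-positive lam)
          λ r → ≡.trans (≡.sym (rows-lamOf r)) (eq r))

    -- Several runs may end in the same shape, hence the deduplication. A shape in range that no run
    -- reaches has no tableaux either, by `ψ≈0`.
    support : List Partition
    support = deduplicate _≟ᴾ_ (map lamOf rs)

    support-unique : Unique support
    support-unique = UniqueDec.deduplicate-! _≟ᴾ_ (map lamOf rs)

    private
      ∈-rs⁻ : ∀ {ts} → ts ∈ rs → Run σs (rows μ) ts × fin ts 0 ≤ N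
      ∈-rs⁻ ts∈ with ∈-filter⁻ small? {xs = runs σs (rows μ)} ts∈
      ... | p , q = ∈-runs⁻ σs p , q

      ∈-rs⁺ : ∀ {ts} → Run σs (rows μ) ts → fin ts 0 ≤ N → ts ∈ rs
      ∈-rs⁺ run small = ∈-filter⁺ small? (∈-runs⁺ run) small

      ∈-support⁺ : ∀ {ts} → ts ∈ rs → lamOf ts ∈ support
      ∈-support⁺ ts∈ = ∈-deduplicate⁺ _≟ᴾ_ (∈-map⁺ lamOf ts∈)

      ∈-support⁻ : ∀ {lam} → lam ∈ support → ∃[ ts ] ts ∈ rs × lam ≡ lamOf ts
      ∈-support⁻ lam∈ = ∈-map⁻ lamOf (∈-deduplicate⁻ _≟ᴾ_ (map lamOf rs) lam∈)

    ∈-support⇒ : ∀ {lam} → lam ∈ support → μ ⊆ lam × diag lam ≡ d × ℓ lam ≤ n × rows lam 0 ≤ N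
    ∈-support⇒ lam∈ with ∈-support⁻ lam∈
    ... | ts , ts∈ , ≡.refl with ∈-rs⁻ ts∈
    ...   | run , small = ⊆-lamOf run , diag-lamOf run , ℓ-lamOf run , ≡.subst (_≤ N) (rows-lamOf run 0) small

    private
      hookOf : ∀ lam → diag lam ≡ d → Hook d (rows lam)
      hookOf lam eq = ≡.subst (λ d → Hook d (rows lam)) eq (hook lam)

    tableau⇒∈-support : ∀ lam {T} → μ ⊆ lam → diag lam ≡ d → ℓ lam ≤ n → rows lam 0 ≤ N →
      T ∈ dualHookTableaux d lam μ →
      ∃[ ts ] ts ∈ rs × lamOf ts ≡ lam × (∀ {b} → b ∈ skew lam μ → adds ts b ≡ T b)
    tableau⇒∈-support lam μ⊆λ dλ ℓ≤n λ₁≤N T∈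
      with FromTableau.tableau⇒run {d} {lam} {μ} (hookOf lam dλ) hμ T∈ d≤n ℓ≤n λ₁≤N μ⊆λ
    ... | ts , run , eq , add = ts , ∈-rs⁺ run (≡.subst (_≤ N) (≡.sym (eq 0)) λ₁≤N) , lamOf-≡ run lam eq , add

    ψ≈0 : ∀ lam → μ ⊆ lam → diag lam ≡ d → ℓ lam ≤ n → rows lam 0 ≤ N → lam ∉ support → ψ d lam μ ≈ 0#
    ψ≈0 lam μ⊆λ dλ ℓ≤n λ₁≤N lam∉ = sumᴸ≈0 (dualHookTableaux d lam μ) λ T∈ → ⊥-elim (none T∈)
      where
      none : ∀ {T} → T ∈ dualHookTableaux d lam μ → ⊥
      none T∈ with tableau⇒∈-support lam μ⊆λ dλ ℓ≤n λ₁≤N T∈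
      ... | ts , ts∈ , ≡.refl , _ = lam∉ (∈-support⁺ ts∈)

    signed-ψ : ∀ lam → diag lam ≡ d →
      sign (m d lam μ) * ψ d lam μ ≈ sumᴸ (λ T → prodᴸ (weight ∘ T) (skew lam μ)) (dualHookTableaux d lam μ)
    signed-ψ lam dλ = trans (sym (sumᴸ-*ˡ (sign (m d lam μ)) _ (dualHookTableaux d lam μ)))
      (sumᴸ-cong (dualHookTableaux d lam μ) λ {T} T∈ →
        sign-prod {P = λ b → proj₁ b ≤ d} _ T (skew lam μ) (FromTableau.sign-≤d {d} {lam} {μ} (hookOf lam dλ) hμ T∈))

    private
      -- Stands for a shape together with a filling. Fillings are functions and cannot be compared
      -- directly; with codes the bijection between tableaux and runs becomes a permutation of
      -- duplicate-free lists.
      Code : Set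
      Code = List ℕ × List ℤ

      code : Partition → (Box → ℤ) → Code
      code lam T = parts lam , map T (skew lam μ)

      tableauCodes runCodes : List Code
      tableauCodes = concatMap (λ lam → map (code lam) (dualHookTableaux d lam μ)) support
      runCodes = map (λ ts → code (lamOf ts) (adds ts)) rs

      code-cong : ∀ {lam T T′} → (∀ {b} → b ∈ skew lam μ → T b ≡ T′ b) → code lam T ≡ code lam T′
      code-cong {lam} eq = ≡.cong (parts lam ,_) (map-cong-local (All.tabulate eq))

      tableauCodes-unique : Unique tableauCodes
      tableauCodes-unique = Unique-concatMap (λ lam → map (code lam) (dualHookTableaux d lam μ)) support-unique
        (λ {lam} lam∈ → AllPairs.map⁺ (AllPairs.map (λ ne eq → ne (≡.cong proj₂ eq))
          (AllPairs.filter⁺ (isTableau? d (skew lam μ))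
            (fillings-unique (entries d lam) (skew-unique lam μ)
              (entries-unique {d} {lam} {μ} (hookOf lam (proj₁ (proj₂ (∈-support⇒ lam∈)))) hμ)))))
        λ {lam} {lam′} p q → same (∈-map⁻ (code lam) p) (∈-map⁻ (code lam′) q)
        where
        same : ∀ {lam lam′ v xs ys} → (∃[ T ] T ∈ xs × v ≡ code lam T) → (∃[ T ] T ∈ ys × v ≡ code lam′ T) → lam ≡ lam′
        same (_ , _ , eq) (_ , _ , eq′) = parts-injective (≡.cong proj₁ (≡.trans (≡.sym eq) eq′))

      -- The row of a box and its entry determine the step that added it, so equal codes give equal
      -- labels and `runs-injective` applies.
      runCodes-unique : Unique runCodes
      runCodes-unique = Unique-map _ inj (filter⁺ small? (runs-unique σs (rows μ)))
        where
        inj : ∀ {ts us} → ts ∈ rs → us ∈ rs → code (lamOf ts) (adds ts) ≡ code (lamOf us) (adds us) → ts ≡ us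
        inj {ts} {us} ts∈ us∈ eq = runs-injective (steps-sorted d n N) run run′
          (λ r → ≡.trans (rows-lamOf run r) (≡.trans (≡.cong (λ lam → rows lam r) lam≡) (≡.sym (rows-lamOf run′ r))))
          λ r c p q → same-step (proj₁ (proj₂ (adder-∈ run p q)))
            (proj₁ (proj₂ (adder-∈ run′ p (≡.subst (c ≤_) (fin≡ r) q))))
            (map-≡⁻ vals≡ (∈-skew⁺ (lamOf ts) μ p (≡.subst (c ≤_) (rows-lamOf run r) q)))
          where
          run = proj₁ (∈-rs⁻ ts∈)
          run′ = proj₁ (∈-rs⁻ us∈)
          lam≡ : lamOf ts ≡ lamOf us
          lam≡ = parts-injective (≡.cong proj₁ eq)
          fin≡ : ∀ r → fin ts r ≡ fin us r
          fin≡ r = ≡.trans (rows-lamOf run r) (≡.trans (≡.cong (λ lam → rows lam r) lam≡) (≡.sym (rows-lamOf run′ r)))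
          vals≡ : map (adds ts) (skew (lamOf ts) μ) ≡ map (adds us) (skew (lamOf ts) μ)
          vals≡ = ≡.trans (≡.cong proj₂ eq) (≡.cong (λ lam → map (adds us) (skew lam μ)) (≡.sym lam≡))
          same-step : ∀ {σ τ r} → row σ ≡ r → row τ ≡ r → value σ ≡ value τ → σ ≡ τ
          same-step {σ} {τ} p q v = ≡.trans (≡.sym (toStep-value σ))
            (≡.trans (≡.cong₂ toStep (≡.trans p (≡.sym q)) v) (toStep-value τ))

      tableau⊆run : ∀ {x} → x ∈ tableauCodes → x ∈ runCodes
      tableau⊆run x∈ with find (∈-concatMap⁻ (λ lam → map (code lam) (dualHookTableaux d lam μ)) {xs = support} x∈)
      ... | lam , lam∈ , x∈′ with ∈-map⁻ (code lam) x∈′ | ∈-support⇒ lam∈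
      ...   | T , T∈ , ≡.refl | μ⊆λ , dλ , ℓ≤n , λ₁≤N with tableau⇒∈-support lam μ⊆λ dλ ℓ≤n λ₁≤N T∈
      ...     | ts , ts∈ , ≡.refl , add = ≡.subst (_∈ runCodes) (code-cong {lamOf ts} add)
                  (∈-map⁺ (λ ts → code (lamOf ts) (adds ts)) ts∈)

      run⊆tableau : ∀ {x} → x ∈ runCodes → x ∈ tableauCodes
      run⊆tableau x∈ with ∈-map⁻ (λ ts → code (lamOf ts) (adds ts)) x∈
      ... | ts , ts∈ , ≡.refl with ∈-rs⁻ ts∈
      ...   | run , _ with FromRun.run⇒tableau {d} {lamOf ts} {μ} (hookOf (lamOf ts) (diag-lamOf run)) hμ {n} {N} d≤n {ts} run (rows-lamOf run)
      ...     | T , T∈ , add = ∈-concatMap⁺ (λ lam → map (code lam) (dualHookTableaux d lam μ))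
                  (lose (∈-support⁺ ts∈) (≡.subst (_∈ map (code (lamOf ts)) (dualHookTableaux d (lamOf ts) μ))
                    (code-cong {lamOf ts} add) (∈-map⁺ (code (lamOf ts)) T∈)))

      codes-↭ : tableauCodes ↭ runCodes
      codes-↭ = unique∧same-members⇒↭ tableauCodes-unique runCodes-unique tableau⊆run run⊆tableau

    module _ (β : Vec ℕ n) (bound : ∀ i → lookup β i ≤ N) where

      open Expansion R a d β

      -- After the whole schedule `κ′` is `N` on upper rows and `n` on lower ones. These are at
      -- least the caps `s ∸ r` and `r ∸ s`, so every column has all its factors.
      finalCol-col : ∀ lam → diag lam ≡ d → rows lam 0 ≤ N → ∀ r → r < n →
        finalCol d n (rows lam r) r ≈ᵁ col (κ′ r) (rows lam r) r
      finalCol-col lam dλ λ₁≤N r r<n k with r <? d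
      ... | yes r<d rewrite κ′-upper r<d | ℕ.m≥n⇒m⊓n≡n (ℕ.≤-trans (ℕ.m∸n≤m (rows lam r) r)
              (ℕ.≤-trans (decreasing-≤ (rows-decreasing lam) (z≤n {r})) λ₁≤N)) = refl
      ... | no r≮d rewrite κ′-lower (ℕ.≮⇒≥ r≮d) r<n
              | ℕ.m≥n⇒m⊓n≡n (ℕ.≤-trans (ℕ.m∸n≤m r (rows lam r)) (ℕ.<⇒≤ r<n)) = refl

      detA≈Δ : ∀ lam → diag lam ≡ d → rows lam 0 ≤ N → detA lam β ≈ Δ κ′ (rows lam)
      detA≈Δ lam dλ λ₁≤N = trans (detA≈ β lam) (trans
        (reflexive (≡.cong (λ d′ → Expansion.alternant R a d′ β (λ r → finalCol d′ n (rows lam r) r)) dλ))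
        (alternant-cong (finalCol-col lam dλ λ₁≤N)))

      -- A summand that depends on the code alone, so that the sums over tableaux and over runs can
      -- be compared under the permutation.
      codeWeight : Code → Carrier
      codeWeight (ps , vs) = prodᴸ weight vs * Δ κ′ (nth ps)

      tableau-side : sumᴸ (λ lam → (sign (m d lam μ) * ψ d lam μ) * detA lam β) support ≈ sumᴸ codeWeight tableauCodes
      tableau-side = begin
        sumᴸ (λ lam → (sign (m d lam μ) * ψ d lam μ) * detA lam β) support
          ≈⟨ sumᴸ-cong support (λ {lam} lam∈ → let (_ , dλ , _ , λ₁≤N) = ∈-support⇒ lam∈ in begin
               (sign (m d lam μ) * ψ d lam μ) * detA lam β
                 ≈⟨ *-cong (signed-ψ lam dλ) (detA≈Δ lam dλ λ₁≤N) ⟩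
               sumᴸ (λ T → prodᴸ (weight ∘ T) (skew lam μ)) (dualHookTableaux d lam μ) * Δ κ′ (rows lam)
                 ≈⟨ sumᴸ-*ʳ _ _ (dualHookTableaux d lam μ) ⟨
               sumᴸ (λ T → prodᴸ (weight ∘ T) (skew lam μ) * Δ κ′ (rows lam)) (dualHookTableaux d lam μ)
                 ≈⟨ sumᴸ-cong (dualHookTableaux d lam μ) (λ {T} _ →
                      *-congʳ (reflexive (≡.sym (prodᴸ-map weight T (skew lam μ))))) ⟩
               sumᴸ (codeWeight ∘ code lam) (dualHookTableaux d lam μ)
                 ≡⟨ sumᴸ-map codeWeight (code lam) (dualHookTableaux d lam μ) ⟨
               sumᴸ codeWeight (map (code lam) (dualHookTableaux d lam μ)) ∎) ⟩
        sumᴸ (λ lam → sumᴸ codeWeight (map (code lam) (dualHookTableaux d lam μ))) support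
          ≈⟨ sumᴸ-concatMap codeWeight _ support ⟨
        sumᴸ codeWeight tableauCodes ∎

      run-side : sumᴸ codeWeight runCodes ≈ Δ (λ _ → 0) (rows μ)
      run-side = begin
        sumᴸ codeWeight runCodes
          ≡⟨ sumᴸ-map codeWeight _ rs ⟩
        sumᴸ (λ ts → codeWeight (code (lamOf ts) (adds ts))) rs
          ≈⟨ sumᴸ-cong rs (λ {ts} ts∈ → let run = proj₁ (∈-rs⁻ ts∈) in
               *-cong (weights run) (Δ-cong {κ′} {κ′} (λ _ → ≡.refl) (λ r → ≡.sym (rows-lamOf run r)))) ⟩
        sumᴸ (λ ts → runWeight σs ts * Δ κ′ (fin ts)) rs
          -- The runs left out of `rs` end in a first row longer than `N`, so their determinants
          -- vanish.
          ≈⟨ sumᴸ-filter small? _ (runs σs (rows μ)) (λ {ts} ts∈ big → trans (*-congˡ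
               (vanish (∈-runs⁻ σs ts∈) (ℕ.≰⇒> big))) (zeroʳ _)) ⟩
        sumᴸ (λ ts → runWeight σs ts * Δ κ′ (fin ts)) (runs σs (rows μ))
          ≈⟨ expand schedule hμ ⟨
        Δ (λ _ → 0) (rows μ) ∎
        where
        vanish : ∀ {ts} → Run σs (rows μ) ts → N < fin ts 0 → Δ κ′ (fin ts) ≈ 0#
        vanish {ts} run N< = Δ≈0 β bound d κ′ (fin ts) 0<n N<
          where
          0<n : 0 < n
          0<n with 0 <? n
          ... | yes p = p
          ... | no ¬p = contradiction (fin-beyond run (ℕ.≮⇒≥ ¬p)) (≡.≢-sym (ℕ.<⇒≢ (ℕ.≤-<-trans z≤n N<)))
        weights : ∀ {ts} → Run σs (rows μ) ts →
          prodᴸ weight (map (adds ts) (skew (lamOf ts) μ)) ≈ runWeight σs ts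
        weights {ts} run = begin
          prodᴸ weight (map (adds ts) (skew (lamOf ts) μ))
            ≡⟨ prodᴸ-map weight (adds ts) (skew (lamOf ts) μ) ⟩
          prodᴸ (weight ∘ adds ts) (skew (lamOf ts) μ)
            ≈⟨ prodᴸ-↭ (weight ∘ adds ts) (unique∧same-members⇒↭ (skew-unique (lamOf ts) μ) (newBoxes-unique run)
                 (λ b∈ → new (∈-skew⁻ (lamOf ts) μ b∈)) (λ b∈ → old (∈-newBoxes⁻ run b∈))) ⟩
          prodᴸ (weight ∘ adds ts) (newBoxes σs (rows μ) ts)
            ≈⟨ prod-run run d β ⟩
          runWeight σs ts ∎
          where
          new : ∀ {b} → InSkew (lamOf ts) μ b → b ∈ newBoxes σs (rows μ) ts
          new (r , ≡.refl , p , q) = ∈-newBoxes⁺ run p (≡.subst (_ ≤_) (≡.sym (rows-lamOf run r)) q)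
          old : ∀ {b} → (∃[ r ] proj₁ b ≡ suc r × rows μ r < proj₂ b × proj₂ b ≤ fin ts r) → b ∈ skew (lamOf ts) μ
          old (r , ≡.refl , p , q) = ∈-skew⁺ (lamOf ts) μ p (≡.subst (_ ≤_) (rows-lamOf run r) q)

      determinant-expansion :
        sumᴸ (λ lam → (sign (m d lam μ) * ψ d lam μ) * detA lam β) support ≈ detX μ β
      determinant-expansion = begin
        sumᴸ (λ lam → (sign (m d lam μ) * ψ d lam μ) * detA lam β) support ≈⟨ tableau-side ⟩
        sumᴸ codeWeight tableauCodes   ≈⟨ sumᴸ-↭ codeWeight codes-↭ ⟩
        sumᴸ codeWeight runCodes       ≈⟨ run-side ⟩
        Δ (λ _ → 0) (rows μ)           ≈⟨ detX≈ β d μ ⟨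
        detX μ β                       ∎

  -- From determinants to Schur functions

  ratio-≤ : ∀ lam M {n} (α : Vec ℕ n) → ℓ lam ≤ n →
    ratio lam M n α ≡ (S.det (λ i j → M n i (suc (toℕ j))) ÷Δ) α
  ratio-≤ lam M {n} α ℓ≤n rewrite dec-true (ℓ lam ≤? n) ℓ≤n = ≡.refl

  ratio-> : ∀ lam M {n} (α : Vec ℕ n) → ¬ ℓ lam ≤ n → ratio lam M n α ≡ 0#
  ratio-> lam M {n} α ℓ≰n rewrite dec-false (ℓ lam ≤? n) ℓ≰n = ≡.refl

  lookup≤sum : ∀ {n} (β : Vec ℕ n) i → lookup β i ≤ Vec.sum β
  lookup≤sum (b ∷ β) zero    = ℕ.m≤m+n b _
  lookup≤sum (b ∷ β) (suc i) = ℕ.≤-trans (lookup≤sum β i) (ℕ.m≤n+m _ b)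

  common-bound : ∀ {n} (L : List (Vec ℕ n)) → ∃[ N ] ∀ {β} → β ∈ L → ∀ i → lookup β i ≤ N
  common-bound []      = 0 , λ ()
  common-bound (β ∷ L) with common-bound L
  ... | N , bound = Vec.sum β ℕ.+ N , λ
    { (here ≡.refl) i → ℕ.≤-trans (lookup≤sum β i) (ℕ.m≤m+n _ N)
    ; (there β∈)    i → ℕ.≤-trans (bound β∈ i) (ℕ.m≤n+m N _) }

  -- The list `L` of exponents depends on `α` and not on the shape, which yields one bound `N` and
  -- with it a finite support for all λ at once. If `ℓ μ` exceeds `n`, every λ containing μ is too
  -- long as well and all terms are 0.
  schur-expansion : (μ : Partition) →
    SumsTo (λ lam → μ ⊆ lam × diag lam ≡ diag μ)
           (λ lam → scale (sign (m (diag μ) lam μ) * ψ (diag μ) lam μ) (ŝ lam))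
           (s μ)
  schur-expansion μ n α with ℓ μ ≤? n
  ... | no ℓ≰n = [] , [] , [] , (λ lam (μ⊆λ , _) _ → trans
          (*-congˡ (reflexive (ratio-> lam (A lam) α (ℓ≰n ∘ ℕ.≤-trans (⊆⇒ℓ≤ℓ {μ} {lam} μ⊆λ))))) (zeroʳ _))
        , reflexive (≡.sym (ratio-> μ (λ n i j → X i S.^ (part μ j ℕ.+ n ∸ j)) α ℓ≰n))
  ... | yes ℓ≤n with ÷Δ-sum α
  ...   | L , ÷Δ≈ with common-bound L
  ...     | N , bound = F , support-unique N μ ℓ≤n
            , All.tabulate (λ lam∈ → let (p , q , _) = ∈-support⇒ N μ ℓ≤n lam∈ in p , q)
            , outside , total
    where
    d = diag μ
    F = support N μ ℓ≤n
    c[_] : Partition → Carrier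
    c[ lam ] = sign (m d lam μ) * ψ d lam μ

    ŝ≈ : ∀ lam → ℓ lam ≤ n → ŝ lam n α ≈ sumᴸ (detA lam) L
    ŝ≈ lam ℓλ≤n = trans (reflexive (ratio-≤ lam (A lam) α ℓλ≤n)) (÷Δ≈ _)

    -- Such a term vanishes for one of three reasons: λ has more than `n` rows, there is no tableau,
    -- or the first row exceeds all exponents in `L`.
    outside : ∀ lam → μ ⊆ lam × diag lam ≡ d → lam ∉ F → c[ lam ] * ŝ lam n α ≈ 0#
    outside lam (μ⊆λ , dλ) lam∉ with ℓ lam ≤? n | rows lam 0 ≤? N
    ... | no ℓλ≰n  | _ = trans (*-congˡ (reflexive (ratio-> lam (A lam) α ℓλ≰n))) (zeroʳ _)
    ... | yes ℓλ≤n | yes λ₁≤N = trans (*-congʳ (trans (*-congˡ (ψ≈0 N μ ℓ≤n lam μ⊆λ dλ ℓλ≤n λ₁≤N lam∉)) (zeroʳ _))) (zeroˡ _)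
    ... | yes ℓλ≤n | no λ₁≰N = trans (*-congˡ (trans (ŝ≈ lam ℓλ≤n)
            (sumᴸ≈0 L λ {β} β∈ → detA≈0 β (bound β∈) lam ℓλ≤n (ℕ.≰⇒> λ₁≰N)))) (zeroʳ _)

    total : sumᴸ (λ lam → c[ lam ] * ŝ lam n α) F ≈ s μ n α
    total = begin
      sumᴸ (λ lam → c[ lam ] * ŝ lam n α) F
        ≈⟨ sumᴸ-cong F (λ {lam} lam∈ → let (_ , _ , ℓλ≤n , _) = ∈-support⇒ N μ ℓ≤n lam∈ in
             trans (*-congˡ (ŝ≈ lam ℓλ≤n)) (sym (sumᴸ-*ˡ c[ lam ] (detA lam) L))) ⟩
      sumᴸ (λ lam → sumᴸ (λ β → c[ lam ] * detA lam β) L) F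
        ≈⟨ sumᴸ-comm (λ lam β → c[ lam ] * detA lam β) F L ⟩
      sumᴸ (λ β → sumᴸ (λ lam → c[ lam ] * detA lam β) F) L
        ≈⟨ sumᴸ-cong L (λ {β} β∈ → determinant-expansion N μ ℓ≤n β (bound β∈)) ⟩
      sumᴸ (detX μ) L
        ≈⟨ ÷Δ≈ (detX μ) ⟨
      (detX μ ÷Δ) α
        ≡⟨ ratio-≤ μ (λ n i j → X i S.^ (part μ j ℕ.+ n ∸ j)) α ℓ≤n ⟨
      s μ n α ∎

open import Data.Product using (_×_)
open import Relation.Binary.PropositionalEquality using (_≡_)
open import Defs

theorem3p20 : (d : ℕ) (μ : Partition) → diag μ ≡ d →
    SumsTo (λ lam → μ ⊆ lam × diag lam ≡ d)
    (λ lam → scale (sign (m d lam μ) ⊗ ψ d lam μ) (ŝ lam))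
    (s μ)
theorem3p20 d μ ≡.refl = SchurExpansion.schur-expansion ℚ[a] var μ
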